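{- For each $n\ge 3$ let $T_n$ be a $2$-dimensional determinantal hypertree on the vertex set $[n]=\{1,\dots,n\}$. Then \[\frac{\dim H_1(T_n,\mathbb{F}_2)}{n^2}\] converges to $0$ in probability as $n\to\infty$.
   Context: A $2$-dimensional simplicial complex $S$ on the vertex set $[n]$ is a (2-dimensional) hypertree if (a) $S$ has complete $1$-skeleton (all $\binom n2$ edges), (b) $S$ has exactly $\binom{n-1}{2}$ triangular faces, and (c) the homology group $H_1(S,\mathbb{Z})$ is finite. By Kalai's formula, $\sum_S |H_1(S,\mathbb{Z})|^2 = n^{\binom{n-2}{2}}$, the sum over all hypertrees on $[n]$. A determinantal hypertree $T_n$ is a random hypertree on $[n]$ such that each hypertree $S$ is chosen with probability $|H_1(S,\mathbb{Z})|^2 / n^{\binom{n-2}{2}}$. -}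

module Defs where

open import Level using (Level)
open import Data.Nat as ℕ using (ℕ; zero; suc; _<ᵇ_; _^_)
open import Data.Fin as Fin using (Fin; _<?_; _≟_)
open import Data.Fin.Base using (cast)
open import Data.Bool using (Bool; true; false; if_then_else_; _∧_)
open import Data.List as List using (List; []; _∷_; [_]; concatMap; allFin; length; lookup)
open import Data.Vec as Vec using (Vec; []; _∷_)
open import Data.Product using (Σ; _×_; _,_; ∃)
open import Relation.Nullary using (¬_)
open import Relation.Nullary.Decidable using (⌊_⌋)
open import Relation.Binary.PropositionalEquality using (_≡_; _≢_)
open import Algebra.Bundles using (CommutativeRing)
open import Data.Integer.Properties using (+-*-commutativeRing)
open import Data.Bool.Properties using (xor-∧-commutativeRing)
open import Data.Nat.Combinatorics using (_C_)

edgeList : (n : ℕ) → List (Fin n × Fin n)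
edgeList n = concatMap (λ i → concatMap (λ j →
  if ⌊ i <? j ⌋ then [ (i , j) ] else []) (allFin n)) (allFin n)

triangleList : (n : ℕ) → List (Fin n × Fin n × Fin n)
triangleList n = concatMap (λ i → concatMap (λ j → concatMap (λ k →
  if ⌊ i <? j ⌋ ∧ ⌊ j <? k ⌋ then [ (i , j , k) ] else [])
  (allFin n)) (allFin n)) (allFin n)

Edge : ℕ → Set
Edge n = Fin (length (edgeList n))

Tri : ℕ → Set
Tri n = Fin (length (triangleList n))

numTri : ℕ → ℕ
numTri n = length (triangleList n)

edge : ∀ n → Edge n → Fin n × Fin n
edge n e = lookup (edgeList n) e

tri : ∀ n → Tri n → Fin n × Fin n × Fin n
tri n t = lookup (triangleList n) t

-- A 2-dimensional complex with complete 1-skeleton on [n] is given by its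
-- set of triangular faces: a subset of all triangles.
Complex : ℕ → Set
Complex n = Vec Bool (numTri n)

faces : ∀ {m} → Vec Bool m → ℕ
faces [] = 0
faces (true ∷ v) = suc (faces v)
faces (false ∷ v) = faces v

allSubsets : (m : ℕ) → List (Vec Bool m)
allSubsets zero = [] ∷ []
allSubsets (suc m) = concatMap (λ v → (true ∷ v) ∷ (false ∷ v) ∷ []) (allSubsets m)

eqPair : ∀ {n} → Fin n × Fin n → Fin n × Fin n → Bool
eqPair (a , b) (c , d) = ⌊ a ≟ c ⌋ ∧ ⌊ b ≟ d ⌋

module Chains {c ℓ : Level} (R : CommutativeRing c ℓ) (n : ℕ) where
  open CommutativeRing R

  Σ[_] : ∀ {m} → (Fin m → Carrier) → Carrier
  Σ[_] {zero} f = 0#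
  Σ[_] {suc m} f = f Fin.zero + Σ[_] (λ i → f (Fin.suc i))

  C1 : ℕ → Set c
  C1 n = Edge n → Carrier

  C2 : ℕ → Set c
  C2 n = Tri n → Carrier

  -- coefficient of vertex v in ∂[a,b] = [b] - [a]
  inc1 : Edge n → Fin n → Carrier
  inc1 e v with edge n e
  ... | (a , b) = if ⌊ v ≟ b ⌋ then 1# else (if ⌊ v ≟ a ⌋ then - 1# else 0#)

  -- coefficient of edge e in ∂[i,j,k] = [j,k] - [i,k] + [i,j]
  inc2 : Tri n → Edge n → Carrier
  inc2 t e with tri n t
  ... | (i , j , k) =
    if eqPair (edge n e) (j , k) then 1# else
    (if eqPair (edge n e) (i , k) then - 1# else
    (if eqPair (edge n e) (i , j) then 1# else 0#))

  IsCycle : C1 n → Set ℓ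
  IsCycle z = ∀ (v : Fin n) → Σ[ (λ e → z e * inc1 e v) ] ≈ 0#

  ∂₂ : Complex n → C2 n → C1 n
  ∂₂ S b e = Σ[ (λ t → if Vec.lookup S t then b t * inc2 t e else 0#) ]

  Homologous : Complex n → C1 n → C1 n → Set (c Level.⊔ ℓ)
  Homologous S z w = ∃ λ b → ∀ e → z e ≈ w e + ∂₂ S b e

  HasOrder : Complex n → ℕ → Set (c Level.⊔ ℓ)
  HasOrder S k = Σ (Fin k → C1 n) λ r →
      (∀ i → IsCycle (r i))
    × (∀ i j → i ≢ j → ¬ Homologous S (r i) (r j))
    × (∀ z → IsCycle z → ∃ λ i → Homologous S z (r i))

  HasDim : Complex n → ℕ → Set (c Level.⊔ ℓ)
  HasDim S d = Σ (Fin d → C1 n) λ v →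
      (∀ i → IsCycle (v i))
    × (∀ (a : Fin d → Carrier) → Homologous S (λ e → Σ[ (λ i → a i * v i e) ]) (λ e → 0#)
         → ∀ i → a i ≈ 0#)
    × (∀ z → IsCycle z → ∃ λ (a : Fin d → Carrier) →
         Homologous S z (λ e → Σ[ (λ i → a i * v i e) ]))

module Zc (n : ℕ) = Chains +-*-commutativeRing n
module F2 (n : ℕ) = Chains xor-∧-commutativeRing n

-- S is a 2-dimensional hypertree on [n]: complete 1-skeleton (built in),
-- exactly C(n-1,2) triangles, and H₁(S; ℤ) finite.
IsHypertree : ∀ n → Complex n → Set
IsHypertree n S = (faces S ≡ (n ℕ.∸ 1) C 2) × ∃ λ k → Zc.HasOrder n S k

-- h is the function S ↦ |H₁(S;ℤ)| on hypertrees and 0 on non-hypertrees,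
-- so that h S ^ 2 / n ^ C(n-2,2) is the determinantal probability of S.
IsTorsionOrderFn : ((n : ℕ) → Complex n → ℕ) → Set
IsTorsionOrderFn h = ∀ n (S : Complex n) →
  (IsHypertree n S → Zc.HasOrder n S (h n S)) × (¬ IsHypertree n S → h n S ≡ 0)

IsF2BettiFn : ((n : ℕ) → Complex n → ℕ) → Set
IsF2BettiFn d = ∀ n (S : Complex n) → F2.HasDim n S (d n S)

sumℕ : List ℕ → ℕ
sumℕ = List.foldr ℕ._+_ 0

-- n ^ C(n-2,2) times P( dim H₁(T_n;𝔽₂) / n² > p / q )
--   = Σ over complexes S with q·d(S) > p·n² of h(S)²
weightAbove : (h d : (n : ℕ) → Complex n → ℕ) → (p q n : ℕ) → ℕ
weightAbove h d p q n = sumℕ (List.map (λ S →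
  if (p ℕ.* (n ℕ.* n)) <ᵇ (q ℕ.* d n S) then h n S ℕ.* h n S else 0)
  (allSubsets (numTri n)))

normalizer : ℕ → ℕ
normalizer n = n ^ ((n ℕ.∸ 2) C 2)

{-# OPTIONS --safe #-}
-- Let m = C(n-1,2). Deleting the edges at vertex 0 from the boundary matrix of a
-- hypertree S leaves an m × m integer matrix whose cokernel is H₁(S;ℤ), so |H₁(S;ℤ)|
-- is at most the absolute value of its determinant, a maximal minor of the reduced
-- boundary matrix B of the complete complex.  Over 𝔽₂, 2^dim H₁(S;𝔽₂) is at most the
-- number of f ∈ 𝔽₂^edges that are cocycles of S, that is, for which S only uses the
-- triangles on which f is even.  Summing |H₁(S;ℤ)|² 2^dim H₁(S;𝔽₂) over S and exchanging
-- the sums leaves, for each f, the sum of the squared maximal minors of B restricted to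
-- the even triangles of f.  By Hadamard's inequality this is at most the product over the
-- edges e = uv avoiding 0 of
--   D_e(f) = #{ w : f(uw) + f(vw) = f(uv) }.
-- It remains to see that Σ_f Π_e D_e(f) ≤ n^m 2^{o(n²)}, since n^m exceeds the normalizer
-- only by the factor n^(n-2), and then Markov's inequality applies.
--
-- Sample a sequence W of K vertices and estimate D_e / n by Laplace's rule of succession
-- (X_e + 1) / (K + 2), where X_e counts the w in W with f(uw) + f(vw) = f(uv).  Since the
-- mean of 1 / (X_e + 1) is at most n / ((K + 1) D_e), AM-GM yields for every f some W with
--   Π_e D_e / n ≤ Π_e (X_e + 1) / (K + 1).
-- The X_e depend on f only through the rows of f at W and through the bits f(uv).  With
-- these rows fixed, the two possible values of X_e + 1 add up to K + 2, so the sum over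
-- the bits factorizes, and there are only 2^(nK) choices of rows and n^K choices of W.
-- Hence Σ_f Π_e D_e ≤ n^m ((K + 2) / (K + 1))^m n^K 2^(nK + n), where K is an arbitrary
-- constant.
module Submission where

-- Bounding each D_e by n only yields Σ_f Π_e D_e ≤ 2^C(n,2) n^m, so a factor 2 has to be gained at
-- almost every edge. Its source: flipping f(uv) exchanges the vertices w ≠ u, v that D_uv counts
-- with those that it does not count. But D_uv also depends on the whole rows of u and v, so the
-- exact product does not split along the bits of f. A sample of constant size separates the two
-- roles of f: the rows at W are guessed, and each bit f(uv) then acts on the factor of uv alone.
-- Laplace's rule is preferred to X_e / K because X_e can be 0, while 1 / (X_e + 1) stays bounded.
-- With K + 2 = 2q the loss ((K + 2) / (K + 1))^m is at most 2^(1 + m/q), where m/q is at most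
-- n²/2q. This is half of the available exponent n²/q, and everything else is 2^O(n log n). Only
-- inequalities are needed, so cokernels are merely covered, and dimensions over 𝔽₂ are compared by
-- counting. Squared minors are summed as the squared norm of an exterior product, which makes
-- Hadamard's inequality an induction on rows without Gram determinants.

open import Defs

-- Finite sums and products in a commutative semiring.

module Sums where

  open import Level using (0ℓ)
  open import Algebra.Bundles using (CommutativeSemiring)
  open import Data.Nat as ℕ using (zero; suc)
  open import Data.Fin as Fin using (Fin; zero; suc)
  open import Data.Bool using (Bool; true; false)
  open import Data.List as List using (List; []; _∷_; _++_; concatMap; map; allFin)
  open import Data.List.Properties using (map-tabulate)
  open import Data.Vec as Vec using (Vec; []; _∷_)
  open import Relation.Binary.PropositionalEquality as ≡ using (_≡_; _≢_)
  import Algebra.Properties.CommutativeSemigroup as CommutativeSemigroup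

  -- The head varies fastest, as in `allSubsets`, so that `vecs bools` is that very list and not
  -- just a permutation of it.
  vecs : {A : Set} → List A → ∀ m → List (Vec A m)
  vecs l zero = [] ∷ []
  vecs l (suc m) = concatMap (λ v → map (_∷ v) l) (vecs l m)

  bools : List Bool
  bools = true ∷ false ∷ []

  allSubsets-vecs : ∀ m → allSubsets m ≡ vecs bools m
  allSubsets-vecs zero = ≡.refl
  allSubsets-vecs (suc m) = ≡.cong (concatMap (λ v → (true ∷ v) ∷ (false ∷ v) ∷ [])) (allSubsets-vecs m)

  module Sum (R : CommutativeSemiring 0ℓ 0ℓ) where
    open CommutativeSemiring R hiding (zero)
    open CommutativeSemigroup +-commutativeSemigroup using (interchange)

    ∑ : {A : Set} → List A → (A → Carrier) → Carrier
    ∑ [] φ = 0#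
    ∑ (x ∷ l) φ = φ x + ∑ l φ

    ∑-cong : {A : Set} (l : List A) {φ ψ : A → Carrier} → (∀ x → φ x ≈ ψ x) → ∑ l φ ≈ ∑ l ψ
    ∑-cong [] p = refl
    ∑-cong (x ∷ l) p = +-cong (p x) (∑-cong l p)

    ∑-zero : {A : Set} (l : List A) → ∑ l (λ _ → 0#) ≈ 0#
    ∑-zero [] = refl
    ∑-zero (x ∷ l) = trans (+-identityˡ _) (∑-zero l)

    ∑-+ : {A : Set} (l : List A) (φ ψ : A → Carrier) → ∑ l (λ x → φ x + ψ x) ≈ ∑ l φ + ∑ l ψ
    ∑-+ [] φ ψ = sym (+-identityˡ 0#)
    ∑-+ (x ∷ l) φ ψ = trans (+-congˡ (∑-+ l φ ψ)) (interchange (φ x) (ψ x) _ _)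

    ∑-*ˡ : {A : Set} (l : List A) → ∀ c (φ : A → Carrier) → ∑ l (λ x → c * φ x) ≈ c * ∑ l φ
    ∑-*ˡ [] c φ = sym (zeroʳ c)
    ∑-*ˡ (x ∷ l) c φ = trans (+-congˡ (∑-*ˡ l c φ)) (sym (distribˡ c _ _))

    ∑-*ʳ : {A : Set} (l : List A) → ∀ c (φ : A → Carrier) → ∑ l (λ x → φ x * c) ≈ ∑ l φ * c
    ∑-*ʳ l c φ = trans (∑-cong l (λ x → *-comm (φ x) c)) (trans (∑-*ˡ l c φ) (*-comm c _))

    ∑-swap : {A B : Set} (l : List A) (m : List B) (φ : A → B → Carrier) →
      ∑ l (λ x → ∑ m (φ x)) ≈ ∑ m (λ y → ∑ l (λ x → φ x y))
    ∑-swap [] m φ = sym (∑-zero m)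
    ∑-swap (x ∷ l) m φ = trans (+-congˡ (∑-swap l m φ)) (sym (∑-+ m (φ x) _))

    ∑-++ : {A : Set} (l m : List A) (φ : A → Carrier) → ∑ (l ++ m) φ ≈ ∑ l φ + ∑ m φ
    ∑-++ [] m φ = sym (+-identityˡ _)
    ∑-++ (x ∷ l) m φ = trans (+-congˡ (∑-++ l m φ)) (sym (+-assoc _ _ _))

    ∑-map : {A B : Set} (f : A → B) (l : List A) (φ : B → Carrier) → ∑ (map f l) φ ≈ ∑ l (λ x → φ (f x))
    ∑-map f [] φ = refl
    ∑-map f (x ∷ l) φ = +-congˡ (∑-map f l φ)

    ∑-concatMap : {A B : Set} (f : A → List B) (l : List A) (φ : B → Carrier) →
      ∑ (concatMap f l) φ ≈ ∑ l (λ x → ∑ (f x) φ)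
    ∑-concatMap f [] φ = refl
    ∑-concatMap f (x ∷ l) φ = trans (∑-++ (f x) (concatMap f l) φ) (+-congˡ (∑-concatMap f l φ))

    ∑-vecs-suc : {A : Set} (l : List A) → ∀ m (φ : Vec A (suc m) → Carrier) →
      ∑ (vecs l (suc m)) φ ≈ ∑ (vecs l m) (λ v → ∑ l (λ x → φ (x ∷ v)))
    ∑-vecs-suc l m φ = trans (∑-concatMap _ (vecs l m) φ) (∑-cong (vecs l m) (λ v → ∑-map (_∷ v) l φ))

    ∑-allFin-suc : ∀ n (φ : Fin (suc n) → Carrier) → ∑ (allFin (suc n)) φ ≈ φ zero +
        ∑ (allFin n) (λ i → φ (suc i))
    ∑-allFin-suc n φ = +-congˡ (trans (reflexive (≡.cong (λ l → ∑ l φ) (≡.sym (map-tabulate (λ i → i) suc))))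
      (∑-map suc (allFin n) φ))

    ∑-allFin-single : ∀ {n} (a : Fin n) (φ : Fin n → Carrier) → (∀ i → i ≢ a → φ i ≈ 0#) → ∑ (allFin n) φ ≈ φ a
    ∑-allFin-single {suc n} zero φ p = trans (∑-allFin-suc n φ)
      (trans (+-congˡ (trans (∑-cong (allFin n) (λ i → p (suc i) λ ())) (∑-zero (allFin n)))) (+-identityʳ _))
    ∑-allFin-single {suc n} (suc a) φ p = trans (∑-allFin-suc n φ)
      (trans (+-cong (p zero λ ())
          (∑-allFin-single a (λ i → φ (suc i)) (λ i i≢ → p (suc i) λ { ≡.refl → i≢ ≡.refl })))
        (+-identityˡ _))

    ∏ : ∀ {m} → (Fin m → Carrier) → Carrier
    ∏ {zero} g = 1#
    ∏ {suc m} g = g zero * ∏ (λ i → g (suc i))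

    -- Distributivity. This is how the sum over all f factorizes over the edges once each factor
    -- depends on its own bit.
    ∑-∏ : {A : Set} (l : List A) → ∀ m (g : Fin m → A → Carrier) →
      ∑ (vecs l m) (λ v → ∏ (λ i → g i (Vec.lookup v i))) ≈ ∏ (λ i → ∑ l (g i))
    ∑-∏ l zero g = +-identityʳ _
    ∑-∏ l (suc m) g = trans (∑-vecs-suc l m _)
      (trans (∑-cong (vecs l m) (λ v → ∑-*ʳ l (∏ (λ i → g (suc i) (Vec.lookup v i))) (g zero)))
        (trans (∑-*ˡ (vecs l m) (∑ l (g zero)) _) (*-congˡ (∑-∏ l m (λ i → g (suc i))))))

-- Sums of natural numbers: monotonicity and membership.

module NatSums where

  open Sums
  open import Data.Nat as ℕ using (ℕ; zero; suc; _+_; _*_; _≤_; z≤n)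
  open import Data.Nat.Properties
  open import Data.Bool using (Bool; true; false; if_then_else_)
  open import Data.List as List using (List; []; _∷_; map)
  open import Data.List.Membership.Propositional using (_∈_)
  open import Data.List.Membership.Propositional.Properties using (∈-concatMap⁺; ∈-map⁺)
  open import Data.List.Relation.Unary.Any as Any using (here; there)
  open import Data.Fin using (Fin; zero; suc)
  open import Data.Vec as Vec using (Vec; []; _∷_)
  open import Relation.Binary.PropositionalEquality

  open Sum +-*-commutativeSemiring public

  ⟦_⟧ : Bool → ℕ
  ⟦ b ⟧ = if b then 1 else 0

  ∑-mono : {A : Set} (l : List A) {φ ψ : A → ℕ} → (∀ x → φ x ≤ ψ x) → ∑ l φ ≤ ∑ l ψ
  ∑-mono [] p = z≤n
  ∑-mono (x ∷ l) p = +-mono-≤ (p x) (∑-mono l p)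

  ∑-∈ : {A : Set} {l : List A} {x : A} → x ∈ l → (φ : A → ℕ) → φ x ≤ ∑ l φ
  ∑-∈ {l = _ ∷ l} (here refl) φ = m≤m+n _ _
  ∑-∈ {l = y ∷ l} (there p) φ = ≤-trans (∑-∈ p φ) (m≤n+m _ (φ y))

  ∈-vecs : {A : Set} {l : List A} → (∀ x → x ∈ l) → ∀ {m} (v : Vec A m) → v ∈ vecs l m
  ∈-vecs all [] = here refl
  ∈-vecs {l = l} all (x ∷ v) = ∈-concatMap⁺ (λ v → map (_∷ v) l)
    (Any.map (λ { refl → ∈-map⁺ (_∷ v) (all x) }) (∈-vecs all v))

  ∈-bools : ∀ b → b ∈ bools
  ∈-bools true = here refl
  ∈-bools false = there (here refl)

  ∑-const : {A : Set} (l : List A) → ∀ c → ∑ l (λ _ → c) ≡ List.length l * c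
  ∑-const [] c = refl
  ∑-const (x ∷ l) c = cong (c +_) (∑-const l c)

  ∏-cong : ∀ {m} {g h : Fin m → ℕ} → (∀ i → g i ≡ h i) → ∏ g ≡ ∏ h
  ∏-cong {zero} p = refl
  ∏-cong {suc m} p = cong₂ _*_ (p zero) (∏-cong (λ i → p (suc i)))

-- Exterior algebra over ℤ in coordinates, and Hadamard's inequality.

module Exterior where

  open import Data.Nat as ℕ using (ℕ; zero; suc)
  open import Data.Bool using (Bool; true; false)
  open import Data.Integer hiding (suc)
  open import Data.Integer.Properties
  open import Data.Integer.Tactic.RingSolver using (solve-∀)
  open import Data.Vec as Vec using (Vec; []; _∷_; zipWith)
  open import Relation.Binary.PropositionalEquality

  -- An element of the exterior algebra of ℤ^N: the value at S is the coefficient of the wedge of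
  -- the basis vectors in S. Degrees are not tracked.
  Form : ℕ → Set
  Form N = Vec Bool N → ℤ

  infixr 7 _∧ᶠ_
  -- Left multiplication by a vector. A later basis vector has to pass the first one if that one is
  -- in S, whence the minus sign.
  _∧ᶠ_ : ∀ {N} → Vec ℤ N → Form N → Form N
  ([] ∧ᶠ ω) S = 0ℤ
  ((x ∷ r) ∧ᶠ ω) (true ∷ S) = x * ω (false ∷ S) - (r ∧ᶠ (λ T → ω (true ∷ T))) S
  ((x ∷ r) ∧ᶠ ω) (false ∷ S) = (r ∧ᶠ (λ T → ω (false ∷ T))) S

  -- Contraction by a vector, the adjoint of left multiplication. Its norm is exactly what one step
  -- of Hadamard's inequality gives away.
  ι : ∀ {N} → Vec ℤ N → Form N → Form N
  ι [] ω S = 0ℤ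
  ι (x ∷ r) ω (true ∷ S) = - ι r (λ T → ω (true ∷ T)) S
  ι (x ∷ r) ω (false ∷ S) = x * ω (true ∷ S) + ι r (λ T → ω (false ∷ T)) S

  ∫ : ∀ {N} → Form N → ℤ
  ∫ {zero} ω = ω []
  ∫ {suc N} ω = ∫ (λ S → ω (true ∷ S)) + ∫ (λ S → ω (false ∷ S))

  ‖_‖² : ∀ {N} → Vec ℤ N → ℤ
  ‖ [] ‖² = 0ℤ
  ‖ x ∷ r ‖² = x * x + ‖ r ‖²

  ∧ᶠ-cong : ∀ {N} (r : Vec ℤ N) {ω ω′ : Form N} → ω ≗ ω′ → r ∧ᶠ ω ≗ r ∧ᶠ ω′
  ∧ᶠ-cong [] p S = refl
  ∧ᶠ-cong (x ∷ r) p (true ∷ S) =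
    cong₂ (λ a b → x * a - b) (p (false ∷ S)) (∧ᶠ-cong r (λ T → p (true ∷ T)) S)
  ∧ᶠ-cong (x ∷ r) p (false ∷ S) = ∧ᶠ-cong r (λ T → p (false ∷ T)) S

  ∧ᶠ-linear : ∀ {N} (r : Vec ℤ N) a b (ω ω′ : Form N) S →
    (r ∧ᶠ (λ T → a * ω T + b * ω′ T)) S ≡ a * (r ∧ᶠ ω) S + b * (r ∧ᶠ ω′) S
  ∧ᶠ-linear [] a b ω ω′ S = lemma a b
    where
    lemma : ∀ a b → 0ℤ ≡ a * 0ℤ + b * 0ℤ
    lemma = solve-∀
  ∧ᶠ-linear (x ∷ r) a b ω ω′ (true ∷ S) =
    trans (cong (λ z → x * (a * ω (false ∷ S) + b * ω′ (false ∷ S)) - z) (∧ᶠ-linear r a b _ _ S))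
          (lemma a b x _ _ _ _)
    where
    lemma : ∀ a b x u v w z →
      x * (a * u + b * v) - (a * w + b * z) ≡ a * (x * u - w) + b * (x * v - z)
    lemma = solve-∀
  ∧ᶠ-linear (x ∷ r) a b ω ω′ (false ∷ S) = ∧ᶠ-linear r a b _ _ S

  ∧ᶠ-zero : ∀ {N} (r : Vec ℤ N) S → (r ∧ᶠ (λ _ → 0ℤ)) S ≡ 0ℤ
  ∧ᶠ-zero r S = trans (∧ᶠ-linear r 0ℤ 0ℤ (λ _ → 0ℤ) (λ _ → 0ℤ) S) refl

  ∧ᶠ-scale : ∀ {N} (r : Vec ℤ N) a (ω : Form N) S → (r ∧ᶠ (λ T → a * ω T)) S ≡ a * (r ∧ᶠ ω) S
  ∧ᶠ-scale r a ω S =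
    trans (∧ᶠ-cong r (λ T → sym (+-identityʳ (a * ω T))) S)
          (trans (∧ᶠ-linear r a 0ℤ ω (λ _ → 0ℤ) S) (+-identityʳ _))

  _+[_]_ : ∀ {N} → Vec ℤ N → ℤ → Vec ℤ N → Vec ℤ N
  r +[ q ] s = zipWith (λ x y → x + q * y) r s

  ∧ᶠ-row : ∀ {N} (r : Vec ℤ N) q s (ω : Form N) S →
    ((r +[ q ] s) ∧ᶠ ω) S ≡ (r ∧ᶠ ω) S + q * (s ∧ᶠ ω) S
  ∧ᶠ-row [] q [] ω S = lemma q
    where
    lemma : ∀ q → 0ℤ ≡ 0ℤ + q * 0ℤ
    lemma = solve-∀
  ∧ᶠ-row (x ∷ r) q (y ∷ s) ω (true ∷ S) =
    trans (cong (λ z → (x + q * y) * ω (false ∷ S) - z) (∧ᶠ-row r q s _ S)) (lemma x q y _ _ _)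
    where
    lemma : ∀ x q y u v w → (x + q * y) * u - (v + q * w) ≡ x * u - v + q * (y * u - w)
    lemma = solve-∀
  ∧ᶠ-row (x ∷ r) q (y ∷ s) ω (false ∷ S) = ∧ᶠ-row r q s _ S

  ∧ᶠ-anticomm : ∀ {N} (r s : Vec ℤ N) (ω : Form N) S →
    (r ∧ᶠ s ∧ᶠ ω) S ≡ - (s ∧ᶠ r ∧ᶠ ω) S
  ∧ᶠ-anticomm [] [] ω S = refl
  ∧ᶠ-anticomm (x ∷ r) (y ∷ s) ω (true ∷ S) = begin
    x * (s ∧ᶠ ω₀) S - (r ∧ᶠ (λ T → y * ω₀ T - (s ∧ᶠ ω₁) T)) S
      ≡⟨ cong (λ z → x * (s ∧ᶠ ω₀) S - z) (expand r y s) ⟩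
    x * (s ∧ᶠ ω₀) S - (y * (r ∧ᶠ ω₀) S + -1ℤ * (r ∧ᶠ s ∧ᶠ ω₁) S)
      ≡⟨ cong (λ z → x * (s ∧ᶠ ω₀) S - (y * (r ∧ᶠ ω₀) S + -1ℤ * z)) (∧ᶠ-anticomm r s ω₁ S) ⟩
    x * (s ∧ᶠ ω₀) S - (y * (r ∧ᶠ ω₀) S + -1ℤ * - (s ∧ᶠ r ∧ᶠ ω₁) S)
      ≡⟨ lemma x y _ _ _ ⟩
    - (y * (r ∧ᶠ ω₀) S - (x * (s ∧ᶠ ω₀) S + -1ℤ * (s ∧ᶠ r ∧ᶠ ω₁) S))
      ≡⟨ cong (λ z → - (y * (r ∧ᶠ ω₀) S - z)) (expand s x r) ⟨
    - (y * (r ∧ᶠ ω₀) S - (s ∧ᶠ (λ T → x * ω₀ T - (r ∧ᶠ ω₁) T)) S) ∎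
    where
    open ≡-Reasoning
    ω₀ = λ T → ω (false ∷ T)
    ω₁ = λ T → ω (true ∷ T)
    lemma : ∀ x y u v w → x * u - (y * v + -1ℤ * - w) ≡ - (y * v - (x * u + -1ℤ * w))
    lemma = solve-∀
    minus : ∀ u v → u - v ≡ u + -1ℤ * v
    minus = solve-∀
    expand : ∀ r y s → (r ∧ᶠ (λ T → y * ω₀ T - (s ∧ᶠ ω₁) T)) S ≡
                       y * (r ∧ᶠ ω₀) S + -1ℤ * (r ∧ᶠ s ∧ᶠ ω₁) S
    expand r y s = trans (∧ᶠ-cong r (λ T → minus (y * ω₀ T) ((s ∧ᶠ ω₁) T)) S)
                         (∧ᶠ-linear r y -1ℤ ω₀ (s ∧ᶠ ω₁) S)
  ∧ᶠ-anticomm (x ∷ r) (y ∷ s) ω (false ∷ S) = ∧ᶠ-anticomm r s _ S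

  -- Anticommutativity gives z = - z, and ℤ has no 2-torsion.
  ∧ᶠ-square : ∀ {N} (r : Vec ℤ N) (ω : Form N) S → (r ∧ᶠ r ∧ᶠ ω) S ≡ 0ℤ
  ∧ᶠ-square r ω S = self-minus _ (∧ᶠ-anticomm r r ω S)
    where
    self-minus : ∀ z → z ≡ - z → z ≡ 0ℤ
    self-minus (+ zero) p = refl
    self-minus +[1+ n ] ()
    self-minus -[1+ n ] ()

  ∫-cong : ∀ {N} {ω ω′ : Form N} → ω ≗ ω′ → ∫ ω ≡ ∫ ω′
  ∫-cong {zero} p = p []
  ∫-cong {suc N} p = cong₂ _+_ (∫-cong (λ S → p (true ∷ S))) (∫-cong (λ S → p (false ∷ S)))

  ∫-linear : ∀ N a b (ω ω′ : Form N) → ∫ (λ S → a * ω S + b * ω′ S) ≡ a * ∫ ω + b * ∫ ω′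
  ∫-linear zero a b ω ω′ = refl
  ∫-linear (suc N) a b ω ω′ = trans (cong₂ _+_ (∫-linear N a b ω₁ ω′₁) (∫-linear N a b ω₀ ω′₀))
    (lemma a b (∫ ω₁) (∫ ω′₁) (∫ ω₀) (∫ ω′₀))
    where
    ω₀ = λ T → ω (false ∷ T)
    ω₁ = λ T → ω (true ∷ T)
    ω′₀ = λ T → ω′ (false ∷ T)
    ω′₁ = λ T → ω′ (true ∷ T)
    lemma : ∀ a b u v w z → (a * u + b * v) + (a * w + b * z) ≡ a * (u + w) + b * (v + z)
    lemma = solve-∀

  ∫-zero : ∀ N → ∫ {N} (λ _ → 0ℤ) ≡ 0ℤ
  ∫-zero N = ∫-linear N 0ℤ 0ℤ (λ _ → 0ℤ) (λ _ → 0ℤ)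

  ∫-mono : ∀ {N} {ω ω′ : Form N} → (∀ S → ω S ≤ ω′ S) → ∫ ω ≤ ∫ ω′
  ∫-mono {zero} p = p []
  ∫-mono {suc N} p = +-mono-≤ (∫-mono (λ S → p (true ∷ S))) (∫-mono (λ S → p (false ∷ S)))

  ⟪_,_⟫ : ∀ {N} → Form N → Form N → ℤ
  ⟪ ω , ω′ ⟫ = ∫ (λ S → ω S * ω′ S)

  adjoint : ∀ {N} (r : Vec ℤ N) (ω ω′ : Form N) → ⟪ r ∧ᶠ ω , ω′ ⟫ ≡ ⟪ ω , ι r ω′ ⟫
  adjoint [] ω ω′ = sym (*-zeroʳ (ω []))
  adjoint {suc N} (x ∷ r) ω ω′ = begin
    ∫ (λ S → (x * ω₀ S - (r ∧ᶠ ω₁) S) * ω′₁ S) + ⟪ r ∧ᶠ ω₀ , ω′₀ ⟫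
      ≡⟨ cong (_+ ⟪ r ∧ᶠ ω₀ , ω′₀ ⟫)
           (trans (∫-cong (λ S → l₁ x (ω₀ S) ((r ∧ᶠ ω₁) S) (ω′₁ S))) (∫-linear N x -1ℤ _ _)) ⟩
    x * ⟪ ω₀ , ω′₁ ⟫ + -1ℤ * ⟪ r ∧ᶠ ω₁ , ω′₁ ⟫ + ⟪ r ∧ᶠ ω₀ , ω′₀ ⟫
      ≡⟨ cong₂ (λ u v → x * ⟪ ω₀ , ω′₁ ⟫ + -1ℤ * u + v) (adjoint r ω₁ ω′₁) (adjoint r ω₀ ω′₀) ⟩
    x * ⟪ ω₀ , ω′₁ ⟫ + -1ℤ * ⟪ ω₁ , ι r ω′₁ ⟫ + ⟪ ω₀ , ι r ω′₀ ⟫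
      ≡⟨ l₂ (x * ⟪ ω₀ , ω′₁ ⟫) ⟪ ω₁ , ι r ω′₁ ⟫ ⟪ ω₀ , ι r ω′₀ ⟫ ⟩
    (-1ℤ * ⟪ ω₁ , ι r ω′₁ ⟫ + 0ℤ * ⟪ ω₁ , ι r ω′₁ ⟫) + (x * ⟪ ω₀ , ω′₁ ⟫ + 1ℤ * ⟪ ω₀ , ι r ω′₀ ⟫)
      ≡⟨ cong₂ _+_
           (trans (∫-cong (λ S → l₃ (ω₁ S) (ι r ω′₁ S))) (∫-linear N -1ℤ 0ℤ _ (λ S → ω₁ S * ι r ω′₁ S)))
           (trans (∫-cong (λ S → l₄ (ω₀ S) x (ω′₁ S) (ι r ω′₀ S))) (∫-linear N x 1ℤ _ _)) ⟨
    ∫ (λ S → ω₁ S * - ι r ω′₁ S) + ∫ (λ S → ω₀ S * (x * ω′₁ S + ι r ω′₀ S)) ∎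
    where
    open ≡-Reasoning
    ω₀ = λ T → ω (false ∷ T)
    ω₁ = λ T → ω (true ∷ T)
    ω′₀ = λ T → ω′ (false ∷ T)
    ω′₁ = λ T → ω′ (true ∷ T)
    l₁ : ∀ x u v w → (x * u - v) * w ≡ x * (u * w) + -1ℤ * (v * w)
    l₁ = solve-∀
    l₂ : ∀ u v w → u + -1ℤ * v + w ≡ (-1ℤ * v + 0ℤ * v) + (u + 1ℤ * w)
    l₂ = solve-∀
    l₃ : ∀ u v → u * - v ≡ -1ℤ * (u * v) + 0ℤ * (u * v)
    l₃ = solve-∀
    l₄ : ∀ u x v w → u * (x * v + w) ≡ x * (u * v) + 1ℤ * (u * w)
    l₄ = solve-∀

  -- The Clifford relation between wedge and contraction, paired with ω. Splitting by membership of
  -- the first index leaves the cross terms ⟪ r ∧ ω₁ , ω₀ ⟫ and ⟪ ω₁ , ι r ω₀ ⟫ with opposite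
  -- coefficients, and `adjoint` cancels them.
  wedge-norm : ∀ {N} (r : Vec ℤ N) (ω : Form N) →
    ⟪ r ∧ᶠ ω , r ∧ᶠ ω ⟫ + ⟪ ι r ω , ι r ω ⟫ ≡ ‖ r ‖² * ⟪ ω , ω ⟫
  wedge-norm [] ω = sym (*-zeroˡ (ω [] * ω []))
  wedge-norm {suc N} (x ∷ r) ω = begin
    (∫ (λ S → (x * ω₀ S - (r ∧ᶠ ω₁) S) * (x * ω₀ S - (r ∧ᶠ ω₁) S)) + c₀) +
    (∫ (λ S → - ι r ω₁ S * - ι r ω₁ S) + ∫ (λ S → (x * ω₁ S + ι r ω₀ S) * (x * ω₁ S + ι r ω₀ S)))
      ≡⟨ cong₂ (λ u v → (u + c₀) + v)
           (trans (∫-cong (λ S → l₁ x (ω₀ S) ((r ∧ᶠ ω₁) S)))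
             (trans (∫-linear N 1ℤ (- (x + x)) _ _)
               (cong (λ u → 1ℤ * u + - (x + x) * ⟪ r ∧ᶠ ω₁ , ω₀ ⟫) (∫-linear N (x * x) 1ℤ _ _))))
           (cong₂ _+_ (∫-cong (λ S → l₂ (ι r ω₁ S)))
             (trans (∫-cong (λ S → l₃ x (ω₁ S) (ι r ω₀ S)))
               (trans (∫-linear N 1ℤ (x + x) _ _)
                 (cong (λ u → 1ℤ * u + (x + x) * ⟪ ω₁ , ι r ω₀ ⟫) (∫-linear N (x * x) 1ℤ _ _))))) ⟩
    ((1ℤ * (x * x * ⟪ ω₀ , ω₀ ⟫ + 1ℤ * c₁) + - (x + x) * ⟪ r ∧ᶠ ω₁ , ω₀ ⟫) + c₀) +
    (i₁ + (1ℤ * (x * x * ⟪ ω₁ , ω₁ ⟫ + 1ℤ * i₀) + (x + x) * ⟪ ω₁ , ι r ω₀ ⟫))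
      ≡⟨ cong (λ u → ((1ℤ * (x * x * ⟪ ω₀ , ω₀ ⟫ + 1ℤ * c₁) + - (x + x) * u) + c₀) +
           (i₁ + (1ℤ * (x * x * ⟪ ω₁ , ω₁ ⟫ + 1ℤ * i₀) + (x + x) * ⟪ ω₁ , ι r ω₀ ⟫))) (adjoint r ω₁ ω₀) ⟩
    ((1ℤ * (x * x * ⟪ ω₀ , ω₀ ⟫ + 1ℤ * c₁) + - (x + x) * ⟪ ω₁ , ι r ω₀ ⟫) + c₀) +
    (i₁ + (1ℤ * (x * x * ⟪ ω₁ , ω₁ ⟫ + 1ℤ * i₀) + (x + x) * ⟪ ω₁ , ι r ω₀ ⟫))
      ≡⟨ l₄ x ⟪ ω₀ , ω₀ ⟫ ⟪ ω₁ , ω₁ ⟫ c₀ c₁ i₀ i₁ ⟪ ω₁ , ι r ω₀ ⟫ ⟩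
    x * x * (⟪ ω₁ , ω₁ ⟫ + ⟪ ω₀ , ω₀ ⟫) + ((c₁ + i₁) + (c₀ + i₀))
      ≡⟨ cong (λ u → x * x * (⟪ ω₁ , ω₁ ⟫ + ⟪ ω₀ , ω₀ ⟫) + u) (cong₂ _+_ (wedge-norm r ω₁) (wedge-norm r ω₀)) ⟩
    x * x * (⟪ ω₁ , ω₁ ⟫ + ⟪ ω₀ , ω₀ ⟫) + (‖ r ‖² * ⟪ ω₁ , ω₁ ⟫ + ‖ r ‖² * ⟪ ω₀ , ω₀ ⟫)
      ≡⟨ l₅ x ‖ r ‖² ⟪ ω₁ , ω₁ ⟫ ⟪ ω₀ , ω₀ ⟫ ⟩
    (x * x + ‖ r ‖²) * (⟪ ω₁ , ω₁ ⟫ + ⟪ ω₀ , ω₀ ⟫) ∎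
    where
    open ≡-Reasoning
    ω₀ = λ T → ω (false ∷ T)
    ω₁ = λ T → ω (true ∷ T)
    c₀ = ⟪ r ∧ᶠ ω₀ , r ∧ᶠ ω₀ ⟫
    c₁ = ⟪ r ∧ᶠ ω₁ , r ∧ᶠ ω₁ ⟫
    i₀ = ⟪ ι r ω₀ , ι r ω₀ ⟫
    i₁ = ⟪ ι r ω₁ , ι r ω₁ ⟫
    l₁ : ∀ x u v → (x * u - v) * (x * u - v) ≡ 1ℤ * (x * x * (u * u) + 1ℤ * (v * v)) + - (x + x) * (v * u)
    l₁ = solve-∀
    l₂ : ∀ u → - u * - u ≡ u * u
    l₂ = solve-∀
    l₃ : ∀ x u v → (x * u + v) * (x * u + v) ≡ 1ℤ * (x * x * (u * u) + 1ℤ * (v * v)) + (x + x) * (u * v)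
    l₃ = solve-∀
    l₄ : ∀ x a b c₀ c₁ i₀ i₁ z →
      ((1ℤ * (x * x * a + 1ℤ * c₁) + - (x + x) * z) + c₀) +
      (i₁ + (1ℤ * (x * x * b + 1ℤ * i₀) + (x + x) * z))
      ≡ x * x * (b + a) + ((c₁ + i₁) + (c₀ + i₀))
    l₄ = solve-∀
    l₅ : ∀ x r a b → x * x * (a + b) + (r * a + r * b) ≡ (x * x + r) * (a + b)
    l₅ = solve-∀

  square-nonneg : ∀ z → 0ℤ ≤ z * z
  square-nonneg (+ n) = subst (0ℤ ≤_) (pos-* n n) (+≤+ ℕ.z≤n)
  square-nonneg -[1+ n ] = +≤+ ℕ.z≤n

  ∣∣-square : ∀ z → + (∣ z ∣ ℕ.* ∣ z ∣) ≡ z * z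
  ∣∣-square (+ n) = pos-* n n
  ∣∣-square -[1+ n ] = refl

  ∫-nonneg : ∀ {N} {ω : Form N} → (∀ S → 0ℤ ≤ ω S) → 0ℤ ≤ ∫ ω
  ∫-nonneg {N} {ω} p = subst (_≤ ∫ ω) (∫-zero N) (∫-mono p)

  ‖‖²-nonneg : ∀ {N} (r : Vec ℤ N) → 0ℤ ≤ ‖ r ‖²
  ‖‖²-nonneg [] = ≤-refl
  ‖‖²-nonneg (x ∷ r) = +-mono-≤ (square-nonneg x) (‖‖²-nonneg r)

  wedge-norm-≤ : ∀ {N} (r : Vec ℤ N) (ω : Form N) → ⟪ r ∧ᶠ ω , r ∧ᶠ ω ⟫ ≤ ‖ r ‖² * ⟪ ω , ω ⟫
  wedge-norm-≤ r ω = subst₂ _≤_ (+-identityʳ _) (wedge-norm r ω)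
    (+-monoʳ-≤ ⟪ r ∧ᶠ ω , r ∧ᶠ ω ⟫ (∫-nonneg (λ S → square-nonneg (ι r ω S))))

  vacuum : ∀ {N} → Form N
  vacuum [] = 1ℤ
  vacuum (true ∷ S) = 0ℤ
  vacuum (false ∷ S) = vacuum S

  vacuum-norm : ∀ N → ⟪ vacuum {N} , vacuum ⟫ ≡ 1ℤ
  vacuum-norm zero = refl
  vacuum-norm (suc N) = cong₂ _+_ (∫-zero N) (vacuum-norm N)

  -- minors R S is the determinant of R on the columns S if S has m elements, and 0 otherwise.
  minors : ∀ {N m} → Vec (Vec ℤ N) m → Form N
  minors [] = vacuum
  minors (r ∷ R) = r ∧ᶠ minors R

  -- The left side is the sum of the squares of all maximal minors. By `wedge-norm-≤` each row
  -- multiplies it by at most its own squared length.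
  hadamard : ∀ {N m} (R : Vec (Vec ℤ N) m) →
    ⟪ minors R , minors R ⟫ ≤ Vec.foldr′ (λ r p → ‖ r ‖² * p) 1ℤ R
  hadamard {N} [] = ≤-reflexive (vacuum-norm N)
  hadamard (r ∷ R) = ≤-trans (wedge-norm-≤ r (minors R))
    (*-monoˡ-≤-nonNeg ‖ r ‖² {{nonNegative (‖‖²-nonneg r)}} (hadamard R))

  res : ∀ {A : Set} {N} (S : Vec Bool N) → Vec A N → Vec A (faces S)
  res [] [] = []
  res (true ∷ S) (x ∷ r) = x ∷ res S r
  res (false ∷ S) (x ∷ r) = res S r

  embed : ∀ {N} (S : Vec Bool N) → Vec Bool (faces S) → Vec Bool N
  embed [] [] = []
  embed (true ∷ S) (b ∷ T) = b ∷ embed S T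
  embed (false ∷ S) T = false ∷ embed S T

  wedge-embed : ∀ {N} (S : Vec Bool N) r (ω : Form N) T →
    (r ∧ᶠ ω) (embed S T) ≡ (res S r ∧ᶠ (λ U → ω (embed S U))) T
  wedge-embed [] [] ω [] = refl
  wedge-embed (true ∷ S) (x ∷ r) ω (true ∷ T) =
    cong (λ z → x * ω (false ∷ embed S T) - z) (wedge-embed S r (λ U → ω (true ∷ U)) T)
  wedge-embed (true ∷ S) (x ∷ r) ω (false ∷ T) = wedge-embed S r _ T
  wedge-embed (false ∷ S) (x ∷ r) ω T = wedge-embed S r _ T

  vacuum-embed : ∀ {N} (S : Vec Bool N) T → vacuum (embed S T) ≡ vacuum T
  vacuum-embed [] [] = refl
  vacuum-embed (true ∷ S) (true ∷ T) = refl
  vacuum-embed (true ∷ S) (false ∷ T) = vacuum-embed S T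
  vacuum-embed (false ∷ S) T = vacuum-embed S T

  -- The coefficient at a subset of S involves no column outside S.
  minors-embed : ∀ {N m} (R : Vec (Vec ℤ N) m) S T →
    minors R (embed S T) ≡ minors (Vec.map (res S) R) T
  minors-embed [] S T = vacuum-embed S T
  minors-embed (r ∷ R) S T =
    trans (wedge-embed S r (minors R) T) (∧ᶠ-cong (res S r) (minors-embed R S) T)

  trues : ∀ N → Vec Bool N
  trues N = Vec.replicate N true

  embed-trues : ∀ {N} (S : Vec Bool N) → embed S (trues (faces S)) ≡ S
  embed-trues [] = refl
  embed-trues (true ∷ S) = cong (true ∷_) (embed-trues S)
  embed-trues (false ∷ S) = cong (false ∷_) (embed-trues S)

  det : ∀ {N m} → Vec (Vec ℤ N) m → ℤ
  det {N} R = minors R (trues N)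

  minors-det : ∀ {N m} (R : Vec (Vec ℤ N) m) S → minors R S ≡ det (Vec.map (res S) R)
  minors-det R S = trans (cong (minors R) (sym (embed-trues S))) (minors-embed R S (trues (faces S)))

-- Integral row reduction: the cokernel has at most |det| elements.

module Cokernel where

  open Exterior
  open import Data.Nat as ℕ using (ℕ; zero; suc)
  import Data.Nat.Properties as ℕₚ
  open import Data.Nat.Induction using (<-wellFounded)
  open import Induction.WellFounded using (Acc; acc)
  open import Data.Fin as Fin using (Fin; toℕ; fromℕ<; combine; remQuot)
  open import Data.Fin.Properties using (pigeonhole; toℕ-fromℕ<; remQuot-combine)
  open import Data.Bool using (true; false)
  open import Data.Integer hiding (suc; _/_; _%_)
  open import Data.Integer.Properties
  open import Data.Integer.DivMod using (_/_; _%_; a≡a%n+[a/n]*n; n%d<d)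
  open import Data.Integer.Tactic.RingSolver using (solve-∀)
  open import Data.Product using (Σ; ∃; ∃₂; _,_; proj₁; proj₂)
  open import Data.Vec as Vec using (Vec; []; _∷_; zipWith; map)
  open import Data.Vec.Properties using (∷-injectiveˡ)
  open import Data.Empty using (⊥; ⊥-elim)
  open import Relation.Nullary using (¬_)
  open import Relation.Binary.PropositionalEquality

  -- Row operations are kept as syntax, so that one operation can act both on a matrix and on the
  -- vectors of the module that contains its image.
  data RowOp : ℕ → Set where
    idle  : ∀ {m} → RowOp m
    _⨾_   : ∀ {m} → RowOp m → RowOp m → RowOp m
    under : ∀ {m} → RowOp m → RowOp (suc m)
    swap  : ∀ {m} → RowOp (suc (suc m))
    add   : ∀ {m} → ℤ → RowOp (suc (suc m))

  act : ∀ {X : Set} → (X → ℤ → X → X) → ∀ {m} → RowOp m → Vec X m → Vec X m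
  act _⊞[_]_ idle xs = xs
  act _⊞[_]_ (o ⨾ p) xs = act _⊞[_]_ p (act _⊞[_]_ o xs)
  act _⊞[_]_ (under o) (x ∷ xs) = x ∷ act _⊞[_]_ o xs
  act _⊞[_]_ swap (x ∷ y ∷ xs) = y ∷ x ∷ xs
  act _⊞[_]_ (add q) (x ∷ y ∷ xs) = (x ⊞[ q ] y) ∷ y ∷ xs

  inverse : ∀ {m} → RowOp m → RowOp m
  inverse idle = idle
  inverse (o ⨾ p) = inverse p ⨾ inverse o
  inverse (under o) = under (inverse o)
  inverse swap = swap
  inverse (add q) = add (- q)

  _⊞ℤ[_]_ : ℤ → ℤ → ℤ → ℤ
  x ⊞ℤ[ q ] y = x + q * y

  actᶻ : ∀ {m} → RowOp m → Vec ℤ m → Vec ℤ m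
  actᶻ = act _⊞ℤ[_]_

  actᴿ : ∀ {N m} → RowOp m → Vec (Vec ℤ N) m → Vec (Vec ℤ N) m
  actᴿ = act _+[_]_

  act-inverse : ∀ {m} (o : RowOp m) y → actᶻ o (actᶻ (inverse o) y) ≡ y
  act-inverse idle y = refl
  act-inverse (o ⨾ p) y = trans (cong (actᶻ p) (act-inverse o (actᶻ (inverse p) y))) (act-inverse p y)
  act-inverse (under o) (x ∷ y) = cong (x ∷_) (act-inverse o y)
  act-inverse swap (x ∷ y ∷ ys) = refl
  act-inverse (add q) (x ∷ y ∷ ys) = cong (_∷ y ∷ ys) (lemma x q y)
    where
    lemma : ∀ x q y → x + - q * y + q * y ≡ x
    lemma = solve-∀

  inverse-act : ∀ {m} (o : RowOp m) y → actᶻ (inverse o) (actᶻ o y) ≡ y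
  inverse-act idle y = refl
  inverse-act (o ⨾ p) y = trans (cong (actᶻ (inverse o)) (inverse-act p (actᶻ o y))) (inverse-act o y)
  inverse-act (under o) (x ∷ y) = cong (x ∷_) (inverse-act o y)
  inverse-act swap (x ∷ y ∷ ys) = refl
  inverse-act (add q) (x ∷ y ∷ ys) = cong (_∷ y ∷ ys) (lemma x q y)
    where
    lemma : ∀ x q y → x + q * y + - q * y ≡ x
    lemma = solve-∀

  infixl 6 _⊕_
  _⊕_ : ∀ {m} → Vec ℤ m → Vec ℤ m → Vec ℤ m
  _⊕_ = zipWith _+_

  act-⊕ : ∀ {m} (o : RowOp m) y z → actᶻ o (y ⊕ z) ≡ actᶻ o y ⊕ actᶻ o z
  act-⊕ idle y z = refl
  act-⊕ (o ⨾ p) y z = trans (cong (actᶻ p) (act-⊕ o y z)) (act-⊕ p (actᶻ o y) (actᶻ o z))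
  act-⊕ (under o) (x ∷ y) (x′ ∷ z) = cong (x + x′ ∷_) (act-⊕ o y z)
  act-⊕ swap (x ∷ x′ ∷ y) (z ∷ z′ ∷ w) = refl
  act-⊕ (add q) (x ∷ x′ ∷ y) (z ∷ z′ ∷ w) = cong (_∷ x′ + z′ ∷ y ⊕ w) (lemma x z q x′ z′)
    where
    lemma : ∀ x z q x′ z′ → x + z + q * (x′ + z′) ≡ x + q * x′ + (z + q * z′)
    lemma = solve-∀

  dot : ∀ {N} → Vec ℤ N → Vec ℤ N → ℤ
  dot [] [] = 0ℤ
  dot (x ∷ r) (y ∷ b) = x * y + dot r b

  dot-row : ∀ {N} (r : Vec ℤ N) q s b → dot (r +[ q ] s) b ≡ dot r b + q * dot s b
  dot-row [] q [] [] = sym (trans (+-identityˡ _) (*-zeroʳ q))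
  dot-row (x ∷ r) q (y ∷ s) (z ∷ b) =
    trans (cong (λ u → (x + q * y) * z + u) (dot-row r q s b)) (lemma x q y z (dot r b) (dot s b))
    where
    lemma : ∀ x q y z u v → (x + q * y) * z + (u + q * v) ≡ x * z + u + q * (y * z + v)
    lemma = solve-∀

  infixl 7 _·_
  _·_ : ∀ {N m} → Vec (Vec ℤ N) m → Vec ℤ N → Vec ℤ m
  A · b = map (λ r → dot r b) A

  act-· : ∀ {N m} (o : RowOp m) (A : Vec (Vec ℤ N) m) b → actᴿ o A · b ≡ actᶻ o (A · b)
  act-· idle A b = refl
  act-· (o ⨾ p) A b = trans (act-· p (actᴿ o A) b) (cong (actᶻ p) (act-· o A b))
  act-· (under o) (r ∷ A) b = cong (dot r b ∷_) (act-· o A b)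
  act-· swap (r ∷ s ∷ A) b = refl
  act-· (add q) (r ∷ s ∷ A) b = cong (_∷ dot s b ∷ A · b) (dot-row r q s b)

  -- In other words, the cokernel of A has at most k elements.
  Cover : ∀ {N m} → Vec (Vec ℤ N) m → ℕ → Set
  Cover {N} {m} A k = Σ (Fin k → Vec ℤ m) λ rep → ∀ y → ∃₂ λ i b → y ≡ rep i ⊕ A · b

  cover-act : ∀ {N m k} (o : RowOp m) (A : Vec (Vec ℤ N) m) → Cover A k → Cover (actᴿ o A) k
  cover-act o A (rep , cov) = (λ i → actᶻ o (rep i)) , λ y →
    let i , b , eq = cov (actᶻ (inverse o) y) in
    i , b , (begin
      y                                   ≡⟨ act-inverse o y ⟨
      actᶻ o (actᶻ (inverse o) y)         ≡⟨ cong (actᶻ o) eq ⟩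
      actᶻ o (rep i ⊕ A · b)              ≡⟨ act-⊕ o (rep i) (A · b) ⟩
      actᶻ o (rep i) ⊕ actᶻ o (A · b)     ≡⟨ cong (actᶻ o (rep i) ⊕_) (act-· o A b) ⟨
      actᶻ o (rep i) ⊕ actᴿ o A · b       ∎)
    where open ≡-Reasoning

  cover-unact : ∀ {N m k} (o : RowOp m) (A : Vec (Vec ℤ N) m) → Cover (actᴿ o A) k → Cover A k
  cover-unact o A (rep , cov) = (λ i → actᶻ (inverse o) (rep i)) , λ y →
    let i , b , eq = cov (actᶻ o y) in
    i , b , (begin
      y                                              ≡⟨ inverse-act o y ⟨
      actᶻ (inverse o) (actᶻ o y)
          ≡⟨ cong (actᶻ (inverse o)) (trans eq (cong (rep i ⊕_) (act-· o A b))) ⟩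
      actᶻ (inverse o) (rep i ⊕ actᶻ o (A · b))      ≡⟨ act-⊕ (inverse o) (rep i) _ ⟩
      actᶻ (inverse o) (rep i) ⊕ actᶻ (inverse o) (actᶻ o (A · b))
                                                     ≡⟨ cong (actᶻ (inverse o) (rep i) ⊕_)
                                                         (inverse-act o (A · b)) ⟩
      actᶻ (inverse o) (rep i) ⊕ A · b               ∎)
    where open ≡-Reasoning

  sgn : ∀ {m} → RowOp m → ℤ
  sgn idle = 1ℤ
  sgn (o ⨾ p) = sgn p * sgn o
  sgn (under o) = sgn o
  sgn swap = -1ℤ
  sgn (add q) = 1ℤ

  ∣sgn∣ : ∀ {m} (o : RowOp m) → ∣ sgn o ∣ ≡ 1
  ∣sgn∣ idle = refl
  ∣sgn∣ (o ⨾ p) = trans (abs-* (sgn p) (sgn o)) (cong₂ ℕ._*_ (∣sgn∣ p) (∣sgn∣ o))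
  ∣sgn∣ (under o) = ∣sgn∣ o
  ∣sgn∣ swap = refl
  ∣sgn∣ (add q) = refl

  minors-act : ∀ {N m} (o : RowOp m) (A : Vec (Vec ℤ N) m) S → minors (actᴿ o A) S ≡ sgn o * minors A S
  minors-act idle A S = sym (*-identityˡ _)
  minors-act (o ⨾ p) A S =
    trans (minors-act p (actᴿ o A) S)
      (trans (cong (sgn p *_) (minors-act o A S)) (sym (*-assoc (sgn p) (sgn o) _)))
  minors-act (under o) (r ∷ A) S =
    trans (∧ᶠ-cong r (minors-act o A) S) (∧ᶠ-scale r (sgn o) (minors A) S)
  minors-act swap (r ∷ s ∷ A) S = trans (∧ᶠ-anticomm s r (minors A) S) (sym (-1*i≡-i _))
  minors-act (add q) (r ∷ s ∷ A) S = begin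
    ((r +[ q ] s) ∧ᶠ s ∧ᶠ minors A) S                    ≡⟨ ∧ᶠ-row r q s (s ∧ᶠ minors A) S ⟩
    (r ∧ᶠ s ∧ᶠ minors A) S + q * (s ∧ᶠ s ∧ᶠ minors A) S
        ≡⟨ cong (λ z → (r ∧ᶠ s ∧ᶠ minors A) S + q * z) (∧ᶠ-square s (minors A) S) ⟩
    (r ∧ᶠ s ∧ᶠ minors A) S + q * 0ℤ                      ≡⟨ lemma _ q ⟩
    1ℤ * (r ∧ᶠ s ∧ᶠ minors A) S                          ∎
    where
    open ≡-Reasoning
    lemma : ∀ z q → z + q * 0ℤ ≡ 1ℤ * z
    lemma = solve-∀

  ∣det-act∣ : ∀ {N m} (o : RowOp m) (A : Vec (Vec ℤ N) m) → ∣ det (actᴿ o A) ∣ ≡ ∣ det A ∣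
  ∣det-act∣ o A = begin
    ∣ det (actᴿ o A) ∣        ≡⟨ cong ∣_∣ (minors-act o A _) ⟩
    ∣ sgn o * det A ∣         ≡⟨ abs-* (sgn o) (det A) ⟩
    ∣ sgn o ∣ ℕ.* ∣ det A ∣   ≡⟨ cong (ℕ._* ∣ det A ∣) (∣sgn∣ o) ⟩
    1 ℕ.* ∣ det A ∣           ≡⟨ ℕₚ.*-identityˡ _ ⟩
    ∣ det A ∣                 ∎
    where open ≡-Reasoning

  -- The operation is chosen before the rows `A` are given and leaves them alone, so it may follow
  -- an elimination carried out among the lower rows.
  Reducible : ∀ {N} → ℕ → ℤ → Vec ℤ N → ℤ → Vec ℤ N → Set
  Reducible {N} m x r y s = Σ (RowOp (suc (suc m))) λ o → ∃ λ g → ∃₂ λ r′ s′ → ∀ A →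
    actᴿ o ((x ∷ r) ∷ (y ∷ s) ∷ A) ≡ (g ∷ r′) ∷ (0ℤ ∷ s′) ∷ A

  -- One division of Euclid's algorithm on the leading entries: subtracting x / y times the second
  -- row leaves x % y on top, and a swap restores the order.
  euclid-step : ∀ {N} m x (r : Vec ℤ N) y s .{{_ : NonZero y}} →
    Reducible m y s (+ (x % y)) (r +[ - (x / y) ] s) → Reducible m x r y s
  euclid-step m x r y s (o , g , r′ , s′ , red) =
    (add (- (x / y)) ⨾ (swap ⨾ o)) , g , r′ , s′ , λ A →
    trans (cong (λ z → actᴿ o ((y ∷ s) ∷ (z ∷ (r +[ - (x / y) ] s)) ∷ A)) rem) (red A)
    where
    lemma : ∀ a q y → a + q * y + - q * y ≡ a
    lemma = solve-∀
    rem : x + - (x / y) * y ≡ + (x % y)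
    rem = trans (cong (_+ - (x / y) * y) (a≡a%n+[a/n]*n x y)) (lemma (+ (x % y)) (x / y) y)

  euclid : ∀ {N} m x (r : Vec ℤ N) y s → Acc ℕ._<_ ∣ y ∣ → Reducible m x r y s
  euclid m x r (+ zero) s _ = idle , x , r , s , λ A → refl
  euclid m x r y@(+[1+ _ ]) s (acc rec) =
    euclid-step m x r y s (euclid m y s (+ (x % y)) _ (rec (n%d<d x y)))
  euclid m x r y@(-[1+ _ ]) s (acc rec) =
    euclid-step m x r y s (euclid m y s (+ (x % y)) _ (rec (n%d<d x y)))

  -- The column is cleared from the bottom up: below the first row only one leading entry can be
  -- nonzero after the recursive call, and Euclid's algorithm merges it with the entry on top.
  eliminate : ∀ {N m} (A : Vec (Vec ℤ (suc N)) (suc m)) →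
    Σ (RowOp (suc m)) λ o → ∃₂ λ g r → ∃ λ A′ → actᴿ o A ≡ (g ∷ r) ∷ map (0ℤ ∷_) A′
  eliminate ((g ∷ r) ∷ []) = idle , g , r , [] , refl
  eliminate {m = suc m} ((x ∷ r) ∷ A@(_ ∷ _)) =
    let o , y , s , A′ , eq = eliminate A
        p , g , r′ , s′ , red = euclid m x r y s (<-wellFounded ∣ y ∣)
    in (under o ⨾ p) , g , r′ , s′ ∷ A′ ,
       trans (cong (λ B → actᴿ p ((x ∷ r) ∷ B)) eq) (red (map (0ℤ ∷_) A′))

  dot-0 : ∀ {N m} (A : Vec (Vec ℤ N) m) x b → map (0ℤ ∷_) A · (x ∷ b) ≡ A · b
  dot-0 [] x b = refl
  dot-0 (r ∷ A) x b = cong₂ _∷_ (+-identityˡ (dot r b)) (dot-0 A x b)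

  tail-⊕ : ∀ {m} (y z : Vec ℤ (suc m)) → Vec.tail (y ⊕ z) ≡ Vec.tail y ⊕ Vec.tail z
  tail-⊕ (_ ∷ _) (_ ∷ _) = refl

  cover-tail : ∀ {N m k} r (A : Vec (Vec ℤ N) m) → Cover (r ∷ A) k → Cover A k
  cover-tail r A (rep , cov) = (λ i → Vec.tail (rep i)) , λ y →
    let i , b , eq = cov (0ℤ ∷ y) in i , b , trans (cong Vec.tail eq) (tail-⊕ (rep i) ((r ∷ A) · b))

  cover-drop-zero-column : ∀ {N m k} (A : Vec (Vec ℤ N) m) → Cover (map (0ℤ ∷_) A) k → Cover A k
  cover-drop-zero-column A (rep , cov) = rep , λ y → go y (cov y)
    where
    go : ∀ y → (∃₂ λ i b → y ≡ rep i ⊕ map (0ℤ ∷_) A · b) → ∃₂ λ i b → y ≡ rep i ⊕ A · b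
    go y (i , x ∷ b , eq) = i , b , trans eq (cong (rep i ⊕_) (dot-0 A x b))

  -- With no columns left, k + 1 vectors with distinct first entries cannot be covered by k points.
  -- Otherwise the first column is eliminated and dropped together with the pivot row, which keeps
  -- the matrix tall.
  cover-not-tall : ∀ {N m k} → N ℕ.< m → (A : Vec (Vec ℤ N) m) → ¬ Cover A k
  cover-not-tall {zero} {suc m} {k} _ A (rep , cov) = absurd
    where
    y : Fin (suc k) → Vec ℤ (suc m)
    y j = + toℕ j ∷ Vec.replicate m 0ℤ
    hit : ∀ j → ∃ λ i → y j ≡ rep i ⊕ A · []
    hit j with cov (y j)
    ... | i , [] , eq = i , eq
    absurd : ⊥
    absurd with pigeonhole (ℕₚ.n<1+n k) (λ j → proj₁ (hit j))
    ... | i , j , i<j , eq = ℕₚ.<⇒≢ i<j (+-injective (∷-injectiveˡ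
      (trans (proj₂ (hit i)) (trans (cong (λ l → rep l ⊕ A · []) eq) (sym (proj₂ (hit j)))))))
  cover-not-tall {suc N} {suc m} (ℕ.s≤s N<m) A cov with eliminate A
  ... | o , g , r , A′ , eq = cover-not-tall N<m A′
    (cover-drop-zero-column A′ (cover-tail (g ∷ r) _ (subst (λ B → Cover B _) eq (cover-act o A cov))))

  minors-0-false : ∀ {N m} (A : Vec (Vec ℤ N) m) T → minors (map (0ℤ ∷_) A) (false ∷ T) ≡ minors A T
  minors-0-false [] T = refl
  minors-0-false (r ∷ A) T = ∧ᶠ-cong r (minors-0-false A) T

  minors-0-true : ∀ {N m} (A : Vec (Vec ℤ N) m) T → minors (map (0ℤ ∷_) A) (true ∷ T) ≡ 0ℤ
  minors-0-true [] T = refl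
  minors-0-true (r ∷ A) T = trans
    (cong₂ _-_ (*-zeroˡ (minors (map (0ℤ ∷_) A) (false ∷ T)))
               (trans (∧ᶠ-cong r (minors-0-true A) T) (∧ᶠ-zero r T)))
    refl

  det-block : ∀ {N m} g r (A : Vec (Vec ℤ N) m) → det ((g ∷ r) ∷ map (0ℤ ∷_) A) ≡ g * det A
  det-block {N} g r A = trans
    (cong₂ (λ u v → g * u - v) (minors-0-false A (trues N))
      (trans (∧ᶠ-cong r (minors-0-true A) (trues N)) (∧ᶠ-zero r (trues N))))
    (+-identityʳ _)

  -- The lower rows are solved by the cover of `A`; the free coefficient of the first column then
  -- reduces the top entry modulo the pivot g, which leaves |g| possibilities.
  cover-block : ∀ {N m k} g .{{_ : NonZero g}} r (A : Vec (Vec ℤ N) m) →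
    Cover A k → Cover ((g ∷ r) ∷ map (0ℤ ∷_) A) (∣ g ∣ ℕ.* k)
  cover-block {k = k} g r A (rep , cov) =
    (λ ij → let j , i = remQuot {∣ g ∣} k ij in + toℕ j ∷ rep i) , go
    where
    go : ∀ y → ∃₂ λ ij b → y ≡
      (+ toℕ (proj₁ (remQuot {∣ g ∣} k ij)) ∷ rep (proj₂ (remQuot {∣ g ∣} k ij))) ⊕ ((g ∷ r) ∷ map (0ℤ ∷_) A) · b
    go (y₀ ∷ y) with cov y
    ... | i , b , eq = combine j i , q ∷ b , cong₂ _∷_ head-eq tail-eq
      where
      -- What the top entry still lacks after the columns with coefficients `b` have been used.
      t = y₀ - dot r b
      q = t / g
      j : Fin ∣ g ∣
      j = fromℕ< (n%d<d t g)
      rq : remQuot {∣ g ∣} k (combine j i) ≡ (j , i)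
      rq = remQuot-combine j i
      lemma₁ : ∀ y d → y ≡ y - d + d
      lemma₁ = solve-∀
      lemma₂ : ∀ a q g d → a + q * g + d ≡ a + (g * q + d)
      lemma₂ = solve-∀
      open ≡-Reasoning
      head-eq : y₀ ≡ + toℕ (proj₁ (remQuot {∣ g ∣} k (combine j i))) + (g * q + dot r b)
      head-eq = begin
        y₀                                   ≡⟨ lemma₁ y₀ (dot r b) ⟩
        t + dot r b                          ≡⟨ cong (_+ dot r b) (a≡a%n+[a/n]*n t g) ⟩
        + (t % g) + q * g + dot r b          ≡⟨ lemma₂ (+ (t % g)) q g (dot r b) ⟩
        + (t % g) + (g * q + dot r b)        ≡⟨ cong (λ z → + z + (g * q + dot r b)) (toℕ-fromℕ< (n%d<d t g)) ⟨
        + toℕ j + (g * q + dot r b)          ≡⟨ cong (λ p → + toℕ (proj₁ p) + (g * q + dot r b)) rq ⟨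
        + toℕ (proj₁ (remQuot {∣ g ∣} k (combine j i))) + (g * q + dot r b) ∎
      tail-eq : y ≡ rep (proj₂ (remQuot {∣ g ∣} k (combine j i))) ⊕ map (0ℤ ∷_) A · (q ∷ b)
      tail-eq = begin
        y                                         ≡⟨ eq ⟩
        rep i ⊕ A · b                             ≡⟨ cong₂ _⊕_ (cong (λ p → rep (proj₂ p)) rq) (dot-0 A q b) ⟨
        rep (proj₂ (remQuot {∣ g ∣} k (combine j i))) ⊕ map (0ℤ ∷_) A · (q ∷ b) ∎

  -- After elimination |det A| is the product of the absolute values of the pivots, and each pivot
  -- contributes its absolute value to the size of the cover. The given cover, of whatever size k,
  -- forces the pivots to be nonzero.
  cover-det : ∀ {m k} (A : Vec (Vec ℤ m) m) → Cover A k → Cover A ∣ det A ∣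
  cover-det {zero} [] _ = (λ _ → []) , λ { [] → Fin.zero , [] , refl }
  cover-det {suc m} {k} A cov with eliminate A
  ... | o , g , r , A′ , eq = cover-unact o A (subst₂ Cover (sym eq) size (block g cov′))
    where
    cov′ : Cover ((g ∷ r) ∷ map (0ℤ ∷_) A′) k
    cov′ = subst (λ B → Cover B k) eq (cover-act o A cov)
    size : ∣ g ∣ ℕ.* ∣ det A′ ∣ ≡ ∣ det A ∣
    size = begin
      ∣ g ∣ ℕ.* ∣ det A′ ∣                       ≡⟨ abs-* g (det A′) ⟨
      ∣ g * det A′ ∣                             ≡⟨ cong ∣_∣ (det-block g r A′) ⟨
      ∣ det ((g ∷ r) ∷ map (0ℤ ∷_) A′) ∣         ≡⟨ cong (λ B → ∣ det B ∣) eq ⟨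
      ∣ det (actᴿ o A) ∣                         ≡⟨ ∣det-act∣ o A ⟩
      ∣ det A ∣                                  ∎
      where open ≡-Reasoning
    rest = cover-det A′ (cover-drop-zero-column A′ (cover-tail (g ∷ r) _ cov′))
    block : ∀ g → Cover ((g ∷ r) ∷ map (0ℤ ∷_) A′) k →
      Cover ((g ∷ r) ∷ map (0ℤ ∷_) A′) (∣ g ∣ ℕ.* ∣ det A′ ∣)
    -- A zero pivot makes the whole first column zero; without it, m + 1 rows and only m columns
    -- remain.
    block (+ zero) c = ⊥-elim (cover-not-tall (ℕₚ.n<1+n m) (r ∷ A′) (cover-drop-zero-column (r ∷ A′) c))
    block g@(+[1+ _ ]) c = cover-block g r A′ rest
    block g@(-[1+ _ ]) c = cover-block g r A′ rest

-- The lists of edges and triangles: order, uniqueness, completeness of edges.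

module EdgeLists where

  open import Data.Nat using (ℕ)
  open import Data.Fin as Fin using (Fin; zero; suc; _<_; _<?_)
  open import Data.Bool using (if_then_else_; _∧_)
  open import Data.List using (List; []; _∷_; [_]; concatMap; allFin; lookup)
  open import Data.List.Membership.Propositional using (_∈_)
  open import Data.List.Membership.Propositional.Properties using (∈-allFin; ∈-concatMap⁺; ∈-concatMap⁻; ∈-lookup)
  open import Data.List.Relation.Unary.Any as Any using (Any; here)
  import Data.List.Relation.Unary.Any.Properties as Any
  open import Data.List.Relation.Unary.All as All using (All; []; _∷_)
  import Data.List.Relation.Unary.All.Properties as All
  open import Data.List.Relation.Unary.AllPairs using ([]; _∷_)
  open import Data.List.Relation.Unary.Unique.Propositional using (Unique)
  open import Data.List.Relation.Unary.Unique.Propositional.Properties using (++⁺; allFin⁺)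
  open import Data.Product using (∃; _×_; _,_; proj₁; proj₂)
  open import Relation.Nullary using (yes; no; contradiction)
  open import Relation.Nullary.Decidable using (⌊_⌋)
  open import Relation.Binary.PropositionalEquality using (_≡_; refl; sym; trans; cong)

  concatMap-all : {A B : Set} {P : B → Set} {f : A → List B} → (∀ x → All P (f x)) →
    ∀ xs → All P (concatMap f xs)
  concatMap-all p xs = All.concat⁺ (All.map⁺ (All.universal p xs))

  -- Different blocks are disjoint because `key` recovers from an entry the block to which it
  -- belongs.
  concatMap-unique : {A B : Set} {f : A → List B} (key : B → A) →
    (∀ x → All (λ y → key y ≡ x) (f x)) → (∀ x → Unique (f x)) →
    ∀ {xs} → Unique xs → Unique (concatMap f xs)
  concatMap-unique key keyed uniq {[]} [] = []
  concatMap-unique {f = f} key keyed uniq {x ∷ xs} (x∉xs ∷ u) =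
    ++⁺ (uniq x) (concatMap-unique key keyed uniq u) λ (y∈fx , y∈rest) →
      All.All¬⇒¬Any x∉xs (Any.map
        (λ {z} y∈fz → trans (sym (All.lookup (keyed x) y∈fx)) (All.lookup (keyed z) y∈fz))
        (∈-concatMap⁻ f y∈rest))

  lookup-injective : {A : Set} {xs : List A} → Unique xs → ∀ i j → lookup xs i ≡ lookup xs j → i ≡ j
  lookup-injective (_ ∷ _) zero zero _ = refl
  lookup-injective {xs = _ ∷ xs} (x∉ ∷ _) zero (suc j) eq = contradiction eq
      (All.lookup x∉ (∈-lookup {xs = xs} j))
  lookup-injective {xs = _ ∷ xs} (x∉ ∷ _) (suc i) zero eq = contradiction (sym eq)
      (All.lookup x∉ (∈-lookup {xs = xs} i))
  lookup-injective (_ ∷ u) (suc i) (suc j) eq = cong suc (lookup-injective u i j eq)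

  module _ (n : ℕ) where

    private
      cell : Fin n → Fin n → List (Fin n × Fin n)
      cell i j = if ⌊ i <? j ⌋ then [ (i , j) ] else []

      cell-all : ∀ {P : Fin n × Fin n → Set} i j → (i < j → P (i , j)) → All P (cell i j)
      cell-all i j p with i <? j
      ... | yes i<j = p i<j ∷ []
      ... | no _ = []

      cell-unique : ∀ i j → Unique (cell i j)
      cell-unique i j with i <? j
      ... | yes _ = [] ∷ []
      ... | no _ = []

      cell-∈ : ∀ i j → i < j → (i , j) ∈ cell i j
      cell-∈ i j i<j with i <? j
      ... | yes _ = here refl
      ... | no i≮j = contradiction i<j i≮j

    edge-< : ∀ e → proj₁ (edge n e) < proj₂ (edge n e)
    edge-< e = All.lookup (concatMap-all (λ i → concatMap-all (λ j →
      cell-all i j (λ i<j → i<j)) (allFin n)) (allFin n)) (∈-lookup {xs = edgeList n} e)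

    edge-injective : ∀ e e′ → edge n e ≡ edge n e′ → e ≡ e′
    edge-injective = lookup-injective
      (concatMap-unique proj₁ (λ i → concatMap-all (λ j → cell-all i j (λ _ → refl)) (allFin n))
        (λ i → concatMap-unique proj₂ (λ j → cell-all i j (λ _ → refl)) (cell-unique i) (allFin⁺ n))
        (allFin⁺ n))

    edge-index : ∀ {i j} → i < j → ∃ λ e → edge n e ≡ (i , j)
    edge-index {i} {j} i<j = Any.index mem , sym (Any.lookup-index mem)
      where
      mem : (i , j) ∈ edgeList n
      mem = ∈-concatMap⁺ (λ i → concatMap (cell i) (allFin n)) (Any.map (λ { refl →
              ∈-concatMap⁺ (cell i) (Any.map (λ { refl → cell-∈ i j i<j }) (∈-allFin j)) })
              (∈-allFin i))

    tri-< : ∀ t → let (i , j , k) = tri n t in i < j × j < k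
    tri-< t = All.lookup (concatMap-all (λ i → concatMap-all (λ j → concatMap-all (cell₃ i j)
      (allFin n)) (allFin n)) (allFin n)) (∈-lookup {xs = triangleList n} t)
      where
      cell₃ : ∀ i j k → All (λ (i , j , k) → i < j × j < k)
                (if ⌊ i <? j ⌋ ∧ ⌊ j <? k ⌋ then [ (i , j , k) ] else [])
      cell₃ i j k with i <? j | j <? k
      ... | yes i<j | yes j<k = (i<j , j<k) ∷ []
      ... | yes _ | no _ = []
      ... | no _ | _ = []

-- Sums of chains and the boundary of a triangle, over any commutative ring.

module ChainSums where

  open EdgeLists
  open import Level using (0ℓ)
  open import Algebra.Bundles using (CommutativeRing)
  open import Data.Nat as ℕ using (ℕ; zero; suc)
  open import Data.Fin as Fin using (Fin; zero; suc; _<_; _≟_)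
  open import Data.Fin.Properties using (<⇒≢)
  open import Data.Bool using (true; false; if_then_else_)
  open import Data.Product using (_×_; _,_; proj₁; proj₂)
  open import Data.Empty using (⊥-elim)
  open import Relation.Nullary using (yes; no; contradiction)
  open import Relation.Binary.PropositionalEquality as ≡ using (_≡_; _≢_)
  import Algebra.Properties.CommutativeSemigroup as CommutativeSemigroup
  import Algebra.Properties.Ring as RingProperties
  import Relation.Binary.Reasoning.Setoid as SetoidReasoning

  eqPair-true : ∀ {n} (p q : Fin n × Fin n) → eqPair p q ≡ true → p ≡ q
  eqPair-true (a , b) (c , d) eq with a ≟ c | b ≟ d
  ... | yes ≡.refl | yes ≡.refl = ≡.refl

  eqPair-refl : ∀ {n} (p : Fin n × Fin n) → eqPair p p ≡ true
  eqPair-refl (a , b) with a ≟ a | b ≟ b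
  ... | yes _ | yes _ = ≡.refl
  ... | no a≢a | _ = contradiction ≡.refl a≢a
  ... | yes _ | no b≢b = contradiction ≡.refl b≢b

  module ChainSum (R : CommutativeRing 0ℓ 0ℓ) (n : ℕ) where
    open CommutativeRing R hiding (zero)
    open Chains R n
    open CommutativeSemigroup +-commutativeSemigroup using (interchange)
    open RingProperties ring using (-0#≈0#; -‿+-comm; -‿distribʳ-*)
    open SetoidReasoning setoid

    Σ-cong : ∀ {m} {f g : Fin m → Carrier} → (∀ i → f i ≈ g i) → Σ[ f ] ≈ Σ[ g ]
    Σ-cong {zero} p = refl
    Σ-cong {suc m} p = +-cong (p zero) (Σ-cong (λ i → p (suc i)))

    Σ-zero : ∀ m → Σ[_] {m} (λ _ → 0#) ≈ 0#
    Σ-zero zero = refl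
    Σ-zero (suc m) = trans (+-congˡ (Σ-zero m)) (+-identityˡ 0#)

    Σ-+ : ∀ {m} (f g : Fin m → Carrier) → Σ[ (λ i → f i + g i) ] ≈ Σ[ f ] + Σ[ g ]
    Σ-+ {zero} f g = sym (+-identityˡ 0#)
    Σ-+ {suc m} f g = trans (+-congˡ (Σ-+ (λ i → f (suc i)) (λ i → g (suc i))))
      (interchange (f zero) (g zero) _ _)

    Σ-*ˡ : ∀ {m} c (f : Fin m → Carrier) → Σ[ (λ i → c * f i) ] ≈ c * Σ[ f ]
    Σ-*ˡ {zero} c f = sym (zeroʳ c)
    Σ-*ˡ {suc m} c f = trans (+-congˡ (Σ-*ˡ c (λ i → f (suc i)))) (sym (distribˡ c _ _))

    Σ-*ʳ : ∀ {m} c (f : Fin m → Carrier) → Σ[ (λ i → f i * c) ] ≈ Σ[ f ] * c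
    Σ-*ʳ c f = trans (Σ-cong (λ i → *-comm (f i) c)) (trans (Σ-*ˡ c f) (*-comm c _))

    Σ-neg : ∀ {m} (f : Fin m → Carrier) → Σ[ (λ i → - f i) ] ≈ - Σ[ f ]
    Σ-neg {zero} f = sym -0#≈0#
    Σ-neg {suc m} f = trans (+-congˡ (Σ-neg (λ i → f (suc i)))) (-‿+-comm (f zero) _)

    Σ-swap : ∀ {l m} (f : Fin l → Fin m → Carrier) →
      Σ[ (λ i → Σ[ (λ j → f i j) ]) ] ≈ Σ[ (λ j → Σ[ (λ i → f i j) ]) ]
    Σ-swap {zero} {m} f = sym (Σ-zero m)
    Σ-swap {suc l} f = trans (+-congˡ (Σ-swap (λ i → f (suc i)))) (sym (Σ-+ (f zero) _))

    Σ-single : ∀ {m} (i₀ : Fin m) (f : Fin m → Carrier) → (∀ i → i ≢ i₀ → f i ≈ 0#) → Σ[ f ] ≈ f i₀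
    Σ-single {suc m} zero f p =
      trans (+-congˡ (trans (Σ-cong (λ i → p (suc i) λ ())) (Σ-zero m))) (+-identityʳ _)
    Σ-single {suc m} (suc i₀) f p = trans
      (+-cong (p zero λ ()) (Σ-single i₀ (λ i → f (suc i)) (λ i i≢ → p (suc i) λ { ≡.refl → i≢ ≡.refl })))
      (+-identityˡ _)

    χ : Fin n × Fin n → Edge n → Carrier
    χ p e = if eqPair (edge n e) p then 1# else 0#

    χ-self : ∀ e → χ (edge n e) e ≈ 1#
    χ-self e rewrite eqPair-refl (edge n e) = refl

    χ-off : ∀ p e → edge n e ≢ p → χ p e ≈ 0#
    χ-off p e ne with eqPair (edge n e) p in eq
    ... | true = contradiction (eqPair-true (edge n e) p eq) ne
    ... | false = refl

    Σ-χ : ∀ (g : Edge n → Carrier) e → Σ[ (λ e′ → g e′ * χ (edge n e) e′) ] ≈ g e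
    Σ-χ g e = trans
      (Σ-single e _ λ e′ e′≢e → trans
        (*-congˡ (χ-off (edge n e) e′ (λ eq → e′≢e (edge-injective n e′ e eq)))) (zeroʳ (g e′)))
      (trans (*-congˡ (χ-self e)) (*-identityʳ (g e)))

    -- `inc2` for a triple of vertices instead of an index of `triangleList`, so that cones over
    -- edges can be written down directly.
    ∂Δ : Fin n × Fin n × Fin n → Edge n → Carrier
    ∂Δ (i , j , k) e =
      if eqPair (edge n e) (j , k) then 1# else
      (if eqPair (edge n e) (i , k) then - 1# else
      (if eqPair (edge n e) (i , j) then 1# else 0#))

    inc2-∂Δ : ∀ t e → inc2 t e ≡ ∂Δ (tri n t) e
    inc2-∂Δ t e with tri n t
    ... | _ = ≡.refl

    -- For i < j < k the three tests exclude one another, so the nested conditionals turn into a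
    -- linear expression.
    ∂Δ-χ : ∀ {i j k} → i < j → j < k → ∀ e → ∂Δ (i , j , k) e ≈ χ (j , k) e - χ (i , k) e + χ (i , j) e
    ∂Δ-χ {i} {j} {k} i<j j<k e
      with eqPair (edge n e) (j , k) in jk | eqPair (edge n e) (i , k) in ik | eqPair (edge n e) (i , j) in ij
    ... | true | true | _ = ⊥-elim (<⇒≢ i<j (≡.cong proj₁
            (≡.trans (≡.sym (eqPair-true (edge n e) _ ik)) (eqPair-true (edge n e) _ jk))))
    ... | true | false | true = ⊥-elim (<⇒≢ i<j (≡.cong proj₁
            (≡.trans (≡.sym (eqPair-true (edge n e) _ ij)) (eqPair-true (edge n e) _ jk))))
    ... | false | true | true = ⊥-elim (<⇒≢ j<k (≡.cong proj₂
            (≡.trans (≡.sym (eqPair-true (edge n e) _ ij)) (eqPair-true (edge n e) _ ik))))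
    ... | true | false | false = sym (trans (+-identityʳ _) (trans (+-congˡ -0#≈0#) (+-identityʳ 1#)))
    ... | false | true | false = sym (trans (+-identityʳ _) (+-identityˡ _))
    ... | false | false | true = sym (trans (+-congʳ (trans (+-identityˡ _) -0#≈0#)) (+-identityˡ 1#))
    ... | false | false | false = sym (trans (+-identityʳ _) (trans (+-identityˡ _) -0#≈0#))

    Σ-∂Δ : ∀ {i j k} → i < j → j < k → ∀ (g : Edge n → Carrier) →
      Σ[ (λ e → g e * ∂Δ (i , j , k) e) ] ≈
      Σ[ (λ e → g e * χ (j , k) e) ] - Σ[ (λ e → g e * χ (i , k) e) ] + Σ[ (λ e → g e * χ (i , j) e) ]
    Σ-∂Δ {i} {j} {k} i<j j<k g = begin
      Σ[ (λ e → g e * ∂Δ (i , j , k) e) ]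
        ≈⟨ Σ-cong (λ e → trans (*-congˡ (∂Δ-χ i<j j<k e)) (trans (distribˡ (g e) _ _)
             (+-congʳ (trans (distribˡ (g e) _ _) (+-congˡ (sym (-‿distribʳ-* (g e) _))))))) ⟩
      Σ[ (λ e → g e * χ (j , k) e - g e * χ (i , k) e + g e * χ (i , j) e) ]
        ≈⟨ Σ-+ (λ e → g e * χ (j , k) e - g e * χ (i , k) e) (λ e → g e * χ (i , j) e) ⟩
      Σ[ (λ e → g e * χ (j , k) e - g e * χ (i , k) e) ] + Σ[ (λ e → g e * χ (i , j) e) ]
        ≈⟨ +-congʳ (trans (Σ-+ (λ e → g e * χ (j , k) e) (λ e → - (g e * χ (i , k) e)))
             (+-congˡ (Σ-neg (λ e → g e * χ (i , k) e)))) ⟩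
      Σ[ (λ e → g e * χ (j , k) e) ] - Σ[ (λ e → g e * χ (i , k) e) ] + Σ[ (λ e → g e * χ (i , j) e) ] ∎

-- The order of H₁(S;ℤ) is at most a minor of the reduced boundary matrix.

module TorsionBound where

  open Exterior
  open Cokernel
  open EdgeLists
  open ChainSums
  open import Data.Nat as ℕ using (ℕ; zero; suc)
  import Data.Nat.Properties as ℕₚ
  open import Data.Fin as Fin using (Fin; zero; suc; _≟_)
  open import Data.Fin.Properties using (pigeonhole; <⇒≢)
  open import Data.Bool using (Bool; true; false; if_then_else_)
  open import Data.Integer hiding (suc; _≟_)
  open import Data.Integer.Properties hiding (_≟_; <⇒≢)
  open import Data.Integer.Tactic.RingSolver using (solve-∀)
  open import Data.Product using (∃₂; _,_; proj₁; proj₂)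
  open import Data.Vec as Vec using (Vec; []; _∷_; map; tabulate; lookup)
  open import Data.Vec.Properties using (tabulate-∘; tabulate∘lookup; lookup∘tabulate; ∷-injectiveˡ; ∷-injectiveʳ)
  open import Function using (_∘_)
  open import Relation.Nullary using (yes; no; contradiction)
  open import Relation.Nullary.Decidable using (⌊_⌋)
  open import Relation.Binary.PropositionalEquality

  ext : ∀ {N} (S : Vec Bool N) → Vec ℤ (faces S) → Vec ℤ N
  ext [] [] = []
  ext (true ∷ S) (x ∷ b) = x ∷ ext S b
  ext (false ∷ S) b = 0ℤ ∷ ext S b

  res-ext : ∀ {N} (S : Vec Bool N) b → res S (ext S b) ≡ b
  res-ext [] [] = refl
  res-ext (true ∷ S) (x ∷ b) = cong (x ∷_) (res-ext S b)
  res-ext (false ∷ S) b = res-ext S b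

  ext-off : ∀ {N} (S : Vec Bool N) b i → lookup S i ≡ false → lookup (ext S b) i ≡ 0ℤ
  ext-off (true ∷ S) (x ∷ b) (suc i) eq = ext-off S b i eq
  ext-off (false ∷ S) b zero eq = refl
  ext-off (false ∷ S) b (suc i) eq = ext-off S b i eq

  res-map : ∀ {A B : Set} {N} (f : A → B) (S : Vec Bool N) v → map f (res S v) ≡ res S (map f v)
  res-map f [] [] = refl
  res-map f (true ∷ S) (x ∷ v) = cong (f x ∷_) (res-map f S v)
  res-map f (false ∷ S) (x ∷ v) = res-map f S v

  res-⊕ : ∀ {N} (S : Vec Bool N) (u v : Fin N → ℤ) →
    res S (tabulate u) ⊕ res S (tabulate v) ≡ res S (tabulate (λ i → u i + v i))
  res-⊕ [] u v = refl
  res-⊕ (true ∷ S) u v = cong (u zero + v zero ∷_) (res-⊕ S (u ∘ suc) (v ∘ suc))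
  res-⊕ (false ∷ S) u v = res-⊕ S (u ∘ suc) (v ∘ suc)

  res-cong : ∀ {A : Set} {N} (S : Vec Bool N) {u v : Fin N → A} →
    (∀ i → lookup S i ≡ true → u i ≡ v i) → res S (tabulate u) ≡ res S (tabulate v)
  res-cong [] p = refl
  res-cong (true ∷ S) p = cong₂ _∷_ (p zero refl) (res-cong S (p ∘ suc))
  res-cong (false ∷ S) p = res-cong S (p ∘ suc)

  res-injective : ∀ {A : Set} {N} (S : Vec Bool N) {u v : Fin N → A} →
    res S (tabulate u) ≡ res S (tabulate v) → ∀ i → lookup S i ≡ true → u i ≡ v i
  res-injective (true ∷ S) eq zero _ = ∷-injectiveˡ eq
  res-injective (true ∷ S) eq (suc i) s = res-injective S (∷-injectiveʳ eq) i s
  res-injective (false ∷ S) eq (suc i) s = res-injective S eq i s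

  ⊕-exchange : ∀ {m} (c : Vec ℤ m) {x y u v} → x ≡ c ⊕ u → y ≡ c ⊕ v → x ⊕ v ≡ y ⊕ u
  ⊕-exchange c {u = u} {v} refl refl = swap-last c u v
    where
    lemma : ∀ x y z → x + y + z ≡ x + z + y
    lemma = solve-∀
    swap-last : ∀ {m} (x y z : Vec ℤ m) → (x ⊕ y) ⊕ z ≡ (x ⊕ z) ⊕ y
    swap-last [] [] [] = refl
    swap-last (x ∷ xs) (y ∷ ys) (z ∷ zs) = cong₂ _∷_ (lemma x y z) (swap-last xs ys zs)

  rearrange : ∀ a b c d → a + d ≡ b + c → a - (b + (c - d)) ≡ 0ℤ
  rearrange a b c d eq = trans (lemma a b c d) (i≡j⇒i-j≡0 eq)
    where
    lemma : ∀ a b c d → a - (b + (c - d)) ≡ (a + d) - (b + c)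
    lemma = solve-∀

  isSuc : ∀ {n} → Fin n → Bool
  isSuc zero = false
  isSuc (suc _) = true

  module _ (n′ : ℕ) where
    private n = suc n′
    open Zc n
    open ChainSum +-*-commutativeRing n

    -- The edges avoiding vertex 0.
    mask : Vec Bool _
    mask = tabulate (λ e → isSuc (proj₁ (edge n e)))

    boundaryRow : Edge n → Vec ℤ (numTri n)
    boundaryRow e = tabulate (λ t → inc2 t e)

    boundaryRows : Vec (Vec ℤ (numTri n)) (faces mask)
    boundaryRows = res mask (tabulate boundaryRow)

    Σ-dot : ∀ {m} (S : Vec Bool m) (b r : Fin m → ℤ) →
      Σ[ (λ t → if lookup S t then b t * r t else 0ℤ) ] ≡ dot (res S (tabulate r)) (res S (tabulate b))
    Σ-dot [] b r = refl
    Σ-dot (true ∷ S) b r = cong₂ _+_ (*-comm (b zero) (r zero)) (Σ-dot S (b ∘ suc) (r ∘ suc))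
    Σ-dot (false ∷ S) b r = trans (+-identityˡ _) (Σ-dot S (b ∘ suc) (r ∘ suc))

    ∂₂-dot : ∀ S b e → ∂₂ S b e ≡ dot (res S (boundaryRow e)) (res S (tabulate b))
    ∂₂-dot S b e = Σ-dot S b (λ t → inc2 t e)

    ∂₂-ext : ∀ S b e → ∂₂ S (lookup (ext S b)) e ≡ dot (res S (boundaryRow e)) b
    ∂₂-ext S b e = trans (∂₂-dot S (lookup (ext S b)) e) (cong (dot (res S (boundaryRow e)))
      (trans (cong (res S) (tabulate∘lookup (ext S b))) (res-ext S b)))

    image : ∀ S b → map (res S) boundaryRows · b ≡ res mask (tabulate (λ e → dot (res S (boundaryRow e)) b))
    image S b = begin
      map (λ r → dot r b) (map (res S) (res mask (tabulate boundaryRow)))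
        ≡⟨ cong (map (λ r → dot r b))
            (trans (res-map (res S) mask _) (cong (res mask) (sym (tabulate-∘ (res S) boundaryRow)))) ⟩
      map (λ r → dot r b) (res mask (tabulate (res S ∘ boundaryRow)))
        ≡⟨ trans (res-map _ mask _) (cong (res mask) (sym (tabulate-∘ _ (res S ∘ boundaryRow)))) ⟩
      res mask (tabulate (λ e → dot (res S (boundaryRow e)) b)) ∎
      where open ≡-Reasoning

    mask-lookup : ∀ e → lookup mask e ≡ isSuc (proj₁ (edge n e))
    mask-lookup e = lookup∘tabulate _ e

    kron : Fin n → Fin n → ℤ
    kron v a = if ⌊ v ≟ a ⌋ then 1ℤ else 0ℤ

    inc1-δ : ∀ {a b} e → edge n e ≡ (a , b) → ∀ v → inc1 e v ≡ kron v b - kron v a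
    inc1-δ {a} {b} e eq v with edge n e | edge-< n e
    inc1-δ {a} {b} e refl v | _ | a<b with v ≟ b | v ≟ a
    ... | yes refl | yes refl = contradiction refl (<⇒≢ a<b)
    ... | yes _ | no _ = refl
    ... | no _ | yes _ = refl
    ... | no _ | no _ = refl

    Σ-inc1-χ : ∀ {a b} → a Fin.< b → ∀ v → Σ[ (λ e → inc1 e v * χ (a , b) e) ] ≡ kron v b - kron v a
    Σ-inc1-χ a<b v with edge-index n a<b
    ... | e , eq = trans (cong (λ p → Σ[ (λ e′ → inc1 e′ v * χ p e′) ]) (sym eq))
                         (trans (Σ-χ (λ e′ → inc1 e′ v) e) (inc1-δ e eq v))

    ∂∂ : ∀ {i j k} → i Fin.< j → j Fin.< k → ∀ v → Σ[ (λ e → ∂Δ (i , j , k) e * inc1 e v) ] ≡ 0ℤ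
    ∂∂ {i} {j} {k} i<j j<k v = begin
      Σ[ (λ e → ∂Δ (i , j , k) e * inc1 e v) ]
        ≡⟨ Σ-cong (λ e → *-comm (∂Δ (i , j , k) e) (inc1 e v)) ⟩
      Σ[ (λ e → inc1 e v * ∂Δ (i , j , k) e) ]
        ≡⟨ Σ-∂Δ i<j j<k (λ e → inc1 e v) ⟩
      Σ[ (λ e → inc1 e v * χ (j , k) e) ] - Σ[ (λ e → inc1 e v * χ (i , k) e) ] +
          Σ[ (λ e → inc1 e v * χ (i , j) e) ]
        ≡⟨ cong₂ _+_ (cong₂ _-_ (Σ-inc1-χ j<k v) (Σ-inc1-χ (ℕₚ.<-trans i<j j<k) v)) (Σ-inc1-χ i<j v) ⟩
      (kron v k - kron v j) - (kron v k - kron v i) + (kron v j - kron v i)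
        ≡⟨ telescope (kron v i) (kron v j) (kron v k) ⟩
      0ℤ ∎
      where
      open ≡-Reasoning
      telescope : ∀ i j k → (k - j) - (k - i) + (j - i) ≡ 0ℤ
      telescope = solve-∀

    -- Only the products are required to vanish: in `cone-cycle` the degenerate triples over edges
    -- at vertex 0 are harmless because their coefficients are 0.
    Σ-cycles : ∀ {m} (c : Fin m → ℤ) (z : Fin m → Edge n → ℤ) v →
      (∀ i → c i * Σ[ (λ e → z i e * inc1 e v) ] ≡ 0ℤ) →
      Σ[ (λ e → Σ[ (λ i → c i * z i e) ] * inc1 e v) ] ≡ 0ℤ
    Σ-cycles {m} c z v zero-terms = begin
      Σ[ (λ e → Σ[ (λ i → c i * z i e) ] * inc1 e v) ]
        ≡⟨ Σ-cong (λ e → trans (sym (Σ-*ʳ (inc1 e v) (λ i → c i * z i e)))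
             (Σ-cong (λ i → *-assoc (c i) (z i e) (inc1 e v)))) ⟩
      Σ[ (λ e → Σ[ (λ i → c i * (z i e * inc1 e v)) ]) ]
        ≡⟨ Σ-swap (λ e i → c i * (z i e * inc1 e v)) ⟩
      Σ[ (λ i → Σ[ (λ e → c i * (z i e * inc1 e v)) ]) ]
        ≡⟨ Σ-cong (λ i → trans (Σ-*ˡ (c i) (λ e → z i e * inc1 e v)) (zero-terms i)) ⟩
      Σ[ (λ (i : Fin m) → 0ℤ) ]
        ≡⟨ Σ-zero m ⟩
      0ℤ ∎
      where open ≡-Reasoning

    ∂₂-cycle : ∀ S b → IsCycle (∂₂ S b)
    ∂₂-cycle S b v = trans
      (Σ-cong (λ e → cong (_* inc1 e v) (Σ-cong (λ t → cond (lookup S t) (b t) (inc2 t e)))))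
      (Σ-cycles (λ t → if lookup S t then b t else 0ℤ) inc2 v λ t →
        trans (cong ((if lookup S t then b t else 0ℤ) *_) (trans (Σ-cong (λ e → cong (_* inc1 e v) (inc2-∂Δ t e)))
          (∂∂ (proj₁ (tri-< n t)) (proj₂ (tri-< n t)) v))) (*-zeroʳ (if lookup S t then b t else 0ℤ)))
      where
      cond : ∀ s x y → (if s then x * y else 0ℤ) ≡ (if s then x else 0ℤ) * y
      cond true x y = refl
      cond false x y = sym (*-zeroˡ y)

    combine-cycle : ∀ z w u → IsCycle z → IsCycle w → IsCycle u → IsCycle (λ e → z e - (w e + u e))
    combine-cycle z w u Z W U v = begin
      Σ[ (λ e → (z e - (w e + u e)) * inc1 e v) ]
        ≡⟨ Σ-cong (λ e → lemma (z e) (w e) (u e) (inc1 e v)) ⟩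
      Σ[ (λ e → z e * inc1 e v + - (w e * inc1 e v + u e * inc1 e v)) ]
        ≡⟨ Σ-+ (λ e → z e * inc1 e v) (λ e → - (w e * inc1 e v + u e * inc1 e v)) ⟩
      Σ[ (λ e → z e * inc1 e v) ] + Σ[ (λ e → - (w e * inc1 e v + u e * inc1 e v)) ]
        ≡⟨ cong₂ _+_ (Z v) (trans (Σ-neg (λ e → w e * inc1 e v + u e * inc1 e v))
             (cong -_ (trans (Σ-+ (λ e → w e * inc1 e v) (λ e → u e * inc1 e v)) (cong₂ _+_ (W v) (U v))))) ⟩
      0ℤ ∎
      where
      open ≡-Reasoning
      lemma : ∀ z w u i → (z - (w + u)) * i ≡ z * i + - (w * i + u * i)
      lemma = solve-∀

    -- The star of vertex 0 is a spanning tree, so a cycle is determined by its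
    -- coefficients on the remaining edges.
    cycle-vanishes : ∀ w → IsCycle w → (∀ e → lookup mask e ≡ true → w e ≡ 0ℤ) → ∀ e → w e ≡ 0ℤ
    cycle-vanishes w cyc off e with edge n e in eq | mask-lookup e
    ... | suc a , v | m = off e m
    ... | zero , v | m = begin
      w e              ≡⟨ *-identityʳ (w e) ⟨
      w e * 1ℤ         ≡⟨ cong (w e *_) inc-e ⟨
      w e * inc1 e v   ≡⟨ Σ-single e (λ e′ → w e′ * inc1 e′ v) others ⟨
      Σ[ (λ e′ → w e′ * inc1 e′ v) ] ≡⟨ cyc v ⟩
      0ℤ               ∎
      where
      open ≡-Reasoning
      0≢v : zero ≢ v
      0≢v = <⇒≢ (subst (λ p → proj₁ p Fin.< proj₂ p) eq (edge-< n e))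
      δ-self : kron v v ≡ 1ℤ
      δ-self with v ≟ v
      ... | yes _ = refl
      ... | no ¬r = contradiction refl ¬r
      δ-off : ∀ {a} → v ≢ a → kron v a ≡ 0ℤ
      δ-off {a} ne with v ≟ a
      ... | yes p = contradiction p ne
      ... | no _ = refl
      inc-e : inc1 e v ≡ 1ℤ
      inc-e = trans (inc1-δ e eq v) (cong₂ _-_ δ-self (δ-off (0≢v ∘ sym)))
      others : ∀ e′ → e′ ≢ e → w e′ * inc1 e′ v ≡ 0ℤ
      others e′ ne = cases (edge n e′) refl
        where
        cases : ∀ p → edge n e′ ≡ p → w e′ * inc1 e′ v ≡ 0ℤ
        cases (suc a , b) eq′ = trans
          (cong (_* inc1 e′ v) (off e′ (trans (mask-lookup e′) (cong (isSuc ∘ proj₁) eq′)))) (*-zeroˡ (inc1 e′ v))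
        cases (zero , b) eq′ = trans (cong (w e′ *_) (trans (inc1-δ e′ eq′ v)
          (cong₂ _-_ (δ-off (λ { refl → ne (edge-injective n e′ e (trans eq′ (sym eq))) }))
                     (δ-off (0≢v ∘ sym))))) (*-zeroʳ (w e′))

    -- A combination of boundaries of triangles 0uv, which are the fundamental cycles of the star at
    -- 0. Together with `cycle-vanishes` it identifies the cycles with arbitrary integer vectors on
    -- the edges of `mask`.
    cone : (Edge n → ℤ) → Edge n → ℤ
    cone Y e = Σ[ (λ e′ → Y e′ * ∂Δ (zero , edge n e′) e) ]

    cone-cycle : ∀ Y → (∀ e → lookup mask e ≡ false → Y e ≡ 0ℤ) → IsCycle (cone Y)
    cone-cycle Y off v = Σ-cycles Y (λ e′ e → ∂Δ (zero , edge n e′) e) v term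
      where
      term : ∀ e′ → Y e′ * Σ[ (λ e → ∂Δ (zero , edge n e′) e * inc1 e v) ] ≡ 0ℤ
      term e′ with edge n e′ | mask-lookup e′ | edge-< n e′
      ... | zero , b | m | _ = trans (cong (_* Σ[ (λ e → ∂Δ (zero , zero , b) e * inc1 e v) ]) (off e′ m))
          (*-zeroˡ Σ[ (λ e → ∂Δ (zero , zero , b) e * inc1 e v) ])
      ... | suc a , b | _ | a<b = trans (cong (Y e′ *_) (∂∂ (ℕ.s≤s ℕ.z≤n) a<b v)) (*-zeroʳ (Y e′))

    cone-extends : ∀ Y e → lookup mask e ≡ true → cone Y e ≡ Y e
    cone-extends Y e m = trans (Σ-single e _ others) (trans (cong (Y e *_) self) (*-identityʳ (Y e)))
      where
      self : ∂Δ (zero , edge n e) e ≡ 1ℤ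
      self = cong (λ s → if s then 1ℤ else (if eqPair (edge n e) (zero , proj₂ (edge n e)) then -1ℤ else
        (if eqPair (edge n e) (zero , proj₁ (edge n e)) then 1ℤ else 0ℤ))) (eqPair-refl (edge n e))
      -- The edge avoids vertex 0, so of the three tests in `∂Δ` only the first can succeed.
      no-zero : ∀ b → eqPair (edge n e) (zero , b) ≡ false
      no-zero b with edge n e | trans (sym (mask-lookup e)) m
      ... | suc a , c | _ = refl
      others : ∀ e′ → e′ ≢ e → Y e′ * ∂Δ (zero , edge n e′) e ≡ 0ℤ
      others e′ ne with eqPair (edge n e) (edge n e′) in eq
      ... | true = contradiction (sym (edge-injective n e e′ (eqPair-true (edge n e) (edge n e′) eq))) ne
      ... | false rewrite no-zero (proj₂ (edge n e′)) | no-zero (proj₁ (edge n e′)) = *-zeroʳ (Y e′)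

    -- Extended by zero and coned off, a vector y becomes a cycle; this is homologous to some r i,
    -- and restriction to the edges of `mask` returns y.
    order⇒cover : ∀ {S k} → HasOrder S k → Cover (map (res S) boundaryRows) k
    order⇒cover {S} (r , cyc , _ , cov) = (λ i → res mask (tabulate (r i))) , λ y →
      let Y = lookup (ext mask y)
          i , b , eq = cov (cone Y) (cone-cycle Y (ext-off mask y))
      in i , res S (tabulate b) , (begin
        y
          ≡⟨ trans (cong (res mask) (tabulate∘lookup (ext mask y))) (res-ext mask y) ⟨
        res mask (tabulate Y)
          ≡⟨ res-cong mask (λ e m → trans (sym (cone-extends Y e m))
              (trans (eq e) (cong (λ z → r i e + z) (∂₂-dot S b e)))) ⟩
        res mask (tabulate (λ e → r i e + dot (res S (boundaryRow e)) (res S (tabulate b))))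
          ≡⟨ res-⊕ mask (r i) _ ⟨
        res mask (tabulate (r i)) ⊕ res mask (tabulate (λ e → dot (res S (boundaryRow e)) (res S (tabulate b))))
          ≡⟨ cong (res mask (tabulate (r i)) ⊕_) (image S (res S (tabulate b))) ⟨
        res mask (tabulate (r i)) ⊕ map (res S) boundaryRows · res S (tabulate b) ∎)
      where open ≡-Reasoning

    ∂₂-sub : ∀ S b c e → ∂₂ S (λ t → b t - c t) e ≡ ∂₂ S b e - ∂₂ S c e
    ∂₂-sub S b c e = begin
      ∂₂ S (λ t → b t - c t) e
        ≡⟨ Σ-cong (λ t → cond (lookup S t) (b t) (c t) (inc2 t e)) ⟩
      Σ[ (λ t → (if lookup S t then b t * inc2 t e else 0ℤ) + - (if lookup S t then c t * inc2 t e else 0ℤ)) ]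
        ≡⟨ Σ-+ (λ t → if lookup S t then b t * inc2 t e else 0ℤ)
               (λ t → - (if lookup S t then c t * inc2 t e else 0ℤ)) ⟩
      ∂₂ S b e + Σ[ (λ t → - (if lookup S t then c t * inc2 t e else 0ℤ)) ]
        ≡⟨ cong (λ z → ∂₂ S b e + z) (Σ-neg (λ t → if lookup S t then c t * inc2 t e else 0ℤ)) ⟩
      ∂₂ S b e - ∂₂ S c e ∎
      where
      open ≡-Reasoning
      lemma : ∀ x y z → (x - y) * z ≡ x * z + - (y * z)
      lemma = solve-∀
      cond : ∀ s x y z → (if s then (x - y) * z else 0ℤ) ≡
                         (if s then x * z else 0ℤ) + - (if s then y * z else 0ℤ)
      cond true x y z = lemma x y z
      cond false x y z = refl

    -- The difference of z and w agrees with the boundary of b - b′ on the edges of `mask`. What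
    -- remains is a cycle that vanishes there, so it vanishes everywhere.
    homologous : ∀ S z w → IsCycle z → IsCycle w → ∀ c b b′ →
      res mask (tabulate z) ≡ c ⊕ map (res S) boundaryRows · b →
      res mask (tabulate w) ≡ c ⊕ map (res S) boundaryRows · b′ →
      Homologous S z w
    homologous S z w Z W c b b′ z≡ w≡ = B , λ e → i-j≡0⇒i≡j _ _
      (cycle-vanishes (λ e → z e - (w e + ∂₂ S B e)) (combine-cycle z w (∂₂ S B) Z W (∂₂-cycle S B)) off e)
      where
      B : Tri n → ℤ
      B t = lookup (ext S b) t - lookup (ext S b′) t
      D : Vec ℤ (faces S) → Edge n → ℤ
      D c e = dot (res S (boundaryRow e)) c
      both : res mask (tabulate (λ e → z e + D b′ e)) ≡ res mask (tabulate (λ e → w e + D b e))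
      both = trans (sym (res-⊕ mask z (D b′))) (trans
        (⊕-exchange c (trans z≡ (cong (c ⊕_) (image S b))) (trans w≡ (cong (c ⊕_) (image S b′))))
        (res-⊕ mask w (D b)))
      off : ∀ e → lookup mask e ≡ true → z e - (w e + ∂₂ S B e) ≡ 0ℤ
      off e m = trans
        (cong (λ u → z e - (w e + u)) (trans (∂₂-sub S (lookup (ext S b)) (lookup (ext S b′)) e)
          (cong₂ _-_ (∂₂-ext S b e) (∂₂-ext S b′ e))))
        (rearrange (z e) (w e) (D b e) (D b′ e) (res-injective mask both e m))

    -- If D < k, two of the pairwise inequivalent cycles lie in the same coset of the image.
    cover⇒order-≤ : ∀ {S k D} → HasOrder S k → Cover (map (res S) boundaryRows) D → k ℕ.≤ D
    cover⇒order-≤ {S} {k} {D} (r , cyc , inequiv , _) (rep , cov) = ℕₚ.≮⇒≥ λ D<k →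
      let i , j , i<j , same = pigeonhole D<k (λ i → proj₁ (hit i)) in
      inequiv i j (<⇒≢ i<j) (homologous S (r i) (r j) (cyc i) (cyc j) (rep (proj₁ (hit i)))
        (proj₁ (proj₂ (hit i))) (proj₁ (proj₂ (hit j))) (proj₂ (proj₂ (hit i)))
        (trans (proj₂ (proj₂ (hit j)))
          (cong (λ l → rep l ⊕ map (res S) boundaryRows · proj₁ (proj₂ (hit j))) (sym same))))
      where
      hit : ∀ i → ∃₂ λ l b → res mask (tabulate (r i)) ≡ rep l ⊕ map (res S) boundaryRows · b
      hit i = cov (res mask (tabulate (r i)))

    -- The cover from `order⇒cover` serves as a witness of finiteness; `cover-det` trades it for one
    -- of size |det|, and k is compared with that.
    order-≤-minor : ∀ {S k} → faces S ≡ faces mask → HasOrder S k → k ℕ.≤ ∣ minors boundaryRows S ∣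
    order-≤-minor {S} {k} sq ord = subst (k ℕ.≤_) (cong ∣_∣ (sym (minors-det boundaryRows S)))
      (cover⇒order-≤ {S} ord (square-cover sq (map (res S) boundaryRows) (order⇒cover {S} ord)))
      where
      square-cover : ∀ {N m k} → N ≡ m → (A : Vec (Vec ℤ N) m) → Cover A k → Cover A ∣ det A ∣
      square-cover refl A = cover-det A

-- Cohomology over 𝔽₂ by character sums.

module CocycleCount where

  open Sums
  open NatSums
  open ChainSums
  open import Data.Nat as ℕ using (ℕ; zero; suc; _^_)
  import Data.Nat.Properties as ℕₚ
  open import Data.Integer as ℤ using (ℤ; +_; 0ℤ; 1ℤ; -1ℤ)
  import Data.Integer.Properties as ℤₚ
  open import Data.Bool using (Bool; true; false; not; _∧_; _xor_; if_then_else_)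
  open import Data.Bool.Properties hiding (_≟_)
  open import Data.Fin using (Fin; zero; suc)
  open import Data.List as List using (List; []; _∷_)
  open import Data.Product using (_,_)
  open import Data.Vec as Vec using (Vec; []; _∷_; lookup; tabulate; replicate)
  open import Data.Vec.Properties using (lookup∘tabulate; lookup-replicate; tabulate-cong)
  open import Function using (_∘_)
  open import Relation.Binary.PropositionalEquality

  private
    module ℤΣ = Sum ℤₚ.+-*-commutativeSemiring

  pos-∑ : {A : Set} (l : List A) (φ : A → ℕ) → ℤΣ.∑ l (λ x → + φ x) ≡ + ∑ l φ
  pos-∑ [] φ = refl
  pos-∑ (x ∷ l) φ = trans (cong (λ z → + φ x ℤ.+ z) (pos-∑ l φ)) (sym (ℤₚ.pos-+ (φ x) (∑ l φ)))

  sign : Bool → ℤ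
  sign true = -1ℤ
  sign false = 1ℤ

  sign-xor : ∀ x y → sign (x xor y) ≡ sign x ℤ.* sign y
  sign-xor true true = refl
  sign-xor true false = refl
  sign-xor false true = refl
  sign-xor false false = refl

  infix 7 _∙_
  _∙_ : ∀ {m} → Vec Bool m → Vec Bool m → Bool
  [] ∙ [] = false
  (x ∷ u) ∙ (y ∷ v) = (x ∧ y) xor (u ∙ v)

  isZero : ∀ {m} → Vec Bool m → Bool
  isZero [] = true
  isZero (true ∷ u) = false
  isZero (false ∷ u) = isZero u

  -- Orthogonality of characters: if u has a true entry, flipping the corresponding bit of b changes
  -- the sign.
  character-sum : ∀ {m} (u : Vec Bool m) → ℤΣ.∑ (vecs bools m) (λ b → sign (u ∙ b)) ≡ + (2 ^ m ℕ.* ⟦ isZero u ⟧)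
  character-sum [] = refl
  character-sum {suc m} (true ∷ u) = trans (ℤΣ.∑-vecs-suc bools m _)
    (trans (ℤΣ.∑-cong (vecs bools m) (λ b → cancel (u ∙ b))) (trans (ℤΣ.∑-zero (vecs bools m))
      (cong +_ (sym (ℕₚ.*-zeroʳ (2 ^ suc m))))))
    where
    cancel : ∀ d → sign (not d) ℤ.+ (sign d ℤ.+ 0ℤ) ≡ 0ℤ
    cancel true = refl
    cancel false = refl
  character-sum {suc m} (false ∷ u) = trans (ℤΣ.∑-vecs-suc bools m _)
    (trans (ℤΣ.∑-cong (vecs bools m) (λ b → double (u ∙ b)))
      (trans (ℤΣ.∑-*ˡ (vecs bools m) (+ 2) _) (trans (cong (λ z → + 2 ℤ.* z) (character-sum u))
        (trans (sym (ℤₚ.pos-* 2 (2 ^ m ℕ.* ⟦ isZero u ⟧))) (cong +_ (sym (ℕₚ.*-assoc 2 (2 ^ m) _)))))))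
    where
    double : ∀ d → sign d ℤ.+ (sign d ℤ.+ 0ℤ) ≡ + 2 ℤ.* sign d
    double true = refl
    double false = refl

  ∙-comm : ∀ {m} (u v : Vec Bool m) → u ∙ v ≡ v ∙ u
  ∙-comm [] [] = refl
  ∙-comm (x ∷ u) (y ∷ v) = cong₂ _xor_ (∧-comm x y) (∙-comm u v)

  isZero-lookup : ∀ {m} (u : Vec Bool m) → isZero u ≡ true → ∀ i → lookup u i ≡ false
  isZero-lookup (false ∷ u) z zero = refl
  isZero-lookup (false ∷ u) z (suc i) = isZero-lookup u z i

  lookup-isZero : ∀ {m} (u : Vec Bool m) → (∀ i → lookup u i ≡ false) → isZero u ≡ true
  lookup-isZero [] p = refl
  lookup-isZero (true ∷ u) p = sym (p zero)
  lookup-isZero (false ∷ u) p = lookup-isZero u (p ∘ suc)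

  ∑-isZero : ∀ m → ∑ (vecs bools m) (λ a → ⟦ isZero a ⟧) ≡ 1
  ∑-isZero zero = refl
  ∑-isZero (suc m) = trans (∑-vecs-suc bools m _)
    (trans (∑-cong (vecs bools m) (λ v → ℕₚ.+-identityʳ ⟦ isZero v ⟧)) (∑-isZero m))

  annihilators : ∀ {m} {A : Set} (C : List A) (η : A → Vec Bool m) →
    ℤΣ.∑ (vecs bools m) (λ f → ℤΣ.∑ C (λ c → sign (f ∙ η c))) ≡ + (2 ^ m ℕ.* ∑ C (λ c → ⟦ isZero (η c) ⟧))
  annihilators {m} C η = begin
    ℤΣ.∑ (vecs bools m) (λ f → ℤΣ.∑ C (λ c → sign (f ∙ η c)))
      ≡⟨ ℤΣ.∑-swap (vecs bools m) C _ ⟩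
    ℤΣ.∑ C (λ c → ℤΣ.∑ (vecs bools m) (λ f → sign (f ∙ η c)))
      ≡⟨ ℤΣ.∑-cong C (λ c → trans (ℤΣ.∑-cong (vecs bools m) (λ f → cong sign (∙-comm f (η c))))
          (character-sum (η c))) ⟩
    ℤΣ.∑ C (λ c → + (2 ^ m ℕ.* ⟦ isZero (η c) ⟧))
      ≡⟨ pos-∑ C _ ⟩
    + ∑ C (λ c → 2 ^ m ℕ.* ⟦ isZero (η c) ⟧)
      ≡⟨ cong +_ (∑-*ˡ C (2 ^ m) _) ⟩
    + (2 ^ m ℕ.* ∑ C (λ c → ⟦ isZero (η c) ⟧)) ∎
    where open ≡-Reasoning

  -- The dimension count comes from summing the characters
  -- (-1)^(f ∙ ξη a b) over f first, or over a and b first.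
  module Duality {E d N : ℕ}
    (ξ* : Vec Bool E → Vec Bool d)
    (η : Vec Bool N → Vec Bool E) (η* : Vec Bool E → Vec Bool N)
    (ξη : Vec Bool d → Vec Bool N → Vec Bool E)
    (η-adjoint : ∀ f b → f ∙ η b ≡ η* f ∙ b)
    (ξη-adjoint : ∀ f a b → f ∙ ξη a b ≡ (ξ* f ∙ a) xor (η* f ∙ b))
    (independent : ∀ a b → isZero (ξη a b) ≡ true → isZero a ≡ true)
    (ξη-zero : ∀ a b → isZero a ≡ true → isZero (ξη a b) ≡ isZero (η b))
    where

    private
      F = vecs bools E
      A = vecs bools d
      B = vecs bools N
      0ᶠ = replicate E false

    -- Two evaluations of the double sum of (-1)^(f ∙ η b). In terms of dimensions: a matrix and its
    -- transpose have the same rank.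
    kernels : 2 ^ N ℕ.* ∑ F (λ f → ⟦ isZero (η* f) ⟧) ≡ 2 ^ E ℕ.* ∑ B (λ b → ⟦ isZero (η b) ⟧)
    kernels = ℤₚ.+-injective (begin
      + (2 ^ N ℕ.* ∑ F (λ f → ⟦ isZero (η* f) ⟧))          ≡⟨ cong +_ (∑-*ˡ F (2 ^ N) _) ⟨
      + ∑ F (λ f → 2 ^ N ℕ.* ⟦ isZero (η* f) ⟧)            ≡⟨ pos-∑ F _ ⟨
      ℤΣ.∑ F (λ f → + (2 ^ N ℕ.* ⟦ isZero (η* f) ⟧))       ≡⟨ ℤΣ.∑-cong F (λ f → character-sum (η* f)) ⟨
      ℤΣ.∑ F (λ f → ℤΣ.∑ B (λ b → sign (η* f ∙ b)))
          ≡⟨ ℤΣ.∑-cong F (λ f → ℤΣ.∑-cong B (λ b → cong sign (η-adjoint f b))) ⟨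
      ℤΣ.∑ F (λ f → ℤΣ.∑ B (λ b → sign (f ∙ η b)))         ≡⟨ annihilators B η ⟩
      + (2 ^ E ℕ.* ∑ B (λ b → ⟦ isZero (η b) ⟧))           ∎)
      where open ≡-Reasoning

    -- The same double count for the joint map of a and b; the kernel of its transpose is the
    -- intersection of the kernels of `ξ*` and `η*`.
    extended-kernels : ∑ F (λ f → (2 ^ d ℕ.* ⟦ isZero (ξ* f) ⟧) ℕ.* (2 ^ N ℕ.* ⟦ isZero (η* f) ⟧)) ≡
                       2 ^ E ℕ.* ∑ A (λ a → ∑ B (λ b → ⟦ isZero (ξη a b) ⟧))
    extended-kernels = ℤₚ.+-injective (begin
      + ∑ F (λ f → p f ℕ.* q f)
        ≡⟨ pos-∑ F _ ⟨
      ℤΣ.∑ F (λ f → + (p f ℕ.* q f))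
        ≡⟨ ℤΣ.∑-cong F (λ f → trans (ℤₚ.pos-* (p f) (q f))
             (cong₂ ℤ._*_ (sym (character-sum (ξ* f))) (sym (character-sum (η* f))))) ⟩
      ℤΣ.∑ F (λ f → ℤΣ.∑ A (λ a → sign (ξ* f ∙ a)) ℤ.* ℤΣ.∑ B (λ b → sign (η* f ∙ b)))
        ≡⟨ ℤΣ.∑-cong F (λ f → trans (sym (ℤΣ.∑-*ʳ A (ℤΣ.∑ B (λ b → sign (η* f ∙ b))) _))
             (ℤΣ.∑-cong A (λ a → trans (sym (ℤΣ.∑-*ˡ B (sign (ξ* f ∙ a)) _))
               (ℤΣ.∑-cong B (λ b → trans (sym (sign-xor (ξ* f ∙ a) (η* f ∙ b)))
                   (cong sign (sym (ξη-adjoint f a b)))))))) ⟩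
      ℤΣ.∑ F (λ f → ℤΣ.∑ A (λ a → ℤΣ.∑ B (λ b → sign (f ∙ ξη a b))))
        ≡⟨ ℤΣ.∑-swap F A _ ⟩
      ℤΣ.∑ A (λ a → ℤΣ.∑ F (λ f → ℤΣ.∑ B (λ b → sign (f ∙ ξη a b))))
        ≡⟨ ℤΣ.∑-cong A (λ a → annihilators B (ξη a)) ⟩
      ℤΣ.∑ A (λ a → + (2 ^ E ℕ.* ∑ B (λ b → ⟦ isZero (ξη a b) ⟧)))
        ≡⟨ pos-∑ A _ ⟩
      + ∑ A (λ a → 2 ^ E ℕ.* ∑ B (λ b → ⟦ isZero (ξη a b) ⟧))
        ≡⟨ cong +_ (∑-*ˡ A (2 ^ E) _) ⟩
      + (2 ^ E ℕ.* ∑ A (λ a → ∑ B (λ b → ⟦ isZero (ξη a b) ⟧))) ∎)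
      where
      open ≡-Reasoning
      p q : Vec Bool E → ℕ
      p f = 2 ^ d ℕ.* ⟦ isZero (ξ* f) ⟧
      q f = 2 ^ N ℕ.* ⟦ isZero (η* f) ⟧

    -- In `extended-kernels` the term f = 0 alone is 2^d * 2^N. On the other side independence
    -- forces a = 0, so what remains is the kernel of `η`, and `kernels` turns it into the kernel of
    -- `η*`.
    2^d-≤ : isZero (ξ* (replicate E false)) ≡ true → isZero (η* (replicate E false)) ≡ true →
      2 ^ d ℕ.≤ ∑ F (λ f → ⟦ isZero (η* f) ⟧)
    2^d-≤ ξ*0 η*0 = ℕₚ.*-cancelˡ-≤ (2 ^ N) {{ℕₚ.m^n≢0 2 N}} (begin
      2 ^ N ℕ.* 2 ^ d
        ≡⟨ ℕₚ.*-comm (2 ^ N) (2 ^ d) ⟩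
      2 ^ d ℕ.* 2 ^ N
        ≡⟨ cong₂ ℕ._*_ (sym (trans (cong (λ b → 2 ^ d ℕ.* ⟦ b ⟧) ξ*0) (ℕₚ.*-identityʳ (2 ^ d))))
                       (sym (trans (cong (λ b → 2 ^ N ℕ.* ⟦ b ⟧) η*0) (ℕₚ.*-identityʳ (2 ^ N)))) ⟩
      (2 ^ d ℕ.* ⟦ isZero (ξ* 0ᶠ) ⟧) ℕ.* (2 ^ N ℕ.* ⟦ isZero (η* 0ᶠ) ⟧)
        ≤⟨ ∑-∈ (∈-vecs ∈-bools 0ᶠ) (λ f → (2 ^ d ℕ.* ⟦ isZero (ξ* f) ⟧) ℕ.* (2 ^ N ℕ.* ⟦ isZero (η* f) ⟧)) ⟩
      ∑ F (λ f → (2 ^ d ℕ.* ⟦ isZero (ξ* f) ⟧) ℕ.* (2 ^ N ℕ.* ⟦ isZero (η* f) ⟧))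
        ≡⟨ extended-kernels ⟩
      2 ^ E ℕ.* ∑ A (λ a → ∑ B (λ b → ⟦ isZero (ξη a b) ⟧))
        ≤⟨ ℕₚ.*-monoʳ-≤ (2 ^ E) (∑-mono A (λ a → ∑-mono B (λ b → bound a b))) ⟩
      2 ^ E ℕ.* ∑ A (λ a → ∑ B (λ b → ⟦ isZero a ⟧ ℕ.* ⟦ isZero (η b) ⟧))
        ≡⟨ cong (2 ^ E ℕ.*_) (trans (∑-cong A (λ a → ∑-*ˡ B ⟦ isZero a ⟧ _)) (∑-*ʳ A _ (λ a → ⟦ isZero a ⟧))) ⟩
      2 ^ E ℕ.* (∑ A (λ a → ⟦ isZero a ⟧) ℕ.* ∑ B (λ b → ⟦ isZero (η b) ⟧))
        ≡⟨ cong (λ z → 2 ^ E ℕ.* (z ℕ.* ∑ B (λ b → ⟦ isZero (η b) ⟧))) (∑-isZero d) ⟩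
      2 ^ E ℕ.* (1 ℕ.* ∑ B (λ b → ⟦ isZero (η b) ⟧))
        ≡⟨ cong (2 ^ E ℕ.*_) (ℕₚ.*-identityˡ _) ⟩
      2 ^ E ℕ.* ∑ B (λ b → ⟦ isZero (η b) ⟧)
        ≡⟨ kernels ⟨
      2 ^ N ℕ.* ∑ F (λ f → ⟦ isZero (η* f) ⟧) ∎)
      where
      open ℕₚ.≤-Reasoning
      bound : ∀ a b → ⟦ isZero (ξη a b) ⟧ ℕ.≤ ⟦ isZero a ⟧ ℕ.* ⟦ isZero (η b) ⟧
      bound a b with isZero (ξη a b) in eq
      ... | false = ℕ.z≤n
      ... | true rewrite independent a b eq | trans (sym (ξη-zero a b (independent a b eq))) eq = ℕₚ.≤-refl

  module _ (n : ℕ) where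
    open F2 n
    open ChainSum xor-∧-commutativeRing n

    ∙-Σ : ∀ {m} (u v : Vec Bool m) → u ∙ v ≡ Σ[ (λ i → lookup u i ∧ lookup v i) ]
    ∙-Σ [] [] = refl
    ∙-Σ (x ∷ u) (y ∷ v) = cong ((x ∧ y) xor_) (∙-Σ u v)

    coboundary : Vec Bool _ → Tri n → Bool
    coboundary f t = Σ[ (λ e → lookup f e ∧ inc2 t e) ]

    -- The coboundary of f cut down to S: it vanishes exactly when f is a cocycle of S.
    cocycleDefect : Complex n → Vec Bool _ → Vec Bool (numTri n)
    cocycleDefect S f = tabulate (λ t → lookup S t ∧ coboundary f t)

    Σ-pairing : ∀ {m} (f : Vec Bool _) (a : Fin m → Bool) (z : Fin m → Edge n → Bool) →
      Σ[ (λ e → lookup f e ∧ Σ[ (λ i → a i ∧ z i e) ]) ] ≡ Σ[ (λ i → Σ[ (λ e → lookup f e ∧ z i e) ] ∧ a i) ]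
    Σ-pairing f a z = begin
      Σ[ (λ e → lookup f e ∧ Σ[ (λ i → a i ∧ z i e) ]) ]
        ≡⟨ Σ-cong (λ e → trans (sym (Σ-*ˡ (lookup f e) (λ i → a i ∧ z i e)))
             (Σ-cong (λ i → trans (cong (lookup f e ∧_) (∧-comm (a i) (z i e)))
                 (sym (∧-assoc (lookup f e) (z i e) (a i)))))) ⟩
      Σ[ (λ e → Σ[ (λ i → (lookup f e ∧ z i e) ∧ a i) ]) ]
        ≡⟨ Σ-swap (λ e i → (lookup f e ∧ z i e) ∧ a i) ⟩
      Σ[ (λ i → Σ[ (λ e → (lookup f e ∧ z i e) ∧ a i) ]) ]
        ≡⟨ Σ-cong (λ i → Σ-*ʳ (a i) (λ e → lookup f e ∧ z i e)) ⟩
      Σ[ (λ i → Σ[ (λ e → lookup f e ∧ z i e) ] ∧ a i) ] ∎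
      where open ≡-Reasoning

    ∙-tabulate : ∀ {m} (u : Vec Bool m) (g : Fin m → Bool) → u ∙ tabulate g ≡ Σ[ (λ i → lookup u i ∧ g i) ]
    ∙-tabulate u g = trans (∙-Σ u (tabulate g)) (Σ-cong (λ i → cong (lookup u i ∧_) (lookup∘tabulate g i)))

    tabulate-∙ : ∀ {m} (g : Fin m → Bool) (u : Vec Bool m) → tabulate g ∙ u ≡ Σ[ (λ i → g i ∧ lookup u i) ]
    tabulate-∙ g u = trans (∙-Σ (tabulate g) u) (Σ-cong (λ i → cong (_∧ lookup u i) (lookup∘tabulate g i)))

    ∂₂-adjoint : ∀ S f b → Σ[ (λ e → lookup f e ∧ ∂₂ S (lookup b) e) ] ≡ cocycleDefect S f ∙ b
    ∂₂-adjoint S f b = begin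
      Σ[ (λ e → lookup f e ∧ ∂₂ S (lookup b) e) ]
        ≡⟨ Σ-cong (λ e → cong (lookup f e ∧_) (Σ-cong (λ t → cond (lookup S t) (lookup b t) (inc2 t e)))) ⟩
      Σ[ (λ e → lookup f e ∧ Σ[ (λ t → (lookup S t ∧ lookup b t) ∧ inc2 t e) ]) ]
        ≡⟨ Σ-pairing f (λ t → lookup S t ∧ lookup b t) inc2 ⟩
      Σ[ (λ t → coboundary f t ∧ (lookup S t ∧ lookup b t)) ]
        ≡⟨ Σ-cong (λ t → trans (sym (∧-assoc (coboundary f t) (lookup S t) (lookup b t)))
             (cong (_∧ lookup b t) (∧-comm (coboundary f t) (lookup S t)))) ⟩
      Σ[ (λ t → (lookup S t ∧ coboundary f t) ∧ lookup b t) ]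
        ≡⟨ tabulate-∙ (λ t → lookup S t ∧ coboundary f t) b ⟨
      cocycleDefect S f ∙ b ∎
      where
      open ≡-Reasoning
      cond : ∀ s x y → (if s then x ∧ y else false) ≡ (s ∧ x) ∧ y
      cond true x y = refl
      cond false x y = refl

    -- The cocycles are the annihilator of the boundaries of S. As d cycles are independent modulo
    -- these boundaries, the annihilator has dimension at least d.
    betti-≤-cocycles : ∀ {S d} → HasDim S d → 2 ^ d ℕ.≤ ∑ (vecs bools _) (λ f → ⟦ isZero (cocycleDefect S f) ⟧)
    betti-≤-cocycles {S} {d} (v , _ , indep , _) = Duality.2^d-≤ ξ* η (cocycleDefect S) ξη
      (λ f b → trans (∙-tabulate f (∂₂ S (lookup b))) (∂₂-adjoint S f b)) adj independent ξη-zero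
      (lookup-isZero (ξ* 0ᶠ) (λ i → trans (lookup∘tabulate (λ i → Σ[ (λ e → lookup 0ᶠ e ∧ v i e) ]) i)
          (Σ-0 (v i))))
      (lookup-isZero (cocycleDefect S 0ᶠ) (λ t → trans (lookup∘tabulate (λ t → lookup S t ∧ coboundary 0ᶠ t) t)
        (trans (cong (lookup S t ∧_) (Σ-0 (inc2 t))) (∧-zeroʳ (lookup S t)))))
      where
      #E = List.length (edgeList n)
      0ᶠ = replicate #E false
      combo : Vec Bool d → Edge n → Bool
      combo a e = Σ[ (λ i → lookup a i ∧ v i e) ]
      ξ* : Vec Bool _ → Vec Bool d
      ξ* f = tabulate (λ i → Σ[ (λ e → lookup f e ∧ v i e) ])
      η : Vec Bool _ → Vec Bool _
      η b = tabulate (∂₂ S (lookup b))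
      ξη : Vec Bool d → Vec Bool _ → Vec Bool _
      ξη a b = tabulate (λ e → combo a e xor ∂₂ S (lookup b) e)
      Σ-0 : ∀ z → Σ[ (λ e → lookup 0ᶠ e ∧ z e) ] ≡ false
      Σ-0 z = trans (Σ-cong (λ e → cong (_∧ z e) (lookup-replicate e false))) (Σ-zero #E)
      open ≡-Reasoning
      adj : ∀ f a b → f ∙ ξη a b ≡ (ξ* f ∙ a) xor (cocycleDefect S f ∙ b)
      adj f a b = begin
        f ∙ ξη a b
          ≡⟨ ∙-tabulate f (λ e → combo a e xor ∂₂ S (lookup b) e) ⟩
        Σ[ (λ e → lookup f e ∧ (combo a e xor ∂₂ S (lookup b) e)) ]
          ≡⟨ Σ-cong (λ e → ∧-distribˡ-xor (lookup f e) (combo a e) (∂₂ S (lookup b) e)) ⟩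
        Σ[ (λ e → (lookup f e ∧ combo a e) xor (lookup f e ∧ ∂₂ S (lookup b) e)) ]
          ≡⟨ Σ-+ (λ e → lookup f e ∧ combo a e) (λ e → lookup f e ∧ ∂₂ S (lookup b) e) ⟩
        Σ[ (λ e → lookup f e ∧ combo a e) ] xor Σ[ (λ e → lookup f e ∧ ∂₂ S (lookup b) e) ]
          ≡⟨ cong₂ _xor_ (trans (Σ-pairing f (lookup a) v)
              (sym (tabulate-∙ (λ i → Σ[ (λ e → lookup f e ∧ v i e) ]) a)))
                         (∂₂-adjoint S f b) ⟩
        (ξ* f ∙ a) xor (cocycleDefect S f ∙ b) ∎
      xor-false : ∀ x y → x xor y ≡ false → x ≡ false xor y
      xor-false true true _ = refl
      xor-false false false _ = refl
      independent : ∀ a b → isZero (ξη a b) ≡ true → isZero a ≡ true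
      independent a b z = lookup-isZero a (indep (lookup a) (lookup b , λ e →
        xor-false (combo a e) _ (trans (sym (lookup∘tabulate (λ e → combo a e xor ∂₂ S (lookup b) e) e))
            (isZero-lookup (ξη a b) z e))))
      ξη-zero : ∀ a b → isZero a ≡ true → isZero (ξη a b) ≡ isZero (η b)
      ξη-zero a b z = cong isZero (tabulate-cong (λ e → cong (_xor ∂₂ S (lookup b) e)
        (trans (Σ-cong (λ i → cong (_∧ v i e) (isZero-lookup a z i))) (Σ-zero d))))

-- Squared row lengths of the boundary matrix on even triangles.

module Degrees where

  open Sums
  open NatSums
  open Exterior
  open EdgeLists
  open ChainSums
  open TorsionBound
  open CocycleCount
  open import Data.Nat as ℕ using (ℕ; z≤n)
  import Data.Nat.Properties as ℕₚ
  open import Data.Integer as ℤ using (ℤ; +_; 0ℤ; 1ℤ; -1ℤ; ∣_∣; +≤+)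
  import Data.Integer.Properties as ℤₚ
  open import Data.Bool using (Bool; true; false; not; _∧_; _xor_; if_then_else_)
  open import Data.Bool.Properties using (xor-∧-commutativeRing; xor-comm; xor-assoc; xor-identityʳ; ∧-zeroʳ)
  open import Data.Fin as Fin using (Fin; _<_; _<?_; _≟_)
  open import Data.Fin.Properties using (<-asym)
  open import Data.List as List using (List; []; _∷_; [_]; allFin)
  open import Data.Product using (_×_; _,_; proj₁; proj₂)
  open import Data.Vec as Vec using (Vec; []; _∷_; lookup; tabulate)
  open import Data.Vec.Properties using (tabulate-cong)
  open import Data.Empty using (⊥-elim)
  open import Function using (_∘_)
  open import Relation.Nullary using (yes; no; contradiction)
  open import Relation.Nullary.Decidable using (⌊_⌋)
  open import Relation.Binary.PropositionalEquality using (_≡_; _≢_; refl; sym; trans; cong; cong₂; subst; module ≡-Reasoning)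

  norm-tabulate : ∀ {A : Set} (l : List A) (G : A → ℤ) →
    ‖ tabulate (λ t → G (List.lookup l t)) ‖² ≡ + ∑ l (λ x → ∣ G x ∣ ℕ.* ∣ G x ∣)
  norm-tabulate [] G = refl
  norm-tabulate (x ∷ l) G = trans (cong₂ ℤ._+_ (sym (∣∣-square (G x))) (norm-tabulate l G))
    (sym (ℤₚ.pos-+ (∣ G x ∣ ℕ.* ∣ G x ∣) _))

  δ : ∀ {n} → Fin n → Fin n → ℕ
  δ i j = ⟦ ⌊ i ≟ j ⌋ ⟧

  δ-refl : ∀ {n} (i : Fin n) → δ i i ≡ 1
  δ-refl i with i ≟ i
  ... | yes _ = refl
  ... | no ne = contradiction refl ne

  ∑-δ : ∀ {n} (a : Fin n) (φ : Fin n → ℕ) → ∑ (allFin n) (λ i → δ i a ℕ.* φ i) ≡ φ a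
  ∑-δ a φ = trans (∑-allFin-single a _ off) (trans (cong (ℕ._* φ a) (δ-refl a)) (ℕₚ.*-identityˡ (φ a)))
    where
    off : ∀ i → i ≢ a → δ i a ℕ.* φ i ≡ 0
    off i ne with i ≟ a
    ... | yes p = contradiction p ne
    ... | no _ = refl

  ∑-triangleList : ∀ n (φ : Fin n × Fin n × Fin n → ℕ) →
    ∑ (triangleList n) φ ≡ ∑ (allFin n) λ i → ∑ (allFin n) λ j → ∑ (allFin n) λ k →
      ⟦ ⌊ i <? j ⌋ ∧ ⌊ j <? k ⌋ ⟧ ℕ.* φ (i , j , k)
  ∑-triangleList n φ = trans (∑-concatMap _ (allFin n) φ) (∑-cong (allFin n) λ i →
    trans (∑-concatMap _ (allFin n) φ) (∑-cong (allFin n) λ j →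
    trans (∑-concatMap _ (allFin n) φ) (∑-cong (allFin n) λ k → cell (⌊ i <? j ⌋ ∧ ⌊ j <? k ⌋) (i , j , k))))
    where
    cell : ∀ b x → ∑ (if b then [ x ] else []) φ ≡ ⟦ b ⟧ ℕ.* φ x
    cell true x = refl
    cell false x = refl

  module _ {n : ℕ} (A : Fin n → Fin n → Bool) where

    odd : Fin n × Fin n × Fin n → Bool
    odd (i , j , k) = (A j k xor A i k) xor A i j

    good : Fin n × Fin n → Fin n → Bool
    good (u , v) w = not ((A u w xor A v w) xor A u v)

    evenEntry : Fin n × Fin n → Fin n × Fin n × Fin n → ℤ
    evenEntry p (i , j , k) = if odd (i , j , k) then 0ℤ else
      if eqPair p (j , k) then 1ℤ else
      (if eqPair p (i , k) then -1ℤ else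
      (if eqPair p (i , j) then 1ℤ else 0ℤ))

    module _ (A-sym : ∀ a b → A a b ≡ A b a) (u v : Fin n) (u<v : u < v) where
      private
        g : Fin n → ℕ
        g w = ⟦ good (u , v) w ⟧
        below between above : Fin n → ℕ
        below w = ⟦ ⌊ w <? u ⌋ ⟧ ℕ.* g w
        between w = ⟦ ⌊ u <? w ⌋ ∧ ⌊ w <? v ⌋ ⟧ ℕ.* g w
        above w = ⟦ ⌊ v <? w ⌋ ⟧ ℕ.* g w

        xor-rot : ∀ x y z → (x xor y) xor z ≡ (z xor y) xor x
        xor-rot x y z = trans (xor-comm (x xor y) z)
          (trans (cong (z xor_) (xor-comm x y)) (sym (xor-assoc z y x)))

        <?-yes : ∀ {a b : Fin n} → a < b → ⌊ a <? b ⌋ ≡ true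
        <?-yes {a} {b} a<b with a <? b
        ... | yes _ = refl
        ... | no a≮b = contradiction a<b a≮b

        term₁ : ∀ i → i < u → ⟦ not (odd (i , u , v)) ⟧ ≡ below i
        term₁ i i<u rewrite <?-yes i<u = trans (cong (⟦_⟧ ∘ not)
          (trans (cong₂ (λ x y → (A u v xor x) xor y) (A-sym i v) (A-sym i u))
                 (xor-rot (A u v) (A v i) (A u i))))
          (sym (ℕₚ.+-identityʳ (g i)))

        term₂ : ∀ j → u < j → j < v → ⟦ not (odd (u , j , v)) ⟧ ≡ between j
        term₂ j u<j j<v rewrite <?-yes u<j | <?-yes j<v = trans (cong (⟦_⟧ ∘ not)
          (trans (cong (λ x → (x xor A u v) xor A u j) (A-sym j v))
                 (rot (A v j) (A u v) (A u j))))
          (sym (ℕₚ.+-identityʳ (g j)))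
          where
          rot : ∀ x y z → (x xor y) xor z ≡ (z xor x) xor y
          rot x y z = trans (xor-comm (x xor y) z) (sym (xor-assoc z x y))

        term₃ : ∀ k → v < k → ⟦ not (odd (u , v , k)) ⟧ ≡ above k
        term₃ k v<k rewrite <?-yes v<k = trans (cong (λ x → ⟦ not (x xor A u v) ⟧) (xor-comm (A v k) (A u k)))
          (sym (ℕₚ.+-identityʳ (g k)))

        -- A triangle through uv has its third vertex below u, between u and v, or above v. The
        -- factors `δ` place u and v in the other two positions.
        rhs : Fin n → Fin n → Fin n → ℕ
        rhs i j k = (δ j u ℕ.* (δ k v ℕ.* below i) ℕ.+ δ i u ℕ.* (δ k v ℕ.* between j)) ℕ.+
            δ i u ℕ.* (δ j v ℕ.* above k)

        one : ∀ {i j : Fin n} c → i ≡ j → c ≡ δ i j ℕ.* c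
        one {i} c refl = sym (trans (cong (ℕ._* c) (δ-refl i)) (ℕₚ.*-identityˡ c))

        sq-even : ∀ b s → ∣ s ∣ ≡ 1 → ∣ if b then 0ℤ else s ∣ ℕ.* ∣ if b then 0ℤ else s ∣ ≡ ⟦ not b ⟧
        sq-even true s p = refl
        sq-even false s p = cong₂ ℕ._*_ p p

        entry-bound : ∀ i j k → i < j → j < k →
          ∣ evenEntry (u , v) (i , j , k) ∣ ℕ.* ∣ evenEntry (u , v) (i , j , k) ∣ ℕ.≤ rhs i j k
        entry-bound i j k i<j j<k with eqPair (u , v) (j , k) in jk
        ... | true with eqPair-true (u , v) (j , k) jk
        ...   | eq = begin
          _                                       ≡⟨ sq-even (odd (i , j , k)) 1ℤ refl ⟩
          ⟦ not (odd (i , j , k)) ⟧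
              ≡⟨ cong₂ (λ a b → ⟦ not (odd (i , a , b)) ⟧) (sym (cong proj₁ eq)) (sym (cong proj₂ eq)) ⟩
          ⟦ not (odd (i , u , v)) ⟧             ≡⟨ term₁ i (subst (i <_) (sym (cong proj₁ eq)) i<j) ⟩
          below i
              ≡⟨ trans (one (below i) (sym (cong proj₂ eq))) (one _ (sym (cong proj₁ eq))) ⟩
          δ j u ℕ.* (δ k v ℕ.* below i)           ≤⟨ ℕₚ.≤-trans (ℕₚ.m≤m+n _ _) (ℕₚ.m≤m+n _ _) ⟩
          rhs i j k                               ∎
          where open ℕₚ.≤-Reasoning
        entry-bound i j k i<j j<k | false with eqPair (u , v) (i , k) in ik
        ... | true with eqPair-true (u , v) (i , k) ik
        ...   | eq = begin
          _                                       ≡⟨ sq-even (odd (i , j , k)) -1ℤ refl ⟩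
          ⟦ not (odd (i , j , k)) ⟧
              ≡⟨ cong₂ (λ a b → ⟦ not (odd (a , j , b)) ⟧) (sym (cong proj₁ eq)) (sym (cong proj₂ eq)) ⟩
          ⟦ not (odd (u , j , v)) ⟧
              ≡⟨ term₂ j (subst (_< j) (sym (cong proj₁ eq)) i<j) (subst (j <_) (sym (cong proj₂ eq)) j<k) ⟩
          between j
              ≡⟨ trans (one (between j) (sym (cong proj₂ eq))) (one _ (sym (cong proj₁ eq))) ⟩
          δ i u ℕ.* (δ k v ℕ.* between j)
              ≤⟨ ℕₚ.≤-trans (ℕₚ.m≤n+m _ (δ j u ℕ.* (δ k v ℕ.* below i))) (ℕₚ.m≤m+n _ _) ⟩
          rhs i j k                               ∎
          where open ℕₚ.≤-Reasoning
        entry-bound i j k i<j j<k | false | false with eqPair (u , v) (i , j) in ij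
        ... | true with eqPair-true (u , v) (i , j) ij
        ...   | eq = begin
          _                                       ≡⟨ sq-even (odd (i , j , k)) 1ℤ refl ⟩
          ⟦ not (odd (i , j , k)) ⟧
              ≡⟨ cong₂ (λ a b → ⟦ not (odd (a , b , k)) ⟧) (sym (cong proj₁ eq)) (sym (cong proj₂ eq)) ⟩
          ⟦ not (odd (u , v , k)) ⟧             ≡⟨ term₃ k (subst (_< k) (sym (cong proj₂ eq)) j<k) ⟩
          above k
              ≡⟨ trans (one (above k) (sym (cong proj₂ eq))) (one _ (sym (cong proj₁ eq))) ⟩
          δ i u ℕ.* (δ j v ℕ.* above k)           ≤⟨ ℕₚ.m≤n+m _ _ ⟩
          rhs i j k                               ∎
          where open ℕₚ.≤-Reasoning
        entry-bound i j k i<j j<k | false | false | false with odd (i , j , k)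
        ... | true = z≤n
        ... | false = z≤n

        ordered-bound : ∀ i j k → ⟦ ⌊ i <? j ⌋ ∧ ⌊ j <? k ⌋ ⟧ ℕ.*
          (∣ evenEntry (u , v) (i , j , k) ∣ ℕ.* ∣ evenEntry (u , v) (i , j , k) ∣) ℕ.≤ rhs i j k
        ordered-bound i j k with i <? j | j <? k
        ... | yes i<j | yes j<k = ℕₚ.≤-trans (ℕₚ.≤-reflexive (ℕₚ.+-identityʳ _)) (entry-bound i j k i<j j<k)
        ... | yes _ | no _ = z≤n
        ... | no _ | _ = z≤n

        -- At most one of the three ranges contains w. The vertices u and v lie in none of them, so
        -- this is an inequality.
        position : ∀ w → (below w ℕ.+ between w) ℕ.+ above w ℕ.≤ g w
        position w with w <? u | u <? w | w <? v | v <? w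
        ... | yes w<u | yes u<w | _ | _ = ⊥-elim (<-asym w<u u<w)
        ... | yes w<u | no _ | _ | yes v<w = ⊥-elim (<-asym w<u (ℕₚ.<-trans (u<v) v<w))
        ... | yes _ | no _ | _ | no _ = ℕₚ.≤-reflexive
            (trans (ℕₚ.+-identityʳ _) (trans (ℕₚ.+-identityʳ _) (ℕₚ.+-identityʳ _)))
        ... | no _ | _ | yes w<v | yes v<w = ⊥-elim (<-asym w<v v<w)
        ... | no _ | yes _ | yes _ | no _ = ℕₚ.≤-reflexive (trans (ℕₚ.+-identityʳ _) (ℕₚ.+-identityʳ _))
        ... | no _ | no _ | yes _ | no _ = z≤n
        ... | no _ | yes _ | no _ | yes _ = ℕₚ.≤-reflexive (ℕₚ.+-identityʳ _)
        ... | no _ | no _ | no _ | yes _ = ℕₚ.≤-reflexive (ℕₚ.+-identityʳ _)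
        ... | no _ | yes _ | no _ | no _ = z≤n
        ... | no _ | no _ | no _ | no _ = z≤n

        V = allFin n
        ∑-rhs : ∑ V (λ i → ∑ V (λ j → ∑ V (λ k → rhs i j k))) ≡ ∑ V (λ w → (below w ℕ.+ between w) ℕ.+ above w)
        ∑-rhs = begin
          ∑ V (λ i → ∑ V (λ j → ∑ V (λ k → rhs i j k)))
            ≡⟨ ∑-cong V (λ i → ∑-cong V (λ j → trans (∑-+ V _ _) (cong₂ ℕ._+_ (trans (∑-+ V _ _)
                 (cong₂ ℕ._+_ (collapse (δ j u) (below i)) (collapse (δ i u) (between j))))
                 (trans (∑-*ˡ V (δ i u) _) (cong (δ i u ℕ.*_) (∑-*ˡ V (δ j v) above)))))) ⟩
          ∑ V (λ i → ∑ V (λ j → (δ j u ℕ.* below i ℕ.+ δ i u ℕ.* between j) ℕ.+ δ i u ℕ.* (δ j v ℕ.* ∑ V above)))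
            ≡⟨ ∑-cong V (λ i → trans (∑-+ V _ _) (cong₂ ℕ._+_ (trans (∑-+ V _ _) (cong₂ ℕ._+_
                 (∑-δ u (λ _ → below i)) (∑-*ˡ V (δ i u) between)))
                 (trans (∑-*ˡ V (δ i u) _) (cong (δ i u ℕ.*_) (∑-δ v (λ _ → ∑ V above)))))) ⟩
          ∑ V (λ i → (below i ℕ.+ δ i u ℕ.* ∑ V between) ℕ.+ δ i u ℕ.* ∑ V above)
            ≡⟨ trans (∑-+ V _ _) (cong₂ ℕ._+_
                (trans (∑-+ V _ _) (cong (∑ V below ℕ.+_) (∑-δ u (λ _ → ∑ V between))))
                 (∑-δ u (λ _ → ∑ V above))) ⟩
          (∑ V below ℕ.+ ∑ V between) ℕ.+ ∑ V above
            ≡⟨ trans (∑-+ V (λ w → below w ℕ.+ between w) above) (cong (ℕ._+ ∑ V above) (∑-+ V below between)) ⟨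
          ∑ V (λ w → (below w ℕ.+ between w) ℕ.+ above w) ∎
          where
          open ≡-Reasoning
          collapse : ∀ c d → ∑ V (λ k → c ℕ.* (δ k v ℕ.* d)) ≡ c ℕ.* d
          collapse c d = trans (∑-*ˡ V c _) (cong (c ℕ.*_) (∑-δ v (λ _ → d)))

      -- The entries are 0 and ±1, so the sum counts the even triangles through uv, and each of
      -- these is given by its third vertex.
      evenEntry-squares : ∑ (triangleList n) (λ x → ∣ evenEntry (u , v) x ∣ ℕ.* ∣ evenEntry (u , v) x ∣) ℕ.≤
                          ∑ (allFin n) (λ w → ⟦ good (u , v) w ⟧)
      evenEntry-squares = begin
        ∑ (triangleList n) (λ x → ∣ evenEntry (u , v) x ∣ ℕ.* ∣ evenEntry (u , v) x ∣)
          ≡⟨ ∑-triangleList n (λ x → ∣ evenEntry (u , v) x ∣ ℕ.* ∣ evenEntry (u , v) x ∣) ⟩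
        ∑ V (λ i → ∑ V (λ j → ∑ V (λ k → ⟦ ⌊ i <? j ⌋ ∧ ⌊ j <? k ⌋ ⟧ ℕ.*
          (∣ evenEntry (u , v) (i , j , k) ∣ ℕ.* ∣ evenEntry (u , v) (i , j , k) ∣))))
          ≤⟨ ∑-mono V (λ i → ∑-mono V (λ j → ∑-mono V (λ k → ordered-bound i j k))) ⟩
        ∑ V (λ i → ∑ V (λ j → ∑ V (λ k → rhs i j k)))
          ≡⟨ ∑-rhs ⟩
        ∑ V (λ w → (below w ℕ.+ between w) ℕ.+ above w)
          ≤⟨ ∑-mono V position ⟩
        ∑ (allFin n) (λ w → ⟦ good (u , v) w ⟧) ∎
        where open ℕₚ.≤-Reasoning

  module _ (n : ℕ) where
    open F2 n using (Σ[_])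
    open ChainSum xor-∧-commutativeRing n
    private
      module Z where
        open Zc n public
        open ChainSum ℤₚ.+-*-commutativeRing n public

    -- At most one term survives, so this reads f at the pair (a , b) without searching for its
    -- index; it is false unless a < b. The symmetrization `adj` is false on the diagonal.
    half : Vec Bool _ → Fin n → Fin n → Bool
    half f a b = Σ[ (λ e → lookup f e ∧ χ (a , b) e) ]

    adj : Vec Bool _ → Fin n → Fin n → Bool
    adj f a b = half f a b xor half f b a

    adj-sym : ∀ f a b → adj f a b ≡ adj f b a
    adj-sym f a b = xor-comm (half f a b) (half f b a)

    adj-half : ∀ f {a b} → a < b → half f a b ≡ adj f a b
    adj-half f {a} {b} a<b = sym (trans (cong (half f a b xor_) vanish) (xor-identityʳ (half f a b)))
      where
      vanish : half f b a ≡ false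
      vanish = trans (Σ-cong (λ e → trans (cong (lookup f e ∧_) (χ-off (b , a) e
        (λ eq → <-asym a<b (subst (λ p → proj₁ p < proj₂ p) eq (edge-< n e))))) (∧-zeroʳ (lookup f e))))
        (Σ-zero (List.length (edgeList n)))

    adj-edge : ∀ f e → adj f (proj₁ (edge n e)) (proj₂ (edge n e)) ≡ lookup f e
    adj-edge f e = trans (sym (adj-half f (edge-< n e))) (Σ-χ (lookup f) e)

    coboundary-odd : ∀ f t → coboundary n f t ≡ odd (adj f) (tri n t)
    coboundary-odd f t = trans (Σ-cong (λ e → cong (lookup f e ∧_) (inc2-∂Δ t e)))
      (trans (Σ-∂Δ (proj₁ (tri-< n t)) (proj₂ (tri-< n t)) (lookup f))
        (cong₂ _xor_ (cong₂ _xor_ (adj-half f (proj₂ (tri-< n t)))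
          (adj-half f (ℕₚ.<-trans (proj₁ (tri-< n t)) (proj₂ (tri-< n t)))))
          (adj-half f (proj₁ (tri-< n t)))))

    degree : Vec Bool _ → Edge n → ℕ
    degree f e = ∑ (allFin n) (λ w → ⟦ good (adj f) (edge n e) w ⟧)

    -- Odd triangles are set to 0 instead of being removed, so the matrices of all f have the same
    -- columns.
    evenRow : Vec Bool _ → Edge n → Vec ℤ (numTri n)
    evenRow f e = tabulate (λ t → if coboundary n f t then 0ℤ else Z.inc2 t e)

    evenRow-norm : ∀ f e → ‖ evenRow f e ‖² ℤ.≤ + degree f e
    evenRow-norm f e = subst (ℤ._≤ + degree f e) (sym norm)
      (+≤+ (evenEntry-squares (adj f) (adj-sym f) (proj₁ (edge n e)) (proj₂ (edge n e)) (edge-< n e)))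
      where
      entry = evenEntry (adj f) (edge n e)
      norm : ‖ evenRow f e ‖² ≡ + ∑ (triangleList n) (λ x → ∣ entry x ∣ ℕ.* ∣ entry x ∣)
      norm = trans (cong ‖_‖² (tabulate-cong (λ t →
        cong₂ (λ b z → if b then 0ℤ else z) (coboundary-odd f t) (Z.inc2-∂Δ t e))))
        (norm-tabulate (triangleList n) entry)

-- Total squared minors of the complexes with a given cocycle.

module CocycleWeight where

  open Sums
  open NatSums
  open Exterior
  open TorsionBound
  open CocycleCount
  open Degrees
  open import Data.Nat as ℕ using (ℕ; zero; suc; z≤n)
  import Data.Nat.Properties as ℕₚ
  open import Data.Integer as ℤ using (ℤ; +_; 0ℤ; 1ℤ; ∣_∣)
  import Data.Integer.Properties as ℤₚ
  open import Data.Bool using (Bool; true; false; _∧_; if_then_else_)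
  open import Data.Fin as Fin using (Fin; zero; suc)
  open import Data.Vec as Vec using (Vec; []; _∷_; lookup; tabulate; map)
  open import Data.Vec.Properties using (lookup∘tabulate; tabulate-∘)
  open import Function using (_∘_)
  open import Relation.Binary.PropositionalEquality using (_≡_; refl; sym; trans; cong; cong₂)

  ∫-∑ : ∀ {N} (ω : Form N) (φ : Vec Bool N → ℕ) → (∀ S → + φ S ≡ ω S) → + ∑ (vecs bools N) φ ≡ ∫ ω
  ∫-∑ {zero} ω φ p = trans (cong +_ (ℕₚ.+-identityʳ (φ []))) (p [])
  ∫-∑ {suc N} ω φ p = trans (cong +_ (trans (∑-vecs-suc bools N φ)
      (trans (∑-+ (vecs bools N) (λ S → φ (true ∷ S)) _)
        (cong (∑ (vecs bools N) (λ S → φ (true ∷ S)) ℕ.+_)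
            (∑-cong (vecs bools N) (λ S → ℕₚ.+-identityʳ (φ (false ∷ S))))))))
    (trans (ℤₚ.pos-+ (∑ (vecs bools N) (λ S → φ (true ∷ S))) _)
      (cong₂ ℤ._+_ (∫-∑ (λ S → ω (true ∷ S)) (λ S → φ (true ∷ S)) (λ S → p (true ∷ S)))
                   (∫-∑ (λ S → ω (false ∷ S)) (λ S → φ (false ∷ S)) (λ S → p (false ∷ S)))))

  ∏-norms : ∀ {E N} (M : Vec Bool E) (R : Fin E → Vec ℤ N) (D : Fin E → ℕ) → (∀ e → ‖ R e ‖² ℤ.≤ + D e) →
    Vec.foldr′ (λ r p → ‖ r ‖² ℤ.* p) 1ℤ (res M (tabulate R)) ℤ.≤ + ∏ (λ e → if lookup M e then D e else 1)
  ∏-norms [] R D p = ℤₚ.≤-refl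
  ∏-norms (true ∷ M) R D p = ℤₚ.≤-trans
    (ℤₚ.*-monoˡ-≤-nonNeg ‖ R zero ‖² {{ℤ.nonNegative (‖‖²-nonneg (R zero))}}
        (∏-norms M (R ∘ suc) (D ∘ suc) (p ∘ suc)))
    (ℤₚ.≤-trans (ℤₚ.*-monoʳ-≤-nonNeg (+ ∏ (λ e → if lookup M e then D (suc e) else 1)) (p zero))
      (ℤₚ.≤-reflexive (sym (ℤₚ.pos-* (D zero) _))))
  ∏-norms (false ∷ M) R D p = ℤₚ.≤-trans (∏-norms M (R ∘ suc) (D ∘ suc) (p ∘ suc))
    (ℤₚ.≤-reflexive (cong +_ (sym (ℕₚ.+-identityʳ _))))

  ⟦⟧*-≤ : ∀ b {x y} → (b ≡ true → x ≡ y) → ⟦ b ⟧ ℕ.* x ℕ.≤ y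
  ⟦⟧*-≤ false p = z≤n
  ⟦⟧*-≤ true p = ℕₚ.≤-reflexive (trans (ℕₚ.+-identityʳ _) (p refl))

  module _ (n′ : ℕ) where
    private n = suc n′

    evenRows : Vec Bool _ → Vec (Vec ℤ (numTri n)) (faces (mask n′))
    evenRows f = res (mask n′) (tabulate (evenRow n f))

    -- If f is a cocycle of S, every column of S belongs to an even triangle, and none has been set
    -- to 0.
    evenRows-minor : ∀ f S → isZero (cocycleDefect n S f) ≡ true → minors (evenRows f) S ≡
        minors (boundaryRows n′) S
    evenRows-minor f S z = trans (minors-det (evenRows f) S)
        (trans (cong det rows) (sym (minors-det (boundaryRows n′) S)))
      where
      restrict : ∀ (R : Edge n → Vec ℤ (numTri n)) →
        map (res S) (res (mask n′) (tabulate R)) ≡ res (mask n′) (tabulate (λ e → res S (R e)))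
      restrict R = trans (res-map (res S) (mask n′) (tabulate R))
          (cong (res (mask n′)) (sym (tabulate-∘ (res S) R)))
      even : ∀ t → lookup S t ≡ true → coboundary n f t ≡ false
      even t s = trans (sym (cong (_∧ coboundary n f t) s))
        (trans (sym (lookup∘tabulate (λ t → lookup S t ∧ coboundary n f t) t))
            (isZero-lookup (cocycleDefect n S f) z t))
      rows : map (res S) (evenRows f) ≡ map (res S) (boundaryRows n′)
      rows = trans (restrict (evenRow n f)) (trans
        (res-cong (mask n′) (λ e _ → res-cong S
            (λ t s → cong (λ b → if b then 0ℤ else Zc.inc2 n t e) (even t s))))
        (sym (restrict (boundaryRow n′))))

    -- On the complexes that have f as a cocycle the two kinds of minors coincide. Then all S are
    -- readmitted, at no cost for an upper bound, and Hadamard's inequality applies to the complete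
    -- sum.
    cocycle-weight : ∀ f →
      ∑ (vecs bools (numTri n)) (λ S → ⟦ isZero (cocycleDefect n S f) ⟧ ℕ.*
        (∣ minors (boundaryRows n′) S ∣ ℕ.* ∣ minors (boundaryRows n′) S ∣))
      ℕ.≤ ∏ (λ e → if lookup (mask n′) e then degree n f e else 1)
    cocycle-weight f = begin
      ∑ (vecs bools (numTri n)) (λ S → ⟦ isZero (cocycleDefect n S f) ⟧ ℕ.*
        (∣ minors (boundaryRows n′) S ∣ ℕ.* ∣ minors (boundaryRows n′) S ∣))
        ≤⟨ ∑-mono (vecs bools (numTri n)) bound ⟩
      ∑ (vecs bools (numTri n)) (λ S → ∣ minors (evenRows f) S ∣ ℕ.* ∣ minors (evenRows f) S ∣)
        ≤⟨ ℤₚ.drop‿+≤+ (ℤₚ.≤-trans (ℤₚ.≤-reflexive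
             (∫-∑ _ (λ S → ∣ minors (evenRows f) S ∣ ℕ.* ∣ minors (evenRows f) S ∣)
                 (λ S → ∣∣-square (minors (evenRows f) S))))
             (ℤₚ.≤-trans (hadamard (evenRows f))
                 (∏-norms (mask n′) (evenRow n f) (degree n f) (evenRow-norm n f)))) ⟩
      ∏ (λ e → if lookup (mask n′) e then degree n f e else 1) ∎
      where
      open ℕₚ.≤-Reasoning
      bound : ∀ S → ⟦ isZero (cocycleDefect n S f) ⟧ ℕ.*
          (∣ minors (boundaryRows n′) S ∣ ℕ.* ∣ minors (boundaryRows n′) S ∣)
        ℕ.≤ ∣ minors (evenRows f) S ∣ ℕ.* ∣ minors (evenRows f) S ∣
      bound S = ⟦⟧*-≤ (isZero (cocycleDefect n S f))
          (λ z → cong (λ m → ∣ m ∣ ℕ.* ∣ m ∣) (sym (evenRows-minor f S z)))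

-- The inequality of means and the sampling estimate.

module SamplingBound where

  open Sums
  open NatSums
  open import Data.Nat
  open import Data.Nat.Properties
  open import Data.Nat.DivMod using (m/n*n≡m; m/n*n≤m)
  open import Data.Nat.Divisibility using (m≤n⇒m!∣n!; m∣m*n; ∣-trans)
  open import Data.Nat.Tactic.RingSolver using (solve-∀)
  open import Data.Bool using (Bool; true; false; not)
  open import Data.List as List using (List; []; _∷_; length; map)
  open import Data.Nat.ListAction using (sum; product)
  open import Data.List.Membership.Propositional using (_∈_)
  open import Data.List.Properties using (length-map)
  open import Data.List.Relation.Unary.All using (All; []; _∷_)
  open import Data.List.Relation.Unary.Any using (here; there)
  open import Data.Vec as Vec using (Vec; []; _∷_)
  open import Data.Product using (∃; ∃₂; _×_; _,_)
  open import Data.Sum using (_⊎_; inj₁; inj₂)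
  open import Function using (_∘_)
  open import Relation.Binary.PropositionalEquality

  Extracted : (ℕ → Set) → List ℕ → Set
  Extracted P ys = ∃₂ λ y rest → P y × sum ys ≡ y + sum rest × product ys ≡ y * product rest × length ys ≡
      suc (length rest)

  -- Supplies the partner on the other side of c for the exchange in `am-gm′`, or shows that all
  -- entries are on the same side.
  extract : (P Q : ℕ → Set) → (∀ y → P y ⊎ Q y) → ∀ ys → All P ys ⊎ Extracted Q ys
  extract P Q dec [] = inj₁ []
  extract P Q dec (y ∷ ys) with dec y
  ... | inj₂ q = inj₂ (y , ys , q , refl , refl , refl)
  ... | inj₁ p with extract P Q dec ys
  ...   | inj₁ ps = inj₁ (p ∷ ps)
  ...   | inj₂ (z , rest , q , s , π , l) = inj₂ (z , y ∷ rest , q ,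
          trans (cong (y +_) s) (+-rot y z (sum rest)) ,
          trans (cong (y *_) π) (*-rot y z (product rest)) , cong suc l)
    where
    +-rot : ∀ y z r → y + (z + r) ≡ z + (y + r)
    +-rot = solve-∀
    *-rot : ∀ y z r → y * (z * r) ≡ z * (y * r)
    *-rot = solve-∀

  product-≤ : ∀ {c xs} → All (_≤ c) xs → product xs ≤ c ^ length xs
  product-≤ [] = ≤-refl
  product-≤ (p ∷ ps) = *-mono-≤ p (product-≤ ps)

  sum-≥ : ∀ {c xs} → All (c ≤_) xs → length xs * c ≤ sum xs
  sum-≥ [] = z≤n
  sum-≥ (p ∷ ps) = +-mono-≤ p (sum-≥ ps)

  -- Replacing x ≤ c ≤ y by c and x + y - c keeps the sum and does not decrease the product.
  am-gm′ : ∀ m c xs → length xs ≡ m → sum xs ≤ m * c → product xs ≤ c ^ m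
  am-gm′ zero c [] _ _ = ≤-refl
  am-gm′ (suc m) c (x ∷ ys) len s with ≤-total x c
  ... | inj₁ x≤c with extract (_≤ c) (c ≤_) (λ y → ≤-total y c) ys
  ...   | inj₁ ps = subst (λ k → x * product ys ≤ c ^ k) len (product-≤ (x≤c ∷ ps))
  ...   | inj₂ (y , rest , c≤y , sy , py , ly) with m≤n⇒∃[o]m+o≡n c≤y
  ...     | e , refl = begin
    x * product ys                    ≡⟨ cong (x *_) py ⟩
    x * ((c + e) * product rest)      ≡⟨ *-assoc x (c + e) _ ⟨
    x * (c + e) * product rest        ≤⟨ *-monoˡ-≤ (product rest) smooth ⟩
    c * (x + e) * product rest        ≡⟨ *-assoc c (x + e) _ ⟩
    c * product (x + e ∷ rest)
        ≤⟨ *-monoʳ-≤ c (am-gm′ m c (x + e ∷ rest) (trans (sym ly) (suc-injective len)) sum-bound) ⟩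
    c * c ^ m                         ∎
    where
    open ≤-Reasoning
    smooth : x * (c + e) ≤ c * (x + e)
    smooth = ≤-trans (≤-reflexive (trans (*-distribˡ-+ x c e) (cong (_+ x * e) (*-comm x c))))
      (≤-trans (+-monoʳ-≤ (c * x) (*-monoˡ-≤ e x≤c)) (≤-reflexive (sym (*-distribˡ-+ c x e))))
    arrange : ∀ c x e r → c + (x + e + r) ≡ x + (c + e + r)
    arrange = solve-∀
    sum-bound : x + e + sum rest ≤ m * c
    sum-bound = +-cancelˡ-≤ c _ _
        (≤-trans (≤-reflexive (trans (arrange c x e (sum rest)) (cong (x +_) (sym sy)))) s)
  am-gm′ (suc m) c (x ∷ ys) len s | inj₂ c≤x with extract (c ≤_) (_≤ c) (λ y → ≤-total c y) ys
  ...   | inj₁ ps = subst (λ k → product (x ∷ ys) ≤ c ^ k) len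
      (product-≤ (all-c (c≤x ∷ ps) (≤-trans s (≤-reflexive (cong (_* c) (sym len))))))
    where
    all-c : ∀ {xs} → All (c ≤_) xs → sum xs ≤ length xs * c → All (_≤ c) xs
    all-c [] _ = []
    all-c {z ∷ zs} (p ∷ ps) b =
      +-cancelʳ-≤ (length zs * c) _ _ (≤-trans (+-monoʳ-≤ z (sum-≥ ps)) b) ∷
      all-c ps (+-cancelˡ-≤ c _ _ (≤-trans (+-monoˡ-≤ (sum zs) p) b))
  ...   | inj₂ (y , rest , y≤c , sy , py , ly) with m≤n⇒∃[o]m+o≡n c≤x
  ...     | e , refl = begin
    (c + e) * product ys              ≡⟨ cong ((c + e) *_) py ⟩
    (c + e) * (y * product rest)      ≡⟨ *-assoc (c + e) y _ ⟨
    (c + e) * y * product rest        ≤⟨ *-monoˡ-≤ (product rest) smooth ⟩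
    c * (y + e) * product rest        ≡⟨ *-assoc c (y + e) _ ⟩
    c * product (y + e ∷ rest)
        ≤⟨ *-monoʳ-≤ c (am-gm′ m c (y + e ∷ rest) (trans (sym ly) (suc-injective len)) sum-bound) ⟩
    c * c ^ m                         ∎
    where
    open ≤-Reasoning
    smooth : (c + e) * y ≤ c * (y + e)
    smooth = ≤-trans (≤-reflexive (*-distribʳ-+ y c e))
      (≤-trans (+-monoʳ-≤ (c * y) (≤-trans (≤-reflexive (*-comm e y)) (*-monoˡ-≤ e y≤c)))
          (≤-reflexive (sym (*-distribˡ-+ c y e))))
    arrange : ∀ c y e r → c + (y + e + r) ≡ c + e + (y + r)
    arrange = solve-∀
    sum-bound : y + e + sum rest ≤ m * c
    sum-bound = +-cancelˡ-≤ c _ _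
        (≤-trans (≤-reflexive (trans (arrange c y e (sum rest)) (cong (c + e +_) (sym sy)))) s)

  ∏ᴸ : {A : Set} → List A → (A → ℕ) → ℕ
  ∏ᴸ l φ = product (map φ l)

  ∑-sum : {A : Set} (l : List A) (φ : A → ℕ) → sum (map φ l) ≡ ∑ l φ
  ∑-sum [] φ = refl
  ∑-sum (x ∷ l) φ = cong (φ x +_) (∑-sum l φ)

  am-gm : {A : Set} (l : List A) (φ : A → ℕ) → ∀ c → ∑ l φ ≤ length l * c → ∏ᴸ l φ ≤ c ^ length l
  am-gm l φ c s = am-gm′ (length l) c (map φ l) (length-map φ l) (≤-trans (≤-reflexive (∑-sum l φ)) s)

  ∏ᴸ-* : {A : Set} (l : List A) (φ ψ : A → ℕ) → ∏ᴸ l (λ x → φ x * ψ x) ≡ ∏ᴸ l φ * ∏ᴸ l ψ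
  ∏ᴸ-* [] φ ψ = refl
  ∏ᴸ-* (x ∷ l) φ ψ = trans (cong (φ x * ψ x *_) (∏ᴸ-* l φ ψ)) (interchange (φ x) (ψ x) (∏ᴸ l φ) (∏ᴸ l ψ))
    where
    interchange : ∀ a b c d → a * b * (c * d) ≡ a * c * (b * d)
    interchange = solve-∀

  ∏ᴸ-const : {A : Set} (l : List A) → ∀ c → ∏ᴸ l (λ _ → c) ≡ c ^ length l
  ∏ᴸ-const [] c = refl
  ∏ᴸ-const (x ∷ l) c = cong (c *_) (∏ᴸ-const l c)

  ∏ᴸ-cong : {A : Set} (l : List A) {φ ψ : A → ℕ} → (∀ x → φ x ≡ ψ x) → ∏ᴸ l φ ≡ ∏ᴸ l ψ
  ∏ᴸ-cong [] p = refl
  ∏ᴸ-cong (x ∷ l) p = cong₂ _*_ (p x) (∏ᴸ-cong l p)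

  below-average : {A : Set} (l : List A) (φ : A → ℕ) → ∀ c → 0 < length l → ∑ l φ ≤ length l * c →
    ∃ λ x → x ∈ l × φ x ≤ c
  below-average (x ∷ l) φ c _ = search x l
    where
    search : ∀ x l → ∑ (x ∷ l) φ ≤ suc (length l) * c → ∃ λ y → y ∈ x ∷ l × φ y ≤ c
    search x [] s = x , here refl , ≤-trans (≤-trans (≤-reflexive (sym (+-identityʳ (φ x)))) s)
        (≤-reflexive (+-identityʳ c))
    search x (x′ ∷ l) s with ≤-total (φ x) c
    ... | inj₁ p = x , here refl , p
    ... | inj₂ c≤φx =
      let y , y∈l , p = search x′ l (+-cancelˡ-≤ c _ _ (≤-trans (+-monoˡ-≤ (∑ (x′ ∷ l) φ) c≤φx) s))
      in y , there y∈l , p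

  length-vecs : {A : Set} (V : List A) → ∀ K → length (vecs V K) ≡ length V ^ K
  length-vecs V K = trans (sym (trans (∑-const (vecs V K) 1) (*-identityʳ _))) (count K)
    where
    count : ∀ K → ∑ (vecs V K) (λ _ → 1) ≡ length V ^ K
    count zero = refl
    count (suc K) = trans (∑-vecs-suc V K _) (trans (∑-cong (vecs V K) (λ _ → ∑-const V 1))
      (trans (∑-*ʳ (vecs V K) 1 (λ _ → length V)) (trans (*-identityʳ _)
        (trans (trans (∑-cong (vecs V K) (λ _ → sym (*-identityʳ (length V))))
            (∑-*ˡ (vecs V K) (length V) (λ _ → 1)))
          (cong (length V *_) (count K))))))

  hits : {A : Set} → ∀ {K} → (A → Bool) → Vec A K → ℕ
  hits g [] = 0
  hits g (w ∷ W) = ⟦ g w ⟧ + hits g W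

  hits-≤ : {A : Set} → ∀ {K} g (W : Vec A K) → hits g W ≤ K
  hits-≤ g [] = z≤n
  hits-≤ g (w ∷ W) with g w
  ... | true = s≤s (hits-≤ g W)
  ... | false = m≤n⇒m≤1+n (hits-≤ g W)

  module _ {A : Set} (V : List A) where

    module _ (g : A → Bool) where
      private
        D = ∑ V (λ w → ⟦ g w ⟧)
        D′ = ∑ V (λ w → ⟦ not (g w) ⟧)

      E[_] : ∀ K → (ℕ → ℕ) → ℕ
      E[ K ] φ = ∑ (vecs V K) (λ W → φ (hits g W))

      -- The first sample is a hit in D cases and a miss in D′ cases.
      E-suc : ∀ K φ → E[ suc K ] φ ≡ D * E[ K ] (φ ∘ suc) + D′ * E[ K ] φ
      E-suc K φ = begin
        E[ suc K ] φ
          ≡⟨ ∑-vecs-suc V K _ ⟩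
        ∑ (vecs V K) (λ W → ∑ V (λ w → φ (⟦ g w ⟧ + hits g W)))
          ≡⟨ ∑-cong (vecs V K) (λ W → trans (∑-cong V (λ w → split (g w) (hits g W)))
               (trans (∑-+ V _ _) (cong₂ _+_ (∑-*ʳ V (φ (suc (hits g W))) (λ w → ⟦ g w ⟧))
                   (∑-*ʳ V (φ (hits g W)) (λ w → ⟦ not (g w) ⟧))))) ⟩
        ∑ (vecs V K) (λ W → D * φ (suc (hits g W)) + D′ * φ (hits g W))
          ≡⟨ trans (∑-+ (vecs V K) _ _) (cong₂ _+_ (∑-*ˡ (vecs V K) D _) (∑-*ˡ (vecs V K) D′ _)) ⟩
        D * E[ K ] (φ ∘ suc) + D′ * E[ K ] φ ∎
        where
        open ≡-Reasoning
        split : ∀ b c → φ (⟦ b ⟧ + c) ≡ ⟦ b ⟧ * φ (suc c) + ⟦ not b ⟧ * φ c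
        split true c = sym (trans (+-identityʳ _) (+-identityʳ _))
        split false c = sym (+-identityʳ _)

      -- The factor x counts positions that are hits. Each of the K + 1 positions contributes the
      -- same: D choices at this position and K free samples elsewhere.
      size-bias : ∀ K ψ → E[ suc K ] (λ x → x * ψ x) ≡ suc K * (D * E[ K ] (ψ ∘ suc))
      size-bias zero ψ = trans (E-suc 0 (λ x → x * ψ x)) (lemma D D′ (ψ 1))
        where
        lemma : ∀ D D′ p → D * (1 * p + 0) + D′ * 0 ≡ 1 * (D * (p + 0))
        lemma = solve-∀
      size-bias (suc K) ψ = begin
        E[ suc (suc K) ] (λ x → x * ψ x)
          ≡⟨ E-suc (suc K) (λ x → x * ψ x) ⟩
        D * E[ suc K ] (λ x → ψ (suc x) + x * ψ (suc x)) + D′ * E[ suc K ] (λ x → x * ψ x)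
          ≡⟨ cong₂ (λ a b → D * a + D′ * b)
               (trans (∑-+ (vecs V (suc K)) _ _) (cong (E[ suc K ] (ψ ∘ suc) +_) (size-bias K (ψ ∘ suc))))
                   (size-bias K ψ) ⟩
        D * (E[ suc K ] (ψ ∘ suc) + suc K * (D * E[ K ] (ψ ∘ suc ∘ suc))) + D′ * (suc K * (D * E[ K ] (ψ ∘ suc)))
          ≡⟨ lemma D D′ (suc K) (E[ suc K ] (ψ ∘ suc)) (E[ K ] (ψ ∘ suc ∘ suc)) (E[ K ] (ψ ∘ suc)) ⟩
        D * E[ suc K ] (ψ ∘ suc) + suc K * (D * (D * E[ K ] (ψ ∘ suc ∘ suc) + D′ * E[ K ] (ψ ∘ suc)))
          ≡⟨ cong (λ z → D * E[ suc K ] (ψ ∘ suc) + suc K * (D * z)) (E-suc K (ψ ∘ suc)) ⟨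
        D * E[ suc K ] (ψ ∘ suc) + suc K * (D * E[ suc K ] (ψ ∘ suc)) ∎
        where
        open ≡-Reasoning
        lemma : ∀ D D′ k a b c → D * (a + k * (D * b)) + D′ * (k * (D * c)) ≡ D * a + k * (D * (D * b + D′ * c))
        lemma = solve-∀

    module _ (K : ℕ) where
      private
        -- ψ x is exactly Q / x for 1 ≤ x ≤ K + 1; at 0 only x * ψ x ≤ Q matters.
        Q = suc K !
        ψ : ℕ → ℕ
        ψ zero = 0
        ψ (suc x) = Q / suc x

        ψ-≤ : ∀ x → x * ψ x ≤ Q
        ψ-≤ zero = z≤n
        ψ-≤ (suc x) = ≤-trans (≤-reflexive (*-comm (suc x) (Q / suc x))) (m/n*n≤m Q (suc x))

        ψ-≡ : ∀ {x} → x ≤ K → suc x * ψ (suc x) ≡ Q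
        ψ-≡ {x} x≤K = trans (*-comm (suc x) (Q / suc x)) (m/n*n≡m (∣-trans (m∣m*n (x !)) (m≤n⇒m!∣n! (s≤s x≤K))))

      -- With ψ x = Q / x, `size-bias` trades the inverse of X + 1 over K samples for x * ψ x over K
      -- + 1 samples, which never exceeds Q.
      inverse-moment : ∀ g → suc K * (∑ V (λ w → ⟦ g w ⟧) * E[_] g K (ψ ∘ suc)) ≤ length V ^ suc K * Q
      inverse-moment g = begin
        suc K * (∑ V (λ w → ⟦ g w ⟧) * E[_] g K (ψ ∘ suc))   ≡⟨ size-bias g K ψ ⟨
        E[_] g (suc K) (λ x → x * ψ x)                       ≤⟨ ∑-mono (vecs V (suc K)) (λ W → ψ-≤ (hits g W)) ⟩
        ∑ (vecs V (suc K)) (λ _ → Q)                         ≡⟨ ∑-const (vecs V (suc K)) Q ⟩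
        length (vecs V (suc K)) * Q                          ≡⟨ cong (_* Q) (length-vecs V (suc K)) ⟩
        length V ^ suc K * Q                                 ∎
        where open ≤-Reasoning

      -- Averaging the sum over all e, not each summand separately, yields one W that serves all
      -- edges together.
      good-sample : {B : Set} (L : List B) (g : B → A → Bool) → 0 < length V →
        ∃ λ W → W ∈ vecs V K ×
          ∑ L (λ e → suc K * (∑ V (λ w → ⟦ g e w ⟧) * ψ (suc (hits (g e) W)))) ≤ length L * (length V * Q)
      good-sample L g V>0 = below-average (vecs V K)
        (λ W → ∑ L (λ e → suc K * (∑ V (λ w → ⟦ g e w ⟧) * ψ (suc (hits (g e) W)))))
        (length L * (length V * Q)) nonempty average
        where
        n^K>0 : 0 < length V ^ K
        n^K>0 = m^n>0 (length V) {{>-nonZero V>0}} K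
        nonempty : 0 < length (vecs V K)
        nonempty = subst (0 <_) (sym (length-vecs V K)) n^K>0
        open ≤-Reasoning
        lemma : ∀ l n p Q → l * (n * p * Q) ≡ p * (l * (n * Q))
        lemma = solve-∀
        average : ∑ (vecs V K) (λ W → ∑ L (λ e → suc K * (∑ V (λ w → ⟦ g e w ⟧) * ψ (suc (hits (g e) W))))) ≤
                  length (vecs V K) * (length L * (length V * Q))
        average = begin
          ∑ (vecs V K) (λ W → ∑ L (λ e → suc K * (∑ V (λ w → ⟦ g e w ⟧) * ψ (suc (hits (g e) W)))))
            ≡⟨ ∑-swap (vecs V K) L _ ⟩
          ∑ L (λ e → ∑ (vecs V K) (λ W → suc K * (∑ V (λ w → ⟦ g e w ⟧) * ψ (suc (hits (g e) W)))))
            ≡⟨ ∑-cong L (λ e → trans (∑-*ˡ (vecs V K) (suc K) _)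
                (cong (suc K *_) (∑-*ˡ (vecs V K) (∑ V (λ w → ⟦ g e w ⟧)) _))) ⟩
          ∑ L (λ e → suc K * (∑ V (λ w → ⟦ g e w ⟧) * E[_] (g e) K (ψ ∘ suc)))
            ≤⟨ ∑-mono L (λ e → inverse-moment (g e)) ⟩
          ∑ L (λ _ → length V ^ suc K * Q)
            ≡⟨ ∑-const L _ ⟩
          length L * (length V ^ suc K * Q)
            ≡⟨ lemma (length L) (length V) (length V ^ K) Q ⟩
          length V ^ K * (length L * (length V * Q))
            ≡⟨ cong (_* (length L * (length V * Q))) (length-vecs V K) ⟨
          length (vecs V K) * (length L * (length V * Q)) ∎

      -- The inequality of means converts the bound on the sum from `good-sample` into one on the
      -- product of the ratios of D e to its estimate. The common denominator Q keeps everything in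
      -- ℕ and is cancelled at the end.
      sampling : {B : Set} (L : List B) (g : B → A → Bool) → 0 < length V →
        suc K ^ length L * ∏ᴸ L (λ e → ∑ V (λ w → ⟦ g e w ⟧)) ≤
        length V ^ length L * ∑ (vecs V K) (λ W → ∏ᴸ L (λ e → suc (hits (g e) W)))
      sampling L g V>0 = let W , W∈ , small = good-sample L g V>0 in bound W W∈ small
        where
        open ≤-Reasoning
        m = length L
        Π = ∏ᴸ L
        D = λ e → ∑ V (λ w → ⟦ g e w ⟧)
        regroup : ∀ y p k d → y * p * (k * d) ≡ k * (d * p) * y
        regroup = solve-∀
        regroup′ : ∀ a b c → a * b * c ≡ b * (a * c)
        regroup′ = solve-∀
        bound : ∀ W → W ∈ vecs V K → ∑ L (λ e → suc K * (D e * ψ (suc (hits (g e) W)))) ≤ m * (length V * Q) →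
          suc K ^ m * Π D ≤ length V ^ m * ∑ (vecs V K) (λ W → Π (λ e → suc (hits (g e) W)))
        bound W W∈ small = *-cancelˡ-≤ (Q ^ m) {{m^n≢0 Q m {{suc K !≢0}}}} (begin
          Q ^ m * (suc K ^ m * Π D)
            ≡⟨ cong₂ (λ a b → a * (b * Π D)) (sym (∏ᴸ-const L Q)) (sym (∏ᴸ-const L (suc K))) ⟩
          Π (λ _ → Q) * (Π (λ _ → suc K) * Π D)
            ≡⟨ trans (∏ᴸ-* L (λ _ → Q) (λ e → suc K * D e)) (cong (Π (λ _ → Q) *_) (∏ᴸ-* L (λ _ → suc K) D)) ⟨
          Π (λ e → Q * (suc K * D e))
            -- At most K of the K samples are hits, so Y e divides Q and Q is exactly Y e * ψ (Y e).
            ≡⟨ ∏ᴸ-cong L (λ e → trans (cong (_* (suc K * D e)) (sym (ψ-≡ (hits-≤ (g e) W))))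
                (regroup (Y e) (ψ (Y e)) (suc K) (D e))) ⟩
          Π (λ e → suc K * (D e * ψ (Y e)) * Y e)
            ≡⟨ ∏ᴸ-* L _ Y ⟩
          Π (λ e → suc K * (D e * ψ (Y e))) * Π Y
            ≤⟨ *-monoˡ-≤ (Π Y) (am-gm L _ (length V * Q) small) ⟩
          (length V * Q) ^ m * Π Y
            ≡⟨ cong (_* Π Y) (trans (sym (∏ᴸ-const L (length V * Q)))
                (trans (∏ᴸ-* L _ _) (cong₂ _*_ (∏ᴸ-const L (length V)) (∏ᴸ-const L Q)))) ⟩
          length V ^ m * Q ^ m * Π Y
            ≡⟨ regroup′ (length V ^ m) (Q ^ m) (Π Y) ⟩
          Q ^ m * (length V ^ m * Π Y)
            -- The good W depends on g, and therefore on f; the sum over all W makes the bound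
            -- uniform.
            ≤⟨ *-monoʳ-≤ (Q ^ m) (*-monoʳ-≤ (length V ^ m) (∑-∈ W∈ (λ W → Π (λ e → suc (hits (g e) W))))) ⟩
          Q ^ m * (length V ^ m * ∑ (vecs V K) (λ W → Π (λ e → suc (hits (g e) W)))) ∎)
          where
          Y = λ e → suc (hits (g e) W)

-- Summing the products of degrees over all cochains f.

module DegreeSum where

  open Sums
  open NatSums
  open Exterior using (res)
  open TorsionBound using (mask; isSuc)
  open Degrees
  open SamplingBound
  open import Data.Nat hiding (_≟_; _<?_)
  open import Data.Nat.Properties hiding (_≟_; _<?_)
  open import Data.Nat.Combinatorics using (_C_; nCk+nC[k+1]≡[n+1]C[k+1]; nC1≡n)
  open import Data.Nat.Tactic.RingSolver using (solve-∀)
  open import Data.Bool using (Bool; true; false; not; _xor_; if_then_else_)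
  open import Data.Fin as Fin using (Fin; zero; suc; _<?_)
  open import Data.List as List using (List; []; _∷_; [_]; allFin; length)
  open import Data.List.Properties using (length-tabulate)
  open import Data.Product using (_×_; _,_; proj₁; proj₂)
  open import Data.Vec as Vec using (Vec; []; _∷_; lookup; tabulate; toList)
  open import Data.Vec.Properties using (lookup∘tabulate)
  open import Function using (_∘_; id)
  open import Relation.Nullary using (yes; no; contradiction)
  open import Relation.Nullary.Decidable using (⌊_⌋)
  open import Relation.Binary.PropositionalEquality using (_≡_; refl; sym; trans; cong; cong₂; module ≡-Reasoning)

  holes : ∀ {E} → Vec Bool E → ℕ
  holes M = faces (Vec.map not M)

  faces-tabulate : ∀ {A : Set} (l : List A) (b : A → Bool) → faces (tabulate (λ t → b (List.lookup l t))) ≡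
      ∑ l (λ x → ⟦ b x ⟧)
  faces-tabulate [] b = refl
  faces-tabulate (x ∷ l) b with b x
  ... | true = cong suc (faces-tabulate l b)
  ... | false = faces-tabulate l b

  holes-tabulate : ∀ {A : Set} (l : List A) (b : A → Bool) → holes (tabulate (λ t → b (List.lookup l t))) ≡
      ∑ l (λ x → ⟦ not (b x) ⟧)
  holes-tabulate [] b = refl
  holes-tabulate (x ∷ l) b with b x
  ... | false = cong suc (holes-tabulate l b)
  ... | true = holes-tabulate l b

  ∑-edgeList : ∀ n (φ : Fin n × Fin n → ℕ) →
    ∑ (edgeList n) φ ≡ ∑ (allFin n) λ i → ∑ (allFin n) λ j → ⟦ ⌊ i <? j ⌋ ⟧ * φ (i , j)
  ∑-edgeList n φ = trans (∑-concatMap _ (allFin n) φ) (∑-cong (allFin n) λ i →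
    trans (∑-concatMap _ (allFin n) φ) (∑-cong (allFin n) λ j → cell ⌊ i <? j ⌋ (i , j)))
    where
    cell : ∀ b x → ∑ (if b then [ x ] else []) φ ≡ ⟦ b ⟧ * φ x
    cell true x = refl
    cell false x = refl

  suc-<? : ∀ {n} (i j : Fin n) → ⌊ suc i <? suc j ⌋ ≡ ⌊ i <? j ⌋
  suc-<? i j with suc i <? suc j | i <? j
  ... | yes _ | yes _ = refl
  ... | no _ | no _ = refl
  ... | yes (s≤s p) | no q = contradiction p q
  ... | no p | yes q = contradiction (s≤s q) p

  pairs : ℕ → ℕ
  pairs n = ∑ (allFin n) λ i → ∑ (allFin n) λ j → ⟦ ⌊ i <? j ⌋ ⟧

  row-suc : ∀ {n} (i : Fin n) → ∑ (allFin (suc n)) (λ j → ⟦ ⌊ suc i <? j ⌋ ⟧) ≡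
      ∑ (allFin n) (λ j → ⟦ ⌊ i <? j ⌋ ⟧)
  row-suc {n} i = trans (∑-allFin-suc n (λ j → ⟦ ⌊ suc i <? j ⌋ ⟧))
      (∑-cong (allFin n) (λ j → cong ⟦_⟧ (suc-<? i j)))

  row-zero : ∀ n → ∑ (allFin (suc n)) (λ j → ⟦ ⌊ zero {n} <? j ⌋ ⟧) ≡ n
  row-zero n = trans (∑-allFin-suc n (λ j → ⟦ ⌊ zero {n} <? j ⌋ ⟧))
      (trans (∑-const (allFin n) 1) (trans (*-identityʳ _) (length-tabulate id)))

  pairs-C : ∀ n → pairs n ≡ n C 2
  pairs-C zero = refl
  pairs-C (suc n) = begin
    pairs (suc n)          ≡⟨ ∑-allFin-suc n (λ i → ∑ (allFin (suc n)) (λ j → ⟦ ⌊ i <? j ⌋ ⟧)) ⟩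
    ∑ (allFin (suc n)) (λ j → ⟦ ⌊ zero {n} <? j ⌋ ⟧) +
        ∑ (allFin n) (λ i → ∑ (allFin (suc n)) (λ j → ⟦ ⌊ suc i <? j ⌋ ⟧))
                           ≡⟨ cong₂ _+_ (row-zero n) (∑-cong (allFin n) row-suc) ⟩
    n + pairs n            ≡⟨ cong₂ _+_ (sym (nC1≡n n)) (pairs-C n) ⟩
    n C 1 + n C 2          ≡⟨ nCk+nC[k+1]≡[n+1]C[k+1] n 1 ⟩
    suc n C 2              ∎
    where open ≡-Reasoning

  sucC2 : ∀ n → suc n C 2 ≡ n + n C 2
  sucC2 n = trans (sym (nCk+nC[k+1]≡[n+1]C[k+1] n 1)) (cong (_+ n C 2) (nC1≡n n))

  2*nC2≤n*n : ∀ n → 2 * (n C 2) ≤ n * n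
  2*nC2≤n*n zero = z≤n
  2*nC2≤n*n (suc n) = begin
    2 * (suc n C 2)            ≡⟨ cong (2 *_) (sucC2 n) ⟩
    2 * (n + n C 2)            ≡⟨ *-distribˡ-+ 2 n (n C 2) ⟩
    2 * n + 2 * (n C 2)        ≤⟨ +-monoʳ-≤ (2 * n) (2*nC2≤n*n n) ⟩
    2 * n + n * n              ≤⟨ n≤1+n _ ⟩
    1 + (2 * n + n * n)        ≡⟨ square n ⟩
    suc n * suc n              ∎
    where
    open ≤-Reasoning
    square : ∀ n → 1 + (2 * n + n * n) ≡ (1 + n) * (1 + n)
    square = solve-∀

  faces-mask : ∀ n′ → faces (mask n′) ≡ n′ C 2
  faces-mask n′ = begin
    faces (mask n′)
      ≡⟨ faces-tabulate (edgeList (suc n′)) (isSuc ∘ proj₁) ⟩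
    ∑ (edgeList (suc n′)) (λ p → ⟦ isSuc (proj₁ p) ⟧)
      ≡⟨ ∑-edgeList (suc n′) _ ⟩
    ∑ (allFin (suc n′)) (λ i → ∑ (allFin (suc n′)) (λ j → ⟦ ⌊ i <? j ⌋ ⟧ * ⟦ isSuc i ⟧))
      ≡⟨ ∑-allFin-suc n′ (λ i → ∑ (allFin (suc n′)) (λ j → ⟦ ⌊ i <? j ⌋ ⟧ * ⟦ isSuc i ⟧)) ⟩
    ∑ (allFin (suc n′)) (λ j → ⟦ ⌊ zero {n′} <? j ⌋ ⟧ * 0) +
        ∑ (allFin n′) (λ i → ∑ (allFin (suc n′)) (λ j → ⟦ ⌊ suc i <? j ⌋ ⟧ * 1))
      ≡⟨ cong₂ _+_ (trans (∑-cong (allFin (suc n′)) (λ j → *-zeroʳ ⟦ ⌊ zero {n′} <? j ⌋ ⟧))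
          (∑-zero (allFin (suc n′))))
           (∑-cong (allFin n′) (λ i → trans (∑-cong (allFin (suc n′)) (λ j → *-identityʳ ⟦ ⌊ suc i <? j ⌋ ⟧))
               (row-suc i))) ⟩
    pairs n′
      ≡⟨ pairs-C n′ ⟩
    n′ C 2 ∎
    where open ≡-Reasoning

  holes-mask : ∀ n′ → holes (mask n′) ≡ n′
  holes-mask n′ = begin
    holes (mask n′)
      ≡⟨ holes-tabulate (edgeList (suc n′)) (isSuc ∘ proj₁) ⟩
    ∑ (edgeList (suc n′)) (λ p → ⟦ not (isSuc (proj₁ p)) ⟧)
      ≡⟨ ∑-edgeList (suc n′) _ ⟩
    ∑ (allFin (suc n′)) (λ i → ∑ (allFin (suc n′)) (λ j → ⟦ ⌊ i <? j ⌋ ⟧ * ⟦ not (isSuc i) ⟧))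
      ≡⟨ ∑-allFin-suc n′ (λ i → ∑ (allFin (suc n′)) (λ j → ⟦ ⌊ i <? j ⌋ ⟧ * ⟦ not (isSuc i) ⟧)) ⟩
    ∑ (allFin (suc n′)) (λ j → ⟦ ⌊ zero {n′} <? j ⌋ ⟧ * 1) +
        ∑ (allFin n′) (λ i → ∑ (allFin (suc n′)) (λ j → ⟦ ⌊ suc i <? j ⌋ ⟧ * 0))
      ≡⟨ cong₂ _+_ (trans (∑-cong (allFin (suc n′)) (λ j → *-identityʳ ⟦ ⌊ zero {n′} <? j ⌋ ⟧)) (row-zero n′))
           (trans (∑-cong (allFin n′)
               (λ i → trans (∑-cong (allFin (suc n′)) (λ j → *-zeroʳ ⟦ ⌊ suc i <? j ⌋ ⟧))
                   (∑-zero (allFin (suc n′))))) (∑-zero (allFin n′))) ⟩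
    n′ + 0
      ≡⟨ +-identityʳ n′ ⟩
    n′ ∎
    where open ≡-Reasoning

  ∏ᴸ-res : ∀ {B : Set} {E} (M : Vec Bool E) (ι : Fin E → B) (φ : B → ℕ) →
    ∏ᴸ (toList (res M (tabulate ι))) φ ≡ ∏ (λ e → if lookup M e then φ (ι e) else 1)
  ∏ᴸ-res [] ι φ = refl
  ∏ᴸ-res (true ∷ M) ι φ = cong (φ (ι zero) *_) (∏ᴸ-res M (ι ∘ suc) φ)
  ∏ᴸ-res (false ∷ M) ι φ = trans (∏ᴸ-res M (ι ∘ suc) φ) (sym (+-identityʳ _))

  ∏-mask-const : ∀ {E} (M : Vec Bool E) x y → ∏ (λ e → if lookup M e then x else y) ≡ x ^ faces M * y ^ holes M
  ∏-mask-const [] x y = refl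
  ∏-mask-const (true ∷ M) x y = trans (cong (x *_) (∏-mask-const M x y)) (sym (*-assoc x (x ^ faces M) _))
  ∏-mask-const (false ∷ M) x y = trans (cong (y *_) (∏-mask-const M x y)) (rot y (x ^ faces M) (y ^ holes M))
    where
    rot : ∀ a b c → a * (b * c) ≡ b * (a * c)
    rot = solve-∀

  length-toList : ∀ {B : Set} {k} (v : Vec B k) → length (toList v) ≡ k
  length-toList [] = refl
  length-toList (x ∷ v) = cong suc (length-toList v)

  -- `hits` as a function of the sampled rows of u and v and of the bit b = f(uv), with b as a
  -- separate variable.
  agree : ∀ {K} → Vec Bool K → Vec Bool K → Bool → ℕ
  agree [] [] b = 0
  agree (x ∷ xs) (y ∷ ys) b = ⟦ not ((x xor y) xor b) ⟧ + agree xs ys b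

  -- Every sample agrees with exactly one of the two values of the bit.
  agree-total : ∀ {K} (xs ys : Vec Bool K) → agree xs ys true + agree xs ys false ≡ K
  agree-total [] [] = refl
  agree-total (x ∷ xs) (y ∷ ys) = trans (cell (x xor y) (agree xs ys true) (agree xs ys false))
      (cong suc (agree-total xs ys))
    where
    cell : ∀ b p q → (⟦ not (b xor true) ⟧ + p) + (⟦ not (b xor false) ⟧ + q) ≡ suc (p + q)
    cell true p q = refl
    cell false p q = +-suc p q

  module _ (n′ K : ℕ) where
    private
      n = suc n′
      M = mask n′
      #E = length (edgeList n)
      V = allFin n
      L = toList (res M (tabulate id))

    -- In `sampled-sum` these rows are replaced by a sum over all Φ. Forgetting that they come from
    -- f costs the number of all Φ, 2^(nK), and frees the bits of f.
    traces : Vec Bool #E → Vec (Fin n) K → Vec (Vec Bool K) n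
    traces f W = tabulate (λ u → Vec.map (adj n f u) W)

    factor : Vec (Vec Bool K) n → Edge n → Bool → ℕ
    factor Φ e b = if lookup M e then suc
        (agree (lookup Φ (proj₁ (edge n e))) (lookup Φ (proj₂ (edge n e))) b) else 1

    hits-agree : ∀ f e (W : Vec (Fin n) K) →
      hits (good (adj n f) (edge n e)) W ≡
      agree (lookup (traces f W) (proj₁ (edge n e))) (lookup (traces f W) (proj₂ (edge n e))) (lookup f e)
    hits-agree f e W = trans (go W) (cong₂ (λ xs ys → agree xs ys (lookup f e))
      (sym (lookup∘tabulate (λ u → Vec.map (adj n f u) W) (proj₁ (edge n e))))
      (sym (lookup∘tabulate (λ u → Vec.map (adj n f u) W) (proj₂ (edge n e)))))
      where
      go : ∀ {k} (W : Vec (Fin n) k) → hits (good (adj n f) (edge n e)) W ≡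
        agree (Vec.map (adj n f (proj₁ (edge n e))) W) (Vec.map (adj n f (proj₂ (edge n e))) W) (lookup f e)
      go [] = refl
      go (w ∷ W) = cong₂ _+_ (cong
          (λ b → ⟦ not ((adj n f (proj₁ (edge n e)) w xor adj n f (proj₂ (edge n e)) w) xor b) ⟧)
              (adj-edge n f e)) (go W)

    -- The two successors add 2 to the K agreements. An edge at vertex 0 has the factor 1 for either
    -- bit, which gives the 2.
    factor-total : ∀ Φ e → factor Φ e true + (factor Φ e false + 0) ≡ (if lookup M e then 2 + K else 2)
    factor-total Φ e with lookup M e
    ... | false = refl
    ... | true = cong suc (trans (cong (agree x y true +_) (+-identityʳ _))
      (trans (+-suc (agree x y true) (agree x y false)) (cong suc (agree-total x y))))
      where
      x = lookup Φ (proj₁ (edge n e))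
      y = lookup Φ (proj₂ (edge n e))

    -- For fixed traces Φ the factors of distinct edges depend on distinct bits of f,
    -- and the two values of each factor add up to K + 2.
    sampled-sum : ∀ W → ∑ (vecs bools #E) (λ f → ∏ᴸ L (λ e → suc (hits (good (adj n f) (edge n e)) W))) ≤
      (2 ^ K) ^ n * ((2 + K) ^ faces M * 2 ^ holes M)
    sampled-sum W = begin
      ∑ (vecs bools #E) (λ f → ∏ᴸ L (λ e → suc (hits (good (adj n f) (edge n e)) W)))
        ≡⟨ ∑-cong (vecs bools #E) (λ f → trans (∏ᴸ-res M id _)
             (∏-cong (λ e → cong (λ h → if lookup M e then suc h else 1) (hits-agree f e W)))) ⟩
      ∑ (vecs bools #E) (λ f → ∏ (λ e → factor (traces f W) e (lookup f e)))
        ≤⟨ ∑-mono (vecs bools #E) (λ f → ∑-∈ (∈-vecs (∈-vecs ∈-bools) (traces f W))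
            (λ Φ → ∏ (λ e → factor Φ e (lookup f e)))) ⟩
      ∑ (vecs bools #E) (λ f → ∑ Φs (λ Φ → ∏ (λ e → factor Φ e (lookup f e))))
        ≡⟨ ∑-swap (vecs bools #E) Φs _ ⟩
      ∑ Φs (λ Φ → ∑ (vecs bools #E) (λ f → ∏ (λ e → factor Φ e (lookup f e))))
        ≡⟨ ∑-cong Φs (λ Φ → trans (∑-∏ bools #E (factor Φ))
            (trans (∏-cong (factor-total Φ)) (∏-mask-const M (2 + K) 2))) ⟩
      ∑ Φs (λ _ → (2 + K) ^ faces M * 2 ^ holes M)
        ≡⟨ ∑-const Φs _ ⟩
      length Φs * ((2 + K) ^ faces M * 2 ^ holes M)
        ≡⟨ cong (_* ((2 + K) ^ faces M * 2 ^ holes M))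
            (trans (length-vecs (vecs bools K) n) (cong (_^ n) (length-vecs bools K))) ⟩
      (2 ^ K) ^ n * ((2 + K) ^ faces M * 2 ^ holes M) ∎
      where
      open ≤-Reasoning
      Φs = vecs (vecs bools K) n

    -- `sampling` is applied to every f; after the exchange of sums `sampled-sum` handles each W,
    -- and n ^ K is the number of W.
    degree-sum : suc K ^ faces M * ∑ (vecs bools #E) (λ f → ∏ (λ e → if lookup M e then degree n f e else 1)) ≤
      n ^ faces M * (n ^ K * ((2 ^ K) ^ n * ((2 + K) ^ faces M * 2 ^ holes M)))
    degree-sum = begin
      suc K ^ faces M * ∑ (vecs bools #E) (λ f → ∏ (λ e → if lookup M e then degree n f e else 1))
        ≡⟨ cong₂ (λ l s → suc K ^ l * s) (sym lenL)
            (∑-cong (vecs bools #E) (λ f → sym (∏ᴸ-res M id (degree n f)))) ⟩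
      suc K ^ length L * ∑ (vecs bools #E) (λ f → ∏ᴸ L (degree n f))
        ≡⟨ ∑-*ˡ (vecs bools #E) (suc K ^ length L) _ ⟨
      ∑ (vecs bools #E) (λ f → suc K ^ length L * ∏ᴸ L (degree n f))
        ≤⟨ ∑-mono (vecs bools #E) (λ f → sampling V K L (λ e → good (adj n f) (edge n e)) (s≤s z≤n)) ⟩
      ∑ (vecs bools #E) (λ f → length V ^ length L * ∑ (vecs V K) (λ W → Y f W))
        ≡⟨ trans (∑-*ˡ (vecs bools #E) (length V ^ length L) _)
            (cong₂ (λ v l → v ^ l * ∑ (vecs bools #E) (λ f → ∑ (vecs V K) (λ W → Y f W))) lenV lenL) ⟩
      n ^ faces M * ∑ (vecs bools #E) (λ f → ∑ (vecs V K) (λ W → Y f W))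
        ≡⟨ cong (n ^ faces M *_) (∑-swap (vecs bools #E) (vecs V K) Y) ⟩
      n ^ faces M * ∑ (vecs V K) (λ W → ∑ (vecs bools #E) (λ f → Y f W))
        ≤⟨ *-monoʳ-≤ (n ^ faces M) (∑-mono (vecs V K) sampled-sum) ⟩
      n ^ faces M * ∑ (vecs V K) (λ _ → (2 ^ K) ^ n * ((2 + K) ^ faces M * 2 ^ holes M))
        ≡⟨ cong (n ^ faces M *_) (trans (∑-const (vecs V K) _)
            (cong (_* ((2 ^ K) ^ n * ((2 + K) ^ faces M * 2 ^ holes M)))
             (trans (length-vecs V K) (cong (_^ K) lenV)))) ⟩
      n ^ faces M * (n ^ K * ((2 ^ K) ^ n * ((2 + K) ^ faces M * 2 ^ holes M))) ∎
      where
      open ≤-Reasoning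
      lenV : length V ≡ n
      lenV = length-tabulate id
      lenL : length L ≡ faces M
      lenL = length-toList (res M (tabulate id))
      Y : Vec Bool #E → Vec (Fin n) K → ℕ
      Y f W = ∏ᴸ L (λ e → suc (hits (good (adj n f) (edge n e)) W))

-- Numerical estimates for the choice of constants.

module Numerics where

  open import Data.Nat
  open import Data.Nat.Properties
  open import Data.Nat.DivMod using (m≡m%n+[m/n]*n; m%n<n; m/n*n≤m; m*n/n≡m; /-monoˡ-≤)
  open import Data.Nat.Combinatorics using (_C_)
  open import Data.Nat.Tactic.RingSolver using (solve-∀)
  open import Relation.Binary.PropositionalEquality using (_≡_; sym; trans; cong; cong₂; subst)
  open DegreeSum using (sucC2; 2*nC2≤n*n)

  -- Bernoulli's inequality (1 - x)^r ≥ 1 - rx at x = 1 / (κ + 1), with denominators cleared.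
  bernoulli : ∀ κ r e → r + e ≡ suc κ → suc κ ^ r * e ≤ κ ^ r * suc κ
  bernoulli κ zero e eq = ≤-reflexive (cong (1 *_) eq)
  bernoulli κ (suc r) e eq = begin
    suc κ * suc κ ^ r * e        ≡⟨ rot (suc κ) (suc κ ^ r) e ⟩
    suc κ ^ r * (suc κ * e)      ≤⟨ *-monoʳ-≤ (suc κ ^ r) step ⟩
    suc κ ^ r * (κ * suc e)      ≡⟨ rot′ (suc κ ^ r) κ (suc e) ⟩
    κ * (suc κ ^ r * suc e)      ≤⟨ *-monoʳ-≤ κ (bernoulli κ r (suc e) (trans (+-suc r e) eq)) ⟩
    κ * (κ ^ r * suc κ)          ≡⟨ *-assoc κ (κ ^ r) (suc κ) ⟨
    κ * κ ^ r * suc κ            ∎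
    where
    open ≤-Reasoning
    rot : ∀ a b c → a * b * c ≡ b * (a * c)
    rot = solve-∀
    rot′ : ∀ a b c → a * (b * c) ≡ b * (a * c)
    rot′ = solve-∀
    e≤κ : e ≤ κ
    e≤κ = ≤-trans (m≤n+m e r) (≤-reflexive (suc-injective eq))
    step : suc κ * e ≤ κ * suc e
    step = ≤-trans (+-monoˡ-≤ (κ * e) e≤κ) (≤-reflexive (sym (*-suc κ e)))

  module _ (q : ℕ) .{{_ : NonZero q}} (κ : ℕ) (κ+1≡2q : suc κ ≡ 2 * q) where

    -- As r ≤ q is at most half of κ + 1, the right side of Bernoulli's inequality is at least 1/2.
    half-power : ∀ r → r ≤ q → suc κ ^ r ≤ 2 * κ ^ r
    half-power r r≤q = *-cancelʳ-≤ _ _ q (begin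
      suc κ ^ r * q           ≤⟨ *-monoʳ-≤ (suc κ ^ r) q≤e ⟩
      suc κ ^ r * (2 * q ∸ r) ≤⟨ bernoulli κ r (2 * q ∸ r)
          (trans (m+[n∸m]≡n (≤-trans r≤q (m≤m+n q _))) (sym κ+1≡2q)) ⟩
      κ ^ r * suc κ           ≡⟨ cong (κ ^ r *_) κ+1≡2q ⟩
      κ ^ r * (2 * q)         ≡⟨ rot (κ ^ r) 2 q ⟩
      2 * κ ^ r * q           ∎)
      where
      open ≤-Reasoning
      rot : ∀ a b c → a * (b * c) ≡ b * a * c
      rot = solve-∀
      q≤e : q ≤ 2 * q ∸ r
      q≤e = ≤-trans (≤-reflexive (sym (trans (cong (_∸ q) (cong (q +_) (+-identityʳ q))) (m+n∸n≡m q q))))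
          (∸-monoʳ-≤ (2 * q) r≤q)

    power-ratio′ : ∀ j r → r ≤ q → suc κ ^ (r + j * q) ≤ 2 ^ suc j * κ ^ (r + j * q)
    power-ratio′ zero r r≤q = subst (λ m → suc κ ^ m ≤ 2 * κ ^ m) (sym (+-identityʳ r)) (half-power r r≤q)
    power-ratio′ (suc j) r r≤q = begin
      suc κ ^ (r + (q + j * q))                              ≡⟨ cong (suc κ ^_) (rot r q (j * q)) ⟩
      suc κ ^ (q + (r + j * q))                              ≡⟨ ^-distribˡ-+-* (suc κ) q (r + j * q) ⟩
      suc κ ^ q * suc κ ^ (r + j * q)
          ≤⟨ *-mono-≤ (half-power q ≤-refl) (power-ratio′ j r r≤q) ⟩
      2 * κ ^ q * (2 ^ suc j * κ ^ (r + j * q))              ≡⟨ regroup (κ ^ q) (2 ^ suc j) (κ ^ (r + j * q)) ⟩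
      2 * 2 ^ suc j * (κ ^ q * κ ^ (r + j * q))
          ≡⟨ cong (2 * 2 ^ suc j *_) (^-distribˡ-+-* κ q (r + j * q)) ⟨
      2 * 2 ^ suc j * κ ^ (q + (r + j * q))
          ≡⟨ cong (λ z → 2 * 2 ^ suc j * κ ^ z) (rot r q (j * q)) ⟨
      2 * 2 ^ suc j * κ ^ (r + (q + j * q))                  ∎
      where
      open ≤-Reasoning
      rot : ∀ a b c → a + (b + c) ≡ b + (a + c)
      rot = solve-∀
      regroup : ∀ a b c → 2 * a * (b * c) ≡ 2 * b * (a * c)
      regroup = solve-∀

    -- The exponent is cut into m / q blocks of length q and a remainder; each piece costs at most a
    -- factor 2.
    power-ratio : ∀ m → suc κ ^ m ≤ 2 ^ suc (m / q) * κ ^ m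
    power-ratio m = subst (λ z → suc κ ^ z ≤ 2 ^ suc (m / q) * κ ^ z) (sym (m≡m%n+[m/n]*n m q))
      (power-ratio′ (m / q) (m % q) (<⇒≤ (m%n<n m q)))

  n<2^n : ∀ n → n < 2 ^ n
  n<2^n zero = s≤s z≤n
  n<2^n (suc n) = begin-strict
    suc n             ≤⟨ n<2^n n ⟩
    2 ^ n             <⟨ m<m+n (2 ^ n) (m^n>0 2 n) ⟩
    2 ^ n + 2 ^ n     ≡⟨ cong (2 ^ n +_) (+-identityʳ (2 ^ n)) ⟨
    2 ^ suc n         ∎
    where open ≤-Reasoning

  -- The induction starts at 3c because c (3c + 1) ≤ (c + 1)³ ≤ 2^(3c). From there on the left side
  -- at most doubles in each step.
  linear-≤-2^ : ∀ c j → c * suc (3 * c + j) ≤ 2 ^ (3 * c + j)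
  linear-≤-2^ c zero = begin
    c * suc (3 * c + 0)               ≤⟨ m≤m+n _ _ ⟩
    c * suc (3 * c + 0) + (c * c * c + 2 * c + 1)
                                      ≡⟨ cube c ⟩
    suc c * (suc c * (suc c * 1))     ≤⟨ *-mono-≤ (n<2^n c) (*-mono-≤ (n<2^n c) (*-monoˡ-≤ 1 (n<2^n c))) ⟩
    2 ^ c * (2 ^ c * (2 ^ c * 1))     ≡⟨ ^-*-assoc 2 c 3 ⟩
    2 ^ (c * 3)                       ≡⟨ cong (2 ^_) (trans (*-comm c 3) (sym (+-identityʳ (3 * c)))) ⟩
    2 ^ (3 * c + 0)                   ∎
    where
    open ≤-Reasoning
    cube : ∀ c → c * (1 + (3 * c + 0)) + (c * c * c + 2 * c + 1) ≡ (1 + c) * ((1 + c) * ((1 + c) * 1))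
    cube = solve-∀
  linear-≤-2^ c (suc j) = begin
    c * suc (3 * c + suc j)           ≡⟨ cong (λ z → c * suc z) (+-suc (3 * c) j) ⟩
    c * suc (suc (3 * c + j))         ≤⟨ *-monoʳ-≤ c (s≤s (s≤s (m≤n+m _ (3 * c + j)))) ⟩
    c * suc (suc (3 * c + j + (3 * c + j)))
                                      ≡⟨ double c (3 * c + j) ⟩
    2 * (c * suc (3 * c + j))         ≤⟨ *-monoʳ-≤ 2 (linear-≤-2^ c j) ⟩
    2 ^ suc (3 * c + j)               ≡⟨ cong (2 ^_) (+-suc (3 * c) j) ⟨
    2 ^ (3 * c + suc j)               ∎
    where
    open ≤-Reasoning
    double : ∀ c x → c * (2 + (x + x)) ≡ 2 * (c * (1 + x))
    double = solve-∀

  -- Here t bounds K and the binary logarithms of b and n. In the application it is about n / 8q, so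
  -- terms of order n log n are simply replaced by tn, which is at most n²/8q.
  module _ (q b n″ t K w : ℕ) .{{_ : NonZero q}}
    (K+2≡2q : 2 + K ≡ 2 * q) (K<t : K < t) (b<2^t : b < 2 ^ t)
    (n≤2^t : 2 + n″ ≤ 2 ^ t) (8qt≤n : 8 * q * t ≤ 2 + n″) where

    private
      n = 2 + n″
      m = suc n″ C 2
      D = n * n / q
      norm = n ^ (n″ C 2)
      -- The exponents of 2 lost to n ^ n″, n ^ K, the choice of Φ, the ratio of (K + 2)^m to (K +
      -- 1)^m, and the edges at vertex 0.
      X = (t * n″ + t * K + K * n) + (suc (m / q) + suc n″)

    t≤n : t ≤ n
    t≤n = ≤-trans (m≤n*m t (8 * q) {{m*n≢0 8 q}}) 8qt≤n

    -- After multiplication by 2q there is room for 2n². The term m / q takes at most 2m ≤ n²; all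
    -- others are together at most 4tn and take another n², since 8qt ≤ n.
    exponent-bound : t + X ≤ D
    exponent-bound = ≤-trans (≤-reflexive (sym (m*n/n≡m (t + X) q))) (/-monoˡ-≤ q (*-cancelˡ-≤ 2 (begin
      2 * ((t + X) * q)
        ≡⟨ split t X q ⟩
      2 * (q * t) + 2 * (q * X)
        ≡⟨ expand q t (t * n″ + t * K + K * n) (m / q) n″ ⟩
      2 * (q * (t + (t * n″ + t * K + K * n) + (2 + n″))) + 2 * (m / q * q)
        ≤⟨ +-mono-≤ (*-monoʳ-≤ 2 (*-monoʳ-≤ q linear)) (*-monoʳ-≤ 2 (m/n*n≤m m q)) ⟩
      2 * (q * (4 * (t * n))) + 2 * m
        ≤⟨ +-mono-≤ (≤-trans (≤-reflexive (eight q t n)) (*-monoˡ-≤ n 8qt≤n))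
            (≤-trans (2*nC2≤n*n (suc n″)) (*-mono-≤ (n≤1+n (suc n″)) (n≤1+n (suc n″)))) ⟩
      n * n + n * n
        ≡⟨ cong (n * n +_) (+-identityʳ (n * n)) ⟨
      2 * (n * n) ∎)))
      where
      open ≤-Reasoning
      split : ∀ t X q → 2 * ((t + X) * q) ≡ 2 * (q * t) + 2 * (q * X)
      split = solve-∀
      expand : ∀ q t y j n″ → 2 * (q * t) + 2 * (q * (y + ((1 + j) + (1 + n″)))) ≡
          2 * (q * (t + y + (2 + n″))) + 2 * (j * q)
      expand = solve-∀
      eight : ∀ q t n → 2 * (q * (4 * (t * n))) ≡ 8 * q * t * n
      eight = solve-∀
      K≤n : K ≤ n
      K≤n = ≤-trans (<⇒≤ K<t) t≤n
      linear : t + (t * n″ + t * K + K * n) + (2 + n″) ≤ 4 * (t * n)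
      linear = begin
        t + (t * n″ + t * K + K * n) + n
          ≤⟨ +-monoˡ-≤ n (+-mono-≤ (m≤m*n t n)
              (+-monoˡ-≤ (K * n) (+-mono-≤ (*-monoʳ-≤ t (≤-trans (n≤1+n n″) (n≤1+n (suc n″))))
                  (*-monoʳ-≤ t K≤n)))) ⟩
        t * n + (t * n + t * n + K * n) + n
          ≡⟨ collect (t * n) K n ⟩
        3 * (t * n) + (1 + K) * n
          -- The strictness of `K<t` absorbs the single n.
          ≤⟨ +-monoʳ-≤ (3 * (t * n)) (*-monoˡ-≤ n K<t) ⟩
        3 * (t * n) + t * n
          ≡⟨ four (t * n) ⟩
        4 * (t * n) ∎
        where
        collect : ∀ x K n → x + (x + x + K * n) + n ≡ 3 * x + (1 + K) * n
        collect = solve-∀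
        four : ∀ x → 3 * x + x ≡ 4 * x
        four = solve-∀

    -- As C(n-1,2) = (n-2) + C(n-2,2), the power n ^ m contains the normalizer. By `power-ratio` (K
    -- + 2)^m contains the factor to be cancelled, and the rest is bounded by powers of 2.
    collected-bound : suc K ^ m * (2 ^ D * w) ≤ n ^ m * (n ^ K * ((2 ^ K) ^ n * ((2 + K) ^ m * 2 ^ suc n″))) →
      2 ^ D * w ≤ norm * 2 ^ X
    collected-bound bound = *-cancelˡ-≤ (suc K ^ m) {{m^n≢0 (suc K) m}} (begin
      suc K ^ m * (2 ^ D * w)
        ≤⟨ bound ⟩
      n ^ m * (n ^ K * ((2 ^ K) ^ n * ((2 + K) ^ m * 2 ^ suc n″)))
        ≡⟨ cong₂ (λ x y → x * (n ^ K * (y * ((2 + K) ^ m * 2 ^ suc n″)))) n^m (^-*-assoc 2 K n) ⟩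
      n ^ n″ * norm * (n ^ K * (2 ^ (K * n) * ((2 + K) ^ m * 2 ^ suc n″)))
        ≤⟨ *-mono-≤ (*-monoˡ-≤ norm (n^ n″))
            (*-mono-≤ (n^ K) (*-monoʳ-≤ (2 ^ (K * n))
                (*-monoˡ-≤ (2 ^ suc n″) (power-ratio q (suc K) K+2≡2q m)))) ⟩
      2 ^ (t * n″) * norm * (2 ^ (t * K) * (2 ^ (K * n) * (2 ^ suc (m / q) * suc K ^ m * 2 ^ suc n″)))
        ≡⟨ regroup (2 ^ (t * n″)) norm (2 ^ (t * K)) (2 ^ (K * n)) (2 ^ suc (m / q)) (suc K ^ m) (2 ^ suc n″) ⟩
      suc K ^ m * (norm * ((2 ^ (t * n″) * 2 ^ (t * K) * 2 ^ (K * n)) * (2 ^ suc (m / q) * 2 ^ suc n″)))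
        ≡⟨ cong (λ z → suc K ^ m * (norm * z)) exponents ⟩
      suc K ^ m * (norm * 2 ^ X) ∎)
      where
      open ≤-Reasoning
      n^m : n ^ m ≡ n ^ n″ * norm
      n^m = trans (cong (n ^_) (sucC2 n″)) (^-distribˡ-+-* n n″ (n″ C 2))
      n^ : ∀ e → n ^ e ≤ 2 ^ (t * e)
      n^ e = ≤-trans (^-monoˡ-≤ e n≤2^t) (≤-reflexive (^-*-assoc 2 t e))
      regroup : ∀ a N b c d k e → a * N * (b * (c * (d * k * e))) ≡ k * (N * ((a * b * c) * (d * e)))
      regroup = solve-∀
      exponents : (2 ^ (t * n″) * 2 ^ (t * K) * 2 ^ (K * n)) * (2 ^ suc (m / q) * 2 ^ suc n″) ≡ 2 ^ X
      exponents = sym (trans (^-distribˡ-+-* 2 (t * n″ + t * K + K * n) (suc (m / q) + suc n″))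
        (cong₂ _*_ (trans (^-distribˡ-+-* 2 (t * n″ + t * K) (K * n))
            (cong (_* 2 ^ (K * n)) (^-distribˡ-+-* 2 (t * n″) (t * K))))
                   (^-distribˡ-+-* 2 (suc (m / q)) (suc n″))))

    small : suc K ^ m * (2 ^ D * w) ≤ n ^ m * (n ^ K * ((2 ^ K) ^ n * ((2 + K) ^ m * 2 ^ suc n″))) → b * w < norm
    small bound = *-cancelˡ-< (2 ^ D) (b * w) norm (begin-strict
      2 ^ D * (b * w)          ≡⟨ rot (2 ^ D) b w ⟩
      b * (2 ^ D * w)          ≤⟨ *-monoʳ-≤ b (collected-bound bound) ⟩
      b * (norm * 2 ^ X)       <⟨ *-monoˡ-<
          (norm * 2 ^ X) {{m*n≢0 norm (2 ^ X) {{m^n≢0 n (n″ C 2)}} {{m^n≢0 2 X}}}} b<2^t ⟩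
      2 ^ t * (norm * 2 ^ X)   ≡⟨ rot′ (2 ^ t) norm (2 ^ X) ⟩
      2 ^ t * 2 ^ X * norm     ≡⟨ cong (_* norm) (^-distribˡ-+-* 2 t X) ⟨
      2 ^ (t + X) * norm       ≤⟨ *-monoˡ-≤ norm (^-monoʳ-≤ 2 exponent-bound) ⟩
      2 ^ D * norm             ∎)
      where
      open ≤-Reasoning
      rot : ∀ a b c → a * (b * c) ≡ b * (a * c)
      rot = solve-∀
      rot′ : ∀ a b c → a * (b * c) ≡ a * c * b
      rot′ = solve-∀

-- Markov's inequality for 2 to the power dim H₁(S;𝔽₂).

module WeightBound where

  open Sums
  open NatSums
  open Exterior using (minors)
  open TorsionBound using (mask; boundaryRows; order-≤-minor)
  open CocycleCount using (isZero; cocycleDefect; betti-≤-cocycles)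
  open Degrees using (degree)
  open CocycleWeight using (cocycle-weight)
  open DegreeSum
  open import Data.Nat
  open import Data.Nat.Properties
  open import Data.Integer using (∣_∣)
  open import Data.Bool using (Bool; true; false; if_then_else_; T)
  open import Data.List as List using (List; []; _∷_)
  open import Data.Vec as Vec using (Vec; lookup)
  open import Data.Product using (proj₁; proj₂)
  open import Data.Unit using (tt)
  open import Relation.Nullary.Decidable using (decidable-stable)
  open import Relation.Binary.PropositionalEquality using (_≡_; refl; sym; trans; cong; subst)

  sumℕ-∑ : {A : Set} (l : List A) (φ : A → ℕ) → sumℕ (List.map φ l) ≡ ∑ l φ
  sumℕ-∑ [] φ = refl
  sumℕ-∑ (x ∷ l) φ = cong (φ x +_) (sumℕ-∑ l φ)

  module _ (h d : (n : ℕ) → Complex n → ℕ) (torsion : IsTorsionOrderFn h) (betti : IsF2BettiFn d) where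

    -- No decision procedure for hypertrees is at hand, but ≤ is stable under double negation. If it
    -- failed, S could not be a hypertree, so h would be 0 there and the inequality would hold.
    torsion-≤-minor : ∀ n′ S → h (suc n′) S ≤ ∣ minors (boundaryRows n′) S ∣
    torsion-≤-minor n′ S = decidable-stable (h (suc n′) S ≤? ∣ minors (boundaryRows n′) S ∣) λ h≰ →
      h≰ (subst (_≤ _) (sym (proj₂ (torsion (suc n′) S) λ ht →
        h≰ (order-≤-minor n′ {S} (trans (proj₁ ht) (sym (faces-mask n′))) (proj₁ (torsion (suc n′) S) ht)))) z≤n)

    -- On the event q D ≤ p n² < q d(S), so 2 ^ D is at most the number of cocycles of S. Exchanging
    -- the sums over S and f then prepares `cocycle-weight` and `degree-sum`.
    weight-bound : ∀ n′ p q D K → .{{NonZero q}} → q * D ≤ p * (suc n′ * suc n′) →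
      suc K ^ faces (mask n′) * (2 ^ D * weightAbove h d p q (suc n′)) ≤
      suc n′ ^ faces (mask n′) *
          (suc n′ ^ K * ((2 ^ K) ^ suc n′ * ((2 + K) ^ faces (mask n′) * 2 ^ holes (mask n′))))
    weight-bound n′ p q D K qD≤ = ≤-trans (*-monoʳ-≤ (suc K ^ faces (mask n′)) markov) (degree-sum n′ K)
      where
      n = suc n′
      Ss = vecs bools (numTri n)
      Fs = vecs bools (List.length (edgeList n))
      μ² : Complex n → ℕ
      μ² S = ∣ minors (boundaryRows n′) S ∣ * ∣ minors (boundaryRows n′) S ∣
      K[_] : Complex n → Vec Bool _ → ℕ
      K[ S ] f = ⟦ isZero (cocycleDefect n S f) ⟧
      event : Complex n → Bool
      event S = (p * (n * n)) <ᵇ (q * d n S)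
      term : ∀ S b → (b ≡ true → D ≤ d n S) → 2 ^ D * (if b then h n S * h n S else 0) ≤ ∑ Fs K[ S ] * μ² S
      term S false _ = ≤-trans (≤-reflexive (*-zeroʳ (2 ^ D))) z≤n
      term S true D≤ = *-mono-≤ (≤-trans (^-monoʳ-≤ 2 (D≤ refl)) (betti-≤-cocycles n {S} (betti n S)))
                                (*-mono-≤ (torsion-≤-minor n′ S) (torsion-≤-minor n′ S))
      D≤d : ∀ S → event S ≡ true → D ≤ d n S
      D≤d S ev = <⇒≤ (*-cancelˡ-< q D (d n S) (≤-<-trans qD≤ (<ᵇ⇒< _ _ (subst T (sym ev) tt))))
      open ≤-Reasoning
      markov : 2 ^ D * weightAbove h d p q n ≤
          ∑ Fs (λ f → ∏ (λ e → if lookup (mask n′) e then degree n f e else 1))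
      markov = begin
        2 ^ D * weightAbove h d p q n
          ≡⟨ cong (2 ^ D *_) (trans (sumℕ-∑ (allSubsets (numTri n)) _)
               (cong (λ l → ∑ l (λ S → if event S then h n S * h n S else 0)) (allSubsets-vecs (numTri n)))) ⟩
        2 ^ D * ∑ Ss (λ S → if event S then h n S * h n S else 0)
          ≡⟨ ∑-*ˡ Ss (2 ^ D) (λ S → if event S then h n S * h n S else 0) ⟨
        ∑ Ss (λ S → 2 ^ D * (if event S then h n S * h n S else 0))
          ≤⟨ ∑-mono Ss (λ S → term S (event S) (D≤d S)) ⟩
        ∑ Ss (λ S → ∑ Fs K[ S ] * μ² S)
          ≡⟨ ∑-cong Ss (λ S → ∑-*ʳ Fs (μ² S) K[ S ]) ⟨
        ∑ Ss (λ S → ∑ Fs (λ f → K[ S ] f * μ² S))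
          ≡⟨ ∑-swap Ss Fs (λ S f → K[ S ] f * μ² S) ⟩
        ∑ Fs (λ f → ∑ Ss (λ S → K[ S ] f * μ² S))
          ≤⟨ ∑-mono Fs (cocycle-weight n′) ⟩
        ∑ Fs (λ f → ∏ (λ e → if lookup (mask n′) e then degree n f e else 1)) ∎

-- The theorem: choice of the constants.

open WeightBound
open DegreeSum
open Numerics
open import Data.Nat
open import Data.Nat.Properties
open import Data.Nat.DivMod using (m≡m%n+[m/n]*n; m%n<n; m/n*n≤m; m*n/n≡m; /-monoˡ-≤)
open import Data.Product using (∃; _,_)
open import Relation.Binary.PropositionalEquality using (_≡_; refl; sym; cong; subst₂)

theorem1 : (h d : (n : ℕ) → Complex n → ℕ) → IsTorsionOrderFn h → IsF2BettiFn d →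
    ∀ (p q : ℕ) → .{{NonZero p}} → .{{NonZero q}} →
    ∀ (a b : ℕ) → .{{NonZero a}} → .{{NonZero b}} →
    ∃ λ N → ∀ n → n ≥ N → b * weightAbove h d p q n < a * normalizer n
theorem1 h d torsion betti p q a b = 2 + T * c , λ n n≥N →
    bound n n≥N (m≤n⇒∃[o]m+o≡n (≤-trans (m≤m+n 2 (T * c)) n≥N))
  where
  -- With t = n / c this gives 8qt ≤ n. The bound T ≤ t provides 3c for `linear-≤-2^` and K < t, and
  -- b for b < 2 ^ t; the summand 2 of the threshold allows n to be written as 2 + n″.
  c = 8 * q
  T = 3 * c + b
  -- The subtraction is exact since q ≥ 1. K is as small as `power-ratio` with blocks of length q
  -- permits.
  K = 2 * q ∸ 2
  instance
    c≢0 : NonZero c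
    c≢0 = m*n≢0 8 q
  K+2≡2q : 2 + K ≡ 2 * q
  K+2≡2q = m+[n∸m]≡n (*-monoʳ-≤ 2 (>-nonZero⁻¹ q))
  bound : ∀ n → n ≥ 2 + T * c → (∃ λ n″ → 2 + n″ ≡ n) → b * weightAbove h d p q n < a * normalizer n
  bound n n≥N (n″ , refl) = <-≤-trans
    (small q b n″ t K (weightAbove h d p q n) K+2≡2q K<t b<2^t n≤2^t
        (≤-trans (≤-reflexive (*-comm c t)) (m/n*n≤m n c))
      (subst₂ (λ m l → suc K ^ m * (2 ^ (n * n / q) * weightAbove h d p q n) ≤
                       n ^ m * (n ^ K * ((2 ^ K) ^ n * ((2 + K) ^ m * 2 ^ l))))
        (faces-mask (suc n″)) (holes-mask (suc n″))
        (weight-bound h d torsion betti (suc n″) p q (n * n / q) K qD≤)))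
    (m≤n*m (normalizer n) a)
    where
    t = n / c
    T≤t : T ≤ t
    T≤t = ≤-trans (≤-reflexive (sym (m*n/n≡m T c))) (/-monoˡ-≤ c (≤-trans (m≤n+m (T * c) 2) n≥N))
    K<t : K < t
    K<t = begin-strict
      K          <⟨ m<n+m K {2} (s≤s z≤n) ⟩
      2 + K      ≡⟨ K+2≡2q ⟩
      2 * q      ≤⟨ *-monoˡ-≤ q {2} {8} (s≤s (s≤s z≤n)) ⟩
      c          ≤⟨ m≤n*m c 3 ⟩
      3 * c      ≤⟨ m≤m+n (3 * c) b ⟩
      T          ≤⟨ T≤t ⟩
      t          ∎
      where open ≤-Reasoning
    b<2^t : b < 2 ^ t
    b<2^t = <-≤-trans (n<2^n b) (^-monoʳ-≤ 2 (≤-trans (m≤n+m b (3 * c)) T≤t))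
    -- Since n ≤ (t + 1) c, it is enough that the linear function c (t + 1) lies below 2 ^ t, which
    -- holds from t = 3c on.
    n≤2^t : n ≤ 2 ^ t
    n≤2^t with m≤n⇒∃[o]m+o≡n (≤-trans (m≤m+n (3 * c) b) T≤t)
    ... | j , eq = begin
      n                    ≡⟨ m≡m%n+[m/n]*n n c ⟩
      n % c + t * c        ≤⟨ +-monoˡ-≤ (t * c) (<⇒≤ (m%n<n n c)) ⟩
      suc t * c            ≡⟨ *-comm (suc t) c ⟩
      c * suc t            ≡⟨ cong (λ z → c * suc z) eq ⟨
      c * suc (3 * c + j)  ≤⟨ linear-≤-2^ c j ⟩
      2 ^ (3 * c + j)      ≡⟨ cong (2 ^_) eq ⟩
      2 ^ t                ∎
      where open ≤-Reasoning
    -- As p ≥ 1, the exponent D = n²/q, rounded down, already lies below the threshold p/q.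
    qD≤ : q * (n * n / q) ≤ p * (n * n)
    qD≤ = ≤-trans (≤-trans (≤-reflexive (*-comm q (n * n / q))) (m/n*n≤m (n * n) q)) (m≤n*m (n * n) p)
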